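{- Let $k \leq n$ be positive integers and let $\lambda = (\lambda_1 \geq \cdots \geq \lambda_s\ge0)$ be a partition of $k$ with $s$ parts. The harmonic space $V_{n,\lambda}$ is the smallest subspace of $\mathbb{Q}[x_1,\dots,x_n]$ which contains $\delta_T$ for every $T \in \mathrm{Inj}(\lambda, \leq n)$ and is closed under the partial derivative operators $\partial/\partial x_1, \dots, \partial/\partial x_n$. Equivalently, $\{ \delta_T : T \in \mathrm{Inj}(\lambda, \leq n) \}$ generates $V_{n,\lambda}$ as a $\mathbb{Q}[x_1,\dots,x_n]$-module under the action $f\odot g$.
   Context: A partition of $k$ with $s$ parts is a weakly decreasing sequence of $s$ nonnegative integers (trailing zeros allowed) summing to $k$; $\lambda'=(\lambda'_1,\dots,\lambda'_n)$ is its conjugate padded with zeros to length $n$. For $S\subseteq[n]$ and $d\ge0$, $e_d(S)$ is the degree $d$ elementary symmetric polynomial in $\{x_i:i\in S\}$ (zero if $d>|S|$). The ideal $I_{n,\lambda}\subseteq\mathbb{Q}[x_1,\dots,x_n]$ is generated by $x_1^s,\dots,x_n^s$ and all $e_d(S)$ with $S\subseteq[n]$ and $d>|S|-\lambda'_n-\cdots-\lambda'_{n-|S|+1}$. For $f\in\mathbb{Q}[x_1,\dots,x_n]$ let $\partial f=f(\partial/\partial x_1,\dots,\partial/\partial x_n)$ and $f\odot g=(\partial f)(g)$; $\langle f,g\rangle$ is the constant term of $f\odot g$. The harmonic space is $V_{n,\lambda}=\{g:\langle f,g\rangle=0\ \forall f\in I_{n,\lambda}\}$. $\mathrm{Inj}(\lambda,\le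 n)$: fillings of the Young diagram of $\lambda$ with distinct integers in $[n]$ strictly increasing down columns. For such $T$, $\mathbf{x}(T)=\prod_i x_i^{a_i}$ with $a_i$ the number of boxes directly below $i$ in its column if $i$ appears in $T$, else $a_i=s-1$; $C_T\subseteq\mathfrak{S}_n$ is the group of permutations stabilizing each column's entry set and fixing entries not in $T$; $\mathfrak{S}_n$ permutes variable subscripts; $\delta_T=\sum_{w\in C_T}\mathrm{sign}(w)\,w\cdot\mathbf{x}(T)$. -}

module Defs where

open import Data.Nat as ℕ using (ℕ; zero; suc; _∸_; _<_; _≤_)
open import Data.Integer using (+_)
open import Data.Rational as Q using (ℚ; 0ℚ; 1ℚ)
open import Data.Fin as F using (Fin; toℕ)
open import Data.Fin.Subset using (Subset)
open import Data.Vec as V using (Vec; []; _∷_; lookup; allFin; replicate; zipWith)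
open import Data.Vec.Properties using (≡-dec)
open import Data.List as L using (List; []; _∷_; _++_; map; concatMap; upTo; foldr)
open import Data.Nat.ListAction using (sum)
open import Data.Product using (_×_; _,_; Σ; ∃)
open import Data.Bool using (Bool; true; false; if_then_else_; _∧_)
open import Data.Maybe using (Maybe; just; nothing)
open import Relation.Nullary.Decidable using (⌊_⌋; does)
open import Relation.Binary.PropositionalEquality using (_≡_)

-- Polynomials in ℚ[x₁,…,xₙ] (variables indexed by Fin n, 0-based),
-- represented as finite lists of terms (coefficient , exponent vector).
-- Two representations denote the same polynomial iff all coefficients agree.

Mon : ℕ → Set
Mon n = Vec ℕ n

Poly : ℕ → Set
Poly n = List (ℚ × Mon n)

ℕ→ℚ : ℕ → ℚ
ℕ→ℚ m = (+ m) Q./ 1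

coeff : ∀ {n} → Poly n → Mon n → ℚ
coeff []             α = 0ℚ
coeff ((c , β) ∷ p) α =
  if does (≡-dec ℕ._≟_ β α) then c Q.+ coeff p α else coeff p α

_≈_ : ∀ {n} → Poly n → Poly n → Set
p ≈ q = ∀ α → coeff p α ≡ coeff q α

zeroP : ∀ {n} → Poly n
zeroP = []

oneP : ∀ {n} → Poly n
oneP {n} = (1ℚ , replicate n 0) ∷ []

_⊕_ : ∀ {n} → Poly n → Poly n → Poly n
p ⊕ q = p ++ q

_·_ : ∀ {n} → ℚ → Poly n → Poly n
c · p = map (λ { (d , β) → (c Q.* d , β) }) p

_⊗_ : ∀ {n} → Poly n → Poly n → Poly n
p ⊗ q = concatMap (λ { (c , α) → map (λ { (d , β) → (c Q.* d , zipWith ℕ._+_ α β) }) q }) p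

mono : ∀ {n} → Mon n → Poly n
mono α = (1ℚ , α) ∷ []

unitVec : ∀ {n} → Fin n → Mon n
unitVec {n} i = V.tabulate (λ j → if does (i F.≟ j) then 1 else 0)

var : ∀ {n} → Fin n → Poly n
var i = mono (unitVec i)

_^P_ : ∀ {n} → Poly n → ℕ → Poly n
p ^P zero  = oneP
p ^P suc m = p ⊗ (p ^P m)

∂ : ∀ {n} → Fin n → Poly n → Poly n
∂ i = map (λ { (c , α) → (c Q.* ℕ→ℚ (lookup α i) , V.updateAt α i (λ e → e ∸ 1)) })

∂^ : ∀ {n} → Fin n → ℕ → Poly n → Poly n
∂^ i zero    g = g
∂^ i (suc m) g = ∂ i (∂^ i m g)

∂Mon : ∀ {n} → Mon n → Poly n → Poly n
∂Mon {n} α g = foldr (λ i h → ∂^ i (lookup α i) h) g (V.toList (allFin n))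

_⊙_ : ∀ {n} → Poly n → Poly n → Poly n
f ⊙ g = concatMap (λ { (c , α) → c · ∂Mon α g }) f

⟨_,_⟩ : ∀ {n} → Poly n → Poly n → ℚ
⟨_,_⟩ {n} f g = coeff (f ⊙ g) (replicate n 0)

esymMons : ∀ {m} → ℕ → Subset m → List (Mon m)
esymMons {m} zero    S            = replicate m 0 ∷ []
esymMons     (suc d) []           = []
esymMons     (suc d) (true ∷ S)  =
  map (1 ∷_) (esymMons d S) ++ map (0 ∷_) (esymMons (suc d) S)
esymMons     (suc d) (false ∷ S) = map (0 ∷_) (esymMons (suc d) S)

esym : ∀ {n} → ℕ → Subset n → Poly n
esym d S = map (λ α → (1ℚ , α)) (esymMons d S)

card : ∀ {n} → Subset n → ℕ
card []          = 0
card (true ∷ S)  = suc (card S)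
card (false ∷ S) = card S

IsPartition : ∀ {s} → ℕ → Vec ℕ s → Set
IsPartition {s} k lam =
  (∀ (i j : Fin s) → toℕ i ≤ toℕ j → lookup lam j ≤ lookup lam i)
  × V.sum lam ≡ k

-- conjugate: λ'_j = #{ i : λ_i ≥ j }  (j ≥ 1, 1-based)
conj : ∀ {s} → Vec ℕ s → ℕ → ℕ
conj lam j = L.length (L.filter (λ x → j ℕ.≤? x) (V.toList lam))

tailConj : ∀ {s} → ℕ → Vec ℕ s → ℕ → ℕ
tailConj n lam m = sum (map (λ t → conj lam (n ∸ t)) (upTo m))

data IsGen {s : ℕ} (n : ℕ) (lam : Vec ℕ s) : Poly n → Set where
  powGen  : (i : Fin n) → IsGen n lam (var i ^P s)
  esymGen : (S : Subset n) (d : ℕ) →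
            card S < d ℕ.+ tailConj n lam (card S) →   -- d > |S| - (λ'_n + ⋯ + λ'_{n-|S|+1})
            IsGen n lam (esym d S)

data InIdeal {s : ℕ} (n : ℕ) (lam : Vec ℕ s) : Poly n → Set where
  gen  : ∀ {f} → IsGen n lam f → InIdeal n lam f
  zer  : InIdeal n lam zeroP
  add  : ∀ {f g} → InIdeal n lam f → InIdeal n lam g → InIdeal n lam (f ⊕ g)
  mul  : ∀ (h : Poly n) {f} → InIdeal n lam f → InIdeal n lam (h ⊗ f)
  resp : ∀ {f f'} → InIdeal n lam f → f ≈ f' → InIdeal n lam f'

InHarmonic : ∀ {s} (n : ℕ) (lam : Vec ℕ s) → Poly n → Set
InHarmonic n lam g = ∀ f → InIdeal n lam f → ⟨ f , g ⟩ ≡ 0ℚ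

-- Inj(λ, ≤ n). A filling assigns to the cell in row i (Fin s) and column
-- j (ℕ, 0-based; only j < λ_i is a cell) an entry in [n] ≅ Fin n.

Cell : ∀ {s} → Vec ℕ s → Set
Cell {s} lam = Σ (Fin s) (λ i → Σ ℕ (λ j → j < lookup lam i))

Filling : ℕ → ℕ → Set
Filling s n = Fin s → ℕ → Fin n

IsInj : ∀ {s n} → Vec ℕ s → Filling s n → Set
IsInj {s} lam T =
  (∀ (c c' : Cell lam) →
     T (Data.Product.proj₁ c) (Data.Product.proj₁ (Data.Product.proj₂ c))
       ≡ T (Data.Product.proj₁ c') (Data.Product.proj₁ (Data.Product.proj₂ c'))
     → c ≡ c')
  ×
  (∀ (i i' : Fin s) (j : ℕ) → toℕ i < toℕ i' → j < lookup lam i' →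
     toℕ (T i j) < toℕ (T i' j))

cells : ∀ {s} → Vec ℕ s → List (Fin s × ℕ)
cells {s} lam = concatMap (λ i → map (λ j → (i , j)) (upTo (lookup lam i))) (V.toList (allFin s))

boxesBelow : ∀ {s} → Vec ℕ s → Fin s → ℕ → ℕ
boxesBelow {s} lam i j =
  L.length (L.filter (λ i' → (toℕ i ℕ.<? toℕ i') Relation.Nullary.Decidable.×-dec (j ℕ.<? lookup lam i'))
                     (V.toList (allFin s)))

colOf : ∀ {s n} → Vec ℕ s → Filling s n → Fin n → Maybe ℕ
colOf lam T v = foldr (λ { (i , j) r → if does (T i j F.≟ v) then just j else r }) nothing (cells lam)

expT : ∀ {s n} → Vec ℕ s → Filling s n → Fin n → ℕ
expT {s} lam T v =
  foldr (λ { (i , j) r → if does (T i j F.≟ v) then boxesBelow lam i j else r }) (s ∸ 1) (cells lam)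

monT : ∀ {s n} → Vec ℕ s → Filling s n → Mon n
monT lam T = V.tabulate (expT lam T)

-- The symmetric group 𝔖ₙ: a permutation w is the vector (w(0),…,w(n-1)).

inserts : ∀ {A : Set} {m} → A → Vec A m → List (Vec A (suc m))
inserts x []       = (x ∷ []) ∷ []
inserts x (y ∷ ys) = (x ∷ y ∷ ys) ∷ map (y ∷_) (inserts x ys)

perms : ∀ {A : Set} {m} → Vec A m → List (Vec A m)
perms []       = [] ∷ []
perms (x ∷ xs) = concatMap (inserts x) (perms xs)

allPerms : (n : ℕ) → List (Vec (Fin n) n)
allPerms n = perms (allFin n)

inversions : ∀ {n} → Vec (Fin n) n → ℕ
inversions {n} w =
  L.length (L.filter (λ { (a , b) → (toℕ a ℕ.<? toℕ b) Relation.Nullary.Decidable.×-dec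
                                    (toℕ (lookup w b) ℕ.<? toℕ (lookup w a)) })
           (L.cartesianProduct (V.toList (allFin n)) (V.toList (allFin n))))

sign : ∀ {n} → Vec (Fin n) n → ℚ
sign w = if isEven (inversions w) then 1ℚ else Q.- 1ℚ
  where
  isEven : ℕ → Bool
  isEven zero = true
  isEven (suc zero) = false
  isEven (suc (suc m)) = isEven m

actMon : ∀ {n} → Vec (Fin n) n → Mon n → Mon n
actMon {n} w a = V.tabulate (λ v → V.sum (V.tabulate (λ i → if does (lookup w i F.≟ v) then lookup a i else 0)))

inColGroup : ∀ {s n} → Vec ℕ s → Filling s n → Vec (Fin n) n → Bool
inColGroup {n = n} lam T w = V.foldr _ (λ b r → b ∧ r) true (V.tabulate test)
  where
  eqM : Maybe ℕ → Maybe ℕ → Bool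
  eqM (just a) (just b) = does (a ℕ.≟ b)
  eqM nothing  nothing  = true
  eqM _        _        = false
  test : Fin n → Bool
  test v with colOf lam T v
  ... | just j  = eqM (colOf lam T (lookup w v)) (just j)
  ... | nothing = does (lookup w v F.≟ v)

δ : ∀ {s n} → Vec ℕ s → Filling s n → Poly n
δ {n = n} lam T =
  concatMap (λ w → if inColGroup lam T w then (sign w , actMon w (monT lam T)) ∷ [] else [])
            (allPerms n)

data InDerivSpan {s : ℕ} (n : ℕ) (lam : Vec ℕ s) : Poly n → Set where
  base : (T : Filling s n) → IsInj lam T → InDerivSpan n lam (δ lam T)
  zer  : InDerivSpan n lam zeroP
  add  : ∀ {f g} → InDerivSpan n lam f → InDerivSpan n lam g → InDerivSpan n lam (f ⊕ g)
  scal : (c : ℚ) → ∀ {f} → InDerivSpan n lam f → InDerivSpan n lam (c · f)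
  der  : (i : Fin n) → ∀ {f} → InDerivSpan n lam f → InDerivSpan n lam (∂ i f)
  resp : ∀ {f f'} → InDerivSpan n lam f → f ≈ f' → InDerivSpan n lam f'

data InOdotModule {s : ℕ} (n : ℕ) (lam : Vec ℕ s) : Poly n → Set where
  base : (T : Filling s n) → IsInj lam T → InOdotModule n lam (δ lam T)
  zer  : InOdotModule n lam zeroP
  add  : ∀ {f g} → InOdotModule n lam f → InOdotModule n lam g → InOdotModule n lam (f ⊕ g)
  act  : (h : Poly n) → ∀ {f} → InOdotModule n lam f → InOdotModule n lam (h ⊙ f)
  resp : ∀ {f f'} → InOdotModule n lam f → f ≈ f' → InOdotModule n lam f'

{-# OPTIONS --safe #-}
module Submission where

-- Let K(g) be the function sending a monomial to its pairing with g.  On such functions ∂/∂xᵢ is a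
-- shift of exponents, and g is harmonic when certain sums of shifts of K(g) vanish.
--
-- δ_T is harmonic: in e_d(S) ⊙ δ_T the coefficient of x^β vanishes by antisymmetry if β repeats an
-- exponent in a column of T contained in S.  Otherwise only the d-subsets U of S disjoint from every
-- column contained in S contribute, and those columns are too large to leave room for such a U.
--
-- Conversely let g be harmonic of degree i in the first variable x₀.  Its leading coefficient in x₀ is
-- harmonic for the shape obtained from λ by removing a box, the last one of the column that ends row i
-- (no box if row i is empty), as in the recursion of Garsia and Procesi.  By induction it is a
-- combination of derivatives of the δ_T' of that shape.  Placing x₀ on top of the column of T' that lost
-- the box (or outside T') gives a T such that a derivative of δ_T by x₀ has leading term c x₀ⁱ δ_T'.
-- Subtracting these derivatives lowers the degree of g in x₀.

open import Defs
open import Data.Nat as ℕ using (ℕ; zero; suc; _≤_; _<_; z≤n; s≤s; _∸_)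
import Data.Nat.Properties as ℕ
open import Data.Nat.DivMod using (_mod_; m<n⇒m%n≡m)
open import Data.Nat.ListAction using () renaming (sum to sumᴸ)
open import Data.Rational using (ℚ; 0ℚ; 1ℚ; _+_; _*_; -_; _-_; 1/_; ≢-nonZero)
import Data.Rational.Properties as ℚ
open import Data.Rational.Solver using (module +-*-Solver)
open import Data.Fin as F using (Fin; zero; suc; toℕ)
import Data.Fin.Properties as F
open import Data.Fin.Permutation.Components using (transpose)
open import Data.Fin.Relation.Unary.Top using (view; ‵fromℕ; ‵inject₁)
open import Data.Fin.Subset using (Subset)
open import Data.Vec as V using (Vec; []; _∷_; lookup; allFin; replicate; zipWith; tabulate)
import Data.Vec.Properties as V
import Data.Vec.Membership.Propositional.Properties as VMem
import Data.Vec.Relation.Unary.All as VAll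
open VAll using ([]; _∷_) renaming (All to VAll)
open import Data.List as L using (List; []; _∷_; _++_; map; concatMap; foldr; upTo; applyUpTo)
import Data.List.Properties as L
open import Data.List.Membership.Propositional using (_∈_; find; lose)
import Data.List.Membership.Propositional.Properties as Mem
open import Data.List.Relation.Unary.All as All using (All; []; _∷_)
import Data.List.Relation.Unary.All.Properties as All
open import Data.List.Relation.Unary.Any using (here; there)
open import Data.Product using (_×_; _,_; ∃; proj₁; proj₂)
open import Data.Sum using (inj₁; inj₂)
open import Data.Bool using (Bool; true; false; if_then_else_; _∧_)
open import Data.Bool.Properties using () renaming (_≟_ to _≟ᵇ_)
open import Data.Maybe using (Maybe; just; nothing)
import Data.Maybe.Properties as Maybe
open import Data.Empty using (⊥; ⊥-elim)
open import Function using (_∘_; id)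
open import Function.Bundles using (_⇔_; mk⇔)
open import Relation.Nullary using (¬_; yes; no; Dec)
open import Relation.Nullary.Decidable
  using (does; dec-true; dec-false; does-⇔; _×-dec_; _→-dec_; ¬?)
open import Relation.Binary.PropositionalEquality hiding (resp)
open import Algebra.Properties.CommutativeMonoid.Sum ℕ.+-0-commutativeMonoid
  using (sum; ∑-comm; ∑-distrib-+; sum-cong-≗; sum-init-last)
open import Algebra.Properties.Semiring.Sum ℕ.+-*-semiring using (*-distribʳ-sum)

-- The induction leaves the range k ≤ n: passing to the leading coefficient always drops a variable
-- but not always a box, so the shape may outgrow the variables. Then the relation for e_0 and the
-- full set puts 1 into the ideal, and no filling exists, so both sides are zero. For this the
-- threshold has to count all boxes of λ in columns beyond n - |S|, whereas λ′ₙ + ⋯ + λ′ₙ₋ₘ₊₁ stops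
-- at column n. Hence `excess`, which agrees with `tailConj` as soon as λ₁ ≤ n.
--
-- The two inclusions are not independent: after a derivative of δ_T is subtracted, the remainder
-- has to be harmonic again, and this is the first inclusion.
--
-- Why the leading coefficients match: x₀ on top of its column has the strictly largest exponent
-- there, and outside T it is fixed by the column group. So only permutations fixing x₀ reach the
-- top degree, and the leading coefficient of δ_T is δ_T′. That top degree is the number of boxes
-- below x₀, or s - 1 outside T; the removed box is chosen so that it is at least i, and derivatives
-- by x₀ bring it down to i.

private variable
  A B X Y : Set
  m n s N : ℕ

-- Polynomials through their pairings with monomials

∑ : List A → (A → ℚ) → ℚ
∑ []       f = 0ℚ
∑ (x ∷ xs) f = f x + ∑ xs f

∑-cong : ∀ (xs : List A) {f g : A → ℚ} → (∀ x → f x ≡ g x) → ∑ xs f ≡ ∑ xs g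
∑-cong []       e = refl
∑-cong (x ∷ xs) e = cong₂ _+_ (e x) (∑-cong xs e)

∑-++ : ∀ (xs ys : List A) (f : A → ℚ) → ∑ (xs ++ ys) f ≡ ∑ xs f + ∑ ys f
∑-++ []       ys f = sym (ℚ.+-identityˡ _)
∑-++ (x ∷ xs) ys f = trans (cong (f x +_) (∑-++ xs ys f)) (sym (ℚ.+-assoc (f x) _ _))

∑-map : ∀ (g : B → A) xs (f : A → ℚ) → ∑ (map g xs) f ≡ ∑ xs (f ∘ g)
∑-map g []       f = refl
∑-map g (x ∷ xs) f = cong (f (g x) +_) (∑-map g xs f)

∑-concatMap : ∀ (g : B → List A) xs (f : A → ℚ) → ∑ (concatMap g xs) f ≡ ∑ xs (λ x → ∑ (g x) f)
∑-concatMap g []       f = refl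
∑-concatMap g (x ∷ xs) f =
  trans (∑-++ (g x) (concatMap g xs) f) (cong (∑ (g x) f +_) (∑-concatMap g xs f))

∑-zero : ∀ (xs : List A) {f : A → ℚ} → (∀ x → f x ≡ 0ℚ) → ∑ xs f ≡ 0ℚ
∑-zero []       e = refl
∑-zero (x ∷ xs) e = trans (cong₂ _+_ (e x) (∑-zero xs e)) (ℚ.+-identityˡ 0ℚ)

∑-*ˡ : ∀ c (xs : List A) (f : A → ℚ) → ∑ xs (λ x → c * f x) ≡ c * ∑ xs f
∑-*ˡ c []       f = sym (ℚ.*-zeroʳ c)
∑-*ˡ c (x ∷ xs) f = trans (cong (c * f x +_) (∑-*ˡ c xs f)) (sym (ℚ.*-distribˡ-+ c (f x) _))

+-interchange : ∀ a b c d → (a + b) + (c + d) ≡ (a + c) + (b + d)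
+-interchange = solve 4 (λ a b c d → (a :+ b) :+ (c :+ d) := (a :+ c) :+ (b :+ d)) refl
  where open +-*-Solver

∑-+ : ∀ (xs : List A) (f g : A → ℚ) → ∑ xs (λ x → f x + g x) ≡ ∑ xs f + ∑ xs g
∑-+ []       f g = sym (ℚ.+-identityˡ 0ℚ)
∑-+ (x ∷ xs) f g = trans (cong (f x + g x +_) (∑-+ xs f g)) (+-interchange (f x) (g x) _ _)

Fn : ℕ → Set
Fn n = Mon n → ℚ

infixl 6 _⊞_
_⊞_ : Mon n → Mon n → Mon n
_⊞_ = zipWith ℕ._+_

⊞-assoc : ∀ (α β γ : Mon n) → (α ⊞ β) ⊞ γ ≡ α ⊞ (β ⊞ γ)
⊞-assoc = V.zipWith-assoc ℕ.+-assoc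

⊞-comm : ∀ (α β : Mon n) → α ⊞ β ≡ β ⊞ α
⊞-comm = V.zipWith-comm ℕ.+-comm

⊞-identityˡ : ∀ (α : Mon n) → replicate n 0 ⊞ α ≡ α
⊞-identityˡ = V.zipWith-identityˡ ℕ.+-identityˡ

⊞-identityʳ : ∀ (α : Mon n) → α ⊞ replicate n 0 ≡ α
⊞-identityʳ = V.zipWith-identityʳ ℕ.+-identityʳ

inc : Fin n → Mon n → Mon n
inc i α = V.updateAt α i suc

inc≡⊞ : ∀ (i : Fin n) β → inc i β ≡ unitVec i ⊞ β
inc≡⊞ zero (b ∷ β) = cong (suc b ∷_)
  (trans (sym (⊞-identityˡ β)) (cong (_⊞ β) (sym (tabulate-const _))))
  where
  tabulate-const : ∀ m → V.tabulate {n = m} (λ _ → 0) ≡ replicate m 0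
  tabulate-const zero = refl
  tabulate-const (suc m) = cong (0 ∷_) (tabulate-const m)
inc≡⊞ (suc i) (b ∷ β) = cong (b ∷_) (inc≡⊞ i β)

inc-⊞ : ∀ (i : Fin n) α β → inc i (α ⊞ β) ≡ inc i α ⊞ β
inc-⊞ i α β = trans (inc≡⊞ i (α ⊞ β)) (trans (sym (⊞-assoc (unitVec i) α β)) (cong (_⊞ β) (sym (inc≡⊞ i α))))

⊞-inc : ∀ (i : Fin n) α β → inc i (α ⊞ β) ≡ α ⊞ inc i β
⊞-inc i α β = trans (cong (inc i) (⊞-comm α β)) (trans (inc-⊞ i β α) (⊞-comm (inc i β) α))

inc^ : Fin n → ℕ → Mon n → Mon n
inc^ i zero    β = β
inc^ i (suc m) β = inc^ i m (inc i β)

inc^-zero : ∀ m b (β : Mon n) → inc^ zero m (b ∷ β) ≡ b ℕ.+ m ∷ β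
inc^-zero zero    b β = cong (_∷ β) (sym (ℕ.+-identityʳ b))
inc^-zero (suc m) b β = trans (inc^-zero m (suc b) β) (cong (_∷ β) (sym (ℕ.+-suc b m)))

inc^-suc : ∀ (i : Fin n) m b (β : Mon n) → inc^ (suc i) m (b ∷ β) ≡ b ∷ inc^ i m β
inc^-suc i zero    b β = refl
inc^-suc i (suc m) b β = inc^-suc i m b (inc i β)

ℕ→ℚ-suc≢0 : ∀ m → ℕ→ℚ (suc m) ≢ 0ℚ
ℕ→ℚ-suc≢0 m = ≢-sym (ℚ.<⇒≢ (ℚ.positive⁻¹ (ℕ→ℚ (suc m)) {{ℚ.normalize-pos (suc m) 1}}))

*-≢0 : ∀ {p q} → p ≢ 0ℚ → q ≢ 0ℚ → p * q ≢ 0ℚ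
*-≢0 {p} {q} p≢0 q≢0 e = q≢0 (begin
  q              ≡⟨ ℚ.*-identityˡ q ⟨
  1ℚ * q         ≡⟨ cong (_* q) (ℚ.*-inverseˡ p) ⟨
  (1/ p * p) * q ≡⟨ ℚ.*-assoc (1/ p) p q ⟩
  1/ p * (p * q) ≡⟨ cong (1/ p *_) e ⟩
  1/ p * 0ℚ      ≡⟨ ℚ.*-zeroʳ (1/ p) ⟩
  0ℚ             ∎)
  where
  open ≡-Reasoning
  instance _ = ≢-nonZero p≢0

*-cancelˡ : ∀ {p q r} → p ≢ 0ℚ → p * q ≡ p * r → q ≡ r
*-cancelˡ {p} {q} {r} p≢0 e = begin
  q              ≡⟨ lem q ⟨
  1/ p * (p * q) ≡⟨ cong (1/ p *_) e ⟩
  1/ p * (p * r) ≡⟨ lem r ⟩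
  r              ∎
  where
  open ≡-Reasoning
  instance _ = ≢-nonZero p≢0
  lem : ∀ x → 1/ p * (p * x) ≡ x
  lem x = trans (sym (ℚ.*-assoc (1/ p) p x)) (trans (cong (_* x) (ℚ.*-inverseˡ p)) (ℚ.*-identityˡ x))

*-leftComm : ∀ x y z → x * (y * z) ≡ y * (x * z)
*-leftComm = solve 3 (λ x y z → x :* (y :* z) := y :* (x :* z)) refl
  where open +-*-Solver

fact : ℕ → ℚ
fact zero    = 1ℚ
fact (suc m) = ℕ→ℚ (suc m) * fact m

fact≢0 : ∀ m → fact m ≢ 0ℚ
fact≢0 zero    = λ ()
fact≢0 (suc m) = *-≢0 (ℕ→ℚ-suc≢0 m) (fact≢0 m)

fac : Mon n → ℚ
fac []      = 1ℚ
fac (a ∷ α) = fact a * fac α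

fac≢0 : ∀ (α : Mon n) → fac α ≢ 0ℚ
fac≢0 []      = λ ()
fac≢0 (a ∷ α) = *-≢0 (fact≢0 a) (fac≢0 α)

fac-inc : ∀ i (α : Mon n) → fac (inc i α) ≡ ℕ→ℚ (suc (lookup α i)) * fac α
fac-inc zero    (a ∷ α) = ℚ.*-assoc (ℕ→ℚ (suc a)) (fact a) (fac α)
fac-inc (suc i) (a ∷ α) = trans (cong (fact a *_) (fac-inc i α)) (*-leftComm (fact a) (ℕ→ℚ (suc (lookup α i))) (fac α))

-- K g α is the pairing of x^α with g; the factorials turn ∂/∂xᵢ into a shift.
K : Poly n → Fn n
K g α = fac α * coeff g α

K-cong : ∀ (p q : Poly n) → p ≈ q → ∀ β → K p β ≡ K q β
K-cong p q e β = cong (fac β *_) (e β)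

K-injective : ∀ (p q : Poly n) → (∀ β → K p β ≡ K q β) → p ≈ q
K-injective p q e β = *-cancelˡ (fac≢0 β) (e β)

coeff-⊕ : ∀ (p q : Poly n) α → coeff (p ⊕ q) α ≡ coeff p α + coeff q α
coeff-⊕ []            q α = sym (ℚ.+-identityˡ _)
coeff-⊕ ((c , β) ∷ p) q α with does (V.≡-dec ℕ._≟_ β α)
... | true  = trans (cong (c +_) (coeff-⊕ p q α)) (sym (ℚ.+-assoc c _ _))
... | false = coeff-⊕ p q α

coeff-· : ∀ c (p : Poly n) α → coeff (c · p) α ≡ c * coeff p α
coeff-· c []            α = sym (ℚ.*-zeroʳ c)
coeff-· c ((d , β) ∷ p) α with does (V.≡-dec ℕ._≟_ β α)
... | true  = trans (cong (c * d +_) (coeff-· c p α)) (sym (ℚ.*-distribˡ-+ c d _))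
... | false = coeff-· c p α

K-⊕ : ∀ (p q : Poly n) α → K (p ⊕ q) α ≡ K p α + K q α
K-⊕ p q α = trans (cong (fac α *_) (coeff-⊕ p q α)) (ℚ.*-distribˡ-+ (fac α) _ _)

K-· : ∀ c (p : Poly n) α → K (c · p) α ≡ c * K p α
K-· c p α = trans (cong (fac α *_) (coeff-· c p α)) (*-leftComm (fac α) c _)

inc-dec : ∀ (i : Fin n) α a → lookup α i ≡ suc a → inc i (V.updateAt α i (λ e → e ∸ 1)) ≡ α
inc-dec zero    (x ∷ α) a refl = refl
inc-dec (suc i) (x ∷ α) a e    = cong (x ∷_) (inc-dec i α a e)

dec-inc : ∀ (i : Fin n) β → V.updateAt (inc i β) i (λ e → e ∸ 1) ≡ β
dec-inc zero    (x ∷ β) = refl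
dec-inc (suc i) (x ∷ β) = cong (x ∷_) (dec-inc i β)

lookup-inc : ∀ (i : Fin n) β → lookup (inc i β) i ≡ suc (lookup β i)
lookup-inc i β = V.lookup∘updateAt i β

coeff-∂ : ∀ i (g : Poly n) β → coeff (∂ i g) β ≡ ℕ→ℚ (suc (lookup β i)) * coeff g (inc i β)
coeff-∂ i []            β = sym (ℚ.*-zeroʳ (ℕ→ℚ (suc (lookup β i))))
coeff-∂ i ((c , α) ∷ g) β
  with V.≡-dec ℕ._≟_ (V.updateAt α i (λ e → e ∸ 1)) β | V.≡-dec ℕ._≟_ α (inc i β)
... | yes e | yes refl = trans
        (cong₂ _+_ (trans (cong (λ z → c * ℕ→ℚ z) (lookup-inc i β)) (ℚ.*-comm c _)) (coeff-∂ i g β))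
        (sym (ℚ.*-distribˡ-+ (ℕ→ℚ (suc (lookup β i))) c _))
... | no ¬e | yes refl = ⊥-elim (¬e (dec-inc i β))
... | no ¬e | no ¬e′   = coeff-∂ i g β
-- Truncated subtraction sends the exponent 0 to 0, so a term free of the variable `i` can match
-- `β`; it carries the factor 0.
... | yes e | no ¬e′ with lookup α i in eq
...   | zero  = trans (cong (_+ coeff (∂ i g) β) (ℚ.*-zeroʳ c)) (trans (ℚ.+-identityˡ _) (coeff-∂ i g β))
...   | suc a = ⊥-elim (¬e′ (trans (sym (inc-dec i α a eq)) (cong (inc i) e)))

K-∂ : ∀ i (g : Poly n) β → K (∂ i g) β ≡ K g (inc i β)
K-∂ i g β = begin
  fac β * coeff (∂ i g) β                                 ≡⟨ cong (fac β *_) (coeff-∂ i g β) ⟩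
  fac β * (ℕ→ℚ (suc (lookup β i)) * coeff g (inc i β))    ≡⟨ *-leftComm (fac β) (ℕ→ℚ (suc (lookup β i))) _ ⟩
  ℕ→ℚ (suc (lookup β i)) * (fac β * coeff g (inc i β))    ≡⟨ ℚ.*-assoc (ℕ→ℚ (suc (lookup β i))) (fac β) _ ⟨
  (ℕ→ℚ (suc (lookup β i)) * fac β) * coeff g (inc i β)    ≡⟨ cong (_* coeff g (inc i β)) (fac-inc i β) ⟨
  fac (inc i β) * coeff g (inc i β)                       ∎
  where open ≡-Reasoning

K-∂^ : ∀ i m (g : Poly n) β → K (∂^ i m g) β ≡ K g (inc^ i m β)
K-∂^ i zero    g β = refl
K-∂^ i (suc m) g β = trans (K-∂ i (∂^ i m g) β) (K-∂^ i m g (inc i β))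

incs : Mon n → List (Fin n) → Mon n → Mon n
incs α []      β = β
incs α (i ∷ l) β = incs α l (inc^ i (lookup α i) β)

incs-map-suc : ∀ a (α : Mon n) l b β → incs (a ∷ α) (map suc l) (b ∷ β) ≡ b ∷ incs α l β
incs-map-suc a α []      b β = refl
incs-map-suc a α (i ∷ l) b β =
  trans (cong (incs (a ∷ α) (map suc l)) (inc^-suc i (lookup α i) b β)) (incs-map-suc a α l b _)

toList-allFin-suc : ∀ n → V.toList (allFin (suc n)) ≡ zero ∷ map suc (V.toList (allFin n))
toList-allFin-suc n = cong (zero ∷_)
  (trans (cong V.toList (V.tabulate-∘ suc id)) (V.toList-map suc (allFin n)))

incs-allFin : ∀ (α β : Mon n) → incs α (V.toList (allFin n)) β ≡ β ⊞ α
incs-allFin []      []      = refl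
incs-allFin {suc n} (a ∷ α) (b ∷ β) = begin
  incs (a ∷ α) (V.toList (allFin (suc n))) (b ∷ β)
    ≡⟨ cong (λ l → incs (a ∷ α) l (b ∷ β)) (toList-allFin-suc n) ⟩
  incs (a ∷ α) (map suc (V.toList (allFin n))) (inc^ zero a (b ∷ β))
    ≡⟨ cong (incs (a ∷ α) (map suc (V.toList (allFin n)))) (inc^-zero a b β) ⟩
  incs (a ∷ α) (map suc (V.toList (allFin n))) (b ℕ.+ a ∷ β)
    ≡⟨ incs-map-suc a α (V.toList (allFin n)) (b ℕ.+ a) β ⟩
  b ℕ.+ a ∷ incs α (V.toList (allFin n)) β
    ≡⟨ cong (b ℕ.+ a ∷_) (incs-allFin α β) ⟩
  b ℕ.+ a ∷ (β ⊞ α) ∎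
  where open ≡-Reasoning

K-∂Mon : ∀ α (g : Poly n) β → K (∂Mon α g) β ≡ K g (β ⊞ α)
K-∂Mon {n} α g β = trans (go (V.toList (allFin n)) β) (cong (K g) (incs-allFin α β))
  where
  go : ∀ l β → K (foldr (λ i h → ∂^ i (lookup α i) h) g l) β ≡ K g (incs α l β)
  go []      β = refl
  go (i ∷ l) β = trans (K-∂^ i (lookup α i) _ β) (go l _)

K-⊙ : ∀ (f g : Poly n) β → K (f ⊙ g) β ≡ ∑ f (λ z → proj₁ z * K g (β ⊞ proj₂ z))
K-⊙ []            g β = ℚ.*-zeroʳ (fac β)
K-⊙ ((c , α) ∷ f) g β = trans (K-⊕ (c · ∂Mon α g) (f ⊙ g) β)
  (cong₂ _+_ (trans (K-· c (∂Mon α g) β) (cong (c *_) (K-∂Mon α g β))) (K-⊙ f g β))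

fac-0 : ∀ n → fac (replicate n 0) ≡ 1ℚ
fac-0 zero    = refl
fac-0 (suc n) = trans (ℚ.*-identityˡ _) (fac-0 n)

-- For `G = K g` this is `K (f ⊙ g) β`, a combination of shifts of `G`. Keeping `β` free records the
-- pairings of `g` with all monomial multiples of `f`.
pairAt : Poly n → Fn n → Mon n → ℚ
pairAt f G β = ∑ f (λ z → proj₁ z * G (β ⊞ proj₂ z))

⟨⟩≡pairAt : ∀ (f g : Poly n) → ⟨ f , g ⟩ ≡ pairAt f (K g) (replicate n 0)
⟨⟩≡pairAt {n} f g = begin
  coeff (f ⊙ g) (replicate n 0)  ≡⟨ ℚ.*-identityˡ _ ⟨
  1ℚ * coeff (f ⊙ g) (replicate n 0)  ≡⟨ cong (_* coeff (f ⊙ g) (replicate n 0)) (fac-0 n) ⟨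
  K (f ⊙ g) (replicate n 0) ≡⟨ K-⊙ f g (replicate n 0) ⟩
  pairAt f (K g) (replicate n 0) ∎
  where open ≡-Reasoning

-- Equivalent lists cannot be matched term by term, so the recursion runs over the other argument: a
-- single term `(d , γ)` there sees `f` only through `coeff f γ`.
pairAt-resp : ∀ (f f′ : Poly n) (g : Poly n) β → f ≈ f′ → pairAt f (K g) β ≡ pairAt f′ (K g) β
pairAt-resp f f′ g β e = trans (norm f) (trans (symm f f′ e (∂Mon β g)) (sym (norm f′)))
  where
  pair : Poly n → Poly n → ℚ
  pair f h = ∑ f (λ z → proj₁ z * K h (proj₂ z))
  norm : ∀ f → pairAt f (K g) β ≡ pair f (∂Mon β g)
  norm f = ∑-cong f (λ z → cong (proj₁ z *_)
    (trans (cong (K g) (⊞-comm β (proj₂ z))) (sym (K-∂Mon β g (proj₂ z)))))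
  single : ∀ f d γ → ∑ f (λ z → proj₁ z * K ((d , γ) ∷ []) (proj₂ z)) ≡ (d * fac γ) * coeff f γ
  single []            d γ = sym (ℚ.*-zeroʳ (d * fac γ))
  single ((c , α) ∷ f) d γ with V.≡-dec ℕ._≟_ γ α | V.≡-dec ℕ._≟_ α γ
  ... | yes refl | yes _    = trans (cong (c * (fac γ * (d + 0ℚ)) +_) (single f d γ))
          (solve 4 (λ c φ d r → c :* (φ :* (d :+ con 0ℚ)) :+ (d :* φ) :* r := (d :* φ) :* (c :+ r))
             refl c (fac γ) d (coeff f γ))
    where open +-*-Solver
  ... | yes refl | no ¬e    = ⊥-elim (¬e refl)
  ... | no ¬e    | yes refl = ⊥-elim (¬e refl)
  ... | no ¬e    | no _     = trans (cong₂ _+_ (trans (cong (c *_) (ℚ.*-zeroʳ (fac α))) (ℚ.*-zeroʳ c)) (single f d γ))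
          (ℚ.+-identityˡ _)
  split : ∀ f d γ h → pair f ((d , γ) ∷ h) ≡ (d * fac γ) * coeff f γ + pair f h
  split f d γ h = trans (∑-cong f (λ z → trans (cong (proj₁ z *_) (K-⊕ ((d , γ) ∷ []) h (proj₂ z)))
                     (ℚ.*-distribˡ-+ (proj₁ z) _ _)))
                  (trans (∑-+ f _ _) (cong (_+ pair f h) (single f d γ)))
  symm : ∀ f f′ → f ≈ f′ → ∀ h → pair f h ≡ pair f′ h
  symm f f′ e [] = trans (vanish f) (sym (vanish f′))
    where
    vanish : ∀ f → pair f [] ≡ 0ℚ
    vanish f = ∑-zero f (λ z → trans (cong (proj₁ z *_) (ℚ.*-zeroʳ (fac (proj₂ z)))) (ℚ.*-zeroʳ (proj₁ z)))
  symm f f′ e ((d , γ) ∷ h) = trans (split f d γ h)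
    (trans (cong₂ _+_ (cong ((d * fac γ) *_) (e γ)) (symm f f′ e h)) (sym (split f′ d γ h)))

-- Signed sums over rearrangements

insSum : X → (Vec X (suc m) → ℚ) → Vec X m → ℚ
insSum x F []      = F (x ∷ [])
insSum x F (y ∷ p) = F (x ∷ y ∷ p) - insSum x (F ∘ (y ∷_)) p

-- Signed sum of F over the rearrangements of a vector; the entry inserted at
-- position p contributes the sign (-1)^p.
altSum : Vec X m → (Vec X m → ℚ) → ℚ
altSum []       F = F []
altSum (x ∷ xs) F = altSum xs (insSum x F)

insSum-cong : ∀ (x : X) (p : Vec X m) {F G : Vec X (suc m) → ℚ} →
              (∀ w → F w ≡ G w) → insSum x F p ≡ insSum x G p
insSum-cong x []      e = e _
insSum-cong x (y ∷ p) e = cong₂ _-_ (e _) (insSum-cong x p (e ∘ (y ∷_)))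

insSum-- : ∀ (x : X) (p : Vec X m) (F G : Vec X (suc m) → ℚ) →
           insSum x (λ w → F w - G w) p ≡ insSum x F p - insSum x G p
insSum-- x []      F G = refl
insSum-- x (y ∷ p) F G = trans (cong (λ z → F (x ∷ y ∷ p) - G (x ∷ y ∷ p) - z) (insSum-- x p (F ∘ (y ∷_)) (G ∘ (y ∷_))))
  (solve 4 (λ a b c d → (a :- b) :- (c :- d) := (a :- c) :- (b :- d)) refl (F (x ∷ y ∷ p)) (G (x ∷ y ∷ p)) _ _)
  where open +-*-Solver

-- Both sides run over the same words. The letter inserted second counts the other one among the
-- entries before it only if it stands behind it; so for each word exactly one of the two insertion
-- orders picks up the extra sign.
insSum-swap : ∀ (x y : X) (F : Vec X (suc (suc m)) → ℚ) (p : Vec X m) →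
              insSum y (insSum x F) p ≡ - insSum x (insSum y F) p
insSum-swap x y F []      =
  solve 2 (λ a b → a :- b := :- (b :- a)) refl (F (x ∷ y ∷ [])) (F (y ∷ x ∷ []))
  where open +-*-Solver
insSum-swap x y F (z ∷ p) = begin
  (a - (b - u)) - insSum y (λ q → F (x ∷ z ∷ q) - insSum x (F ∘ (z ∷_)) q) p
    ≡⟨ cong (λ r → (a - (b - u)) - r) (insSum-- y p _ _) ⟩
  (a - (b - u)) - (v - insSum y (insSum x (F ∘ (z ∷_))) p)
    ≡⟨ cong (λ r → (a - (b - u)) - (v - r)) (insSum-swap x y (F ∘ (z ∷_)) p) ⟩
  (a - (b - u)) - (v - (- r))
    ≡⟨ solve 5 (λ a b u v r → (a :- (b :- u)) :- (v :- (:- r)) := :- ((b :- (a :- v)) :- (u :- r))) refl a b u v r ⟩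
  - ((b - (a - v)) - (u - r))
    ≡⟨ cong (λ r → - ((b - (a - v)) - r)) (insSum-- x p _ _) ⟨
  - insSum x (insSum y F) (z ∷ p) ∎
  where
  open ≡-Reasoning
  open +-*-Solver
  a = F (x ∷ y ∷ z ∷ p)
  b = F (y ∷ x ∷ z ∷ p)
  u = insSum x (F ∘ (y ∷_) ∘ (z ∷_)) p
  v = insSum y (F ∘ (x ∷_) ∘ (z ∷_)) p
  r = insSum x (insSum y (F ∘ (z ∷_))) p

altSum-cong : ∀ (xs : Vec X m) {F G : Vec X m → ℚ} → (∀ w → F w ≡ G w) → altSum xs F ≡ altSum xs G
altSum-cong []       e = e []
altSum-cong (x ∷ xs) e = altSum-cong xs (λ p → insSum-cong x p e)

insSum-neg : ∀ (x : X) (p : Vec X m) (F : Vec X (suc m) → ℚ) → insSum x (λ w → - F w) p ≡ - insSum x F p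
insSum-neg x []      F = refl
insSum-neg x (y ∷ p) F = trans (cong (λ z → - F (x ∷ y ∷ p) - z) (insSum-neg x p (F ∘ (y ∷_))))
  (sym (ℚ.neg-distrib-+ (F (x ∷ y ∷ p)) (- insSum x (F ∘ (y ∷_)) p)))

altSum-neg : ∀ (xs : Vec X m) (F : Vec X m → ℚ) → altSum xs (λ w → - F w) ≡ - altSum xs F
altSum-neg []       F = refl
altSum-neg (x ∷ xs) F = trans (altSum-cong xs (λ p → insSum-neg x p F)) (altSum-neg xs (insSum x F))

insSum-map : ∀ (f : X → Y) x (p : Vec X m) F → insSum (f x) F (V.map f p) ≡ insSum x (F ∘ V.map f) p
insSum-map f x []      F = refl
insSum-map f x (y ∷ p) F = cong (λ z → F (f x ∷ f y ∷ V.map f p) - z) (insSum-map f x p (F ∘ (f y ∷_)))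

altSum-map : ∀ (f : X → Y) (xs : Vec X m) F → altSum (V.map f xs) F ≡ altSum xs (F ∘ V.map f)
altSum-map f []       F = refl
altSum-map f (x ∷ xs) F = trans (altSum-map f xs (insSum (f x) F)) (altSum-cong xs (λ p → insSum-map f x p F))

neg-involutive : ∀ q → - (- q) ≡ q
neg-involutive = solve 1 (λ q → :- (:- q) := q) refl
  where open +-*-Solver

record Opposite (xs ys : Vec X m) : Set where
  constructor opp
  field opposite : ∀ (F : Vec X m → ℚ) → altSum xs F ≡ - altSum ys F
open Opposite

opposite-cons : ∀ (x : X) {xs ys : Vec X m} → Opposite xs ys → Opposite (x ∷ xs) (x ∷ ys)
opposite-cons x o = opp (λ F → opposite o (insSum x F))

opposite-swap : ∀ (x y : X) (xs : Vec X m) → Opposite (x ∷ y ∷ xs) (y ∷ x ∷ xs)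
opposite-swap x y xs = opp (λ F → trans (altSum-cong xs (insSum-swap x y F)) (altSum-neg xs _))

opposite-trans³ : ∀ {ws xs ys zs : Vec X m} → Opposite ws xs → Opposite xs ys → Opposite ys zs → Opposite ws zs
opposite-trans³ o p q = opp (λ F →
  trans (opposite o F) (trans (cong -_ (trans (opposite p F) (cong -_ (opposite q F)))) (neg-involutive _)))

-- An exchange with a distant entry is an exchange with a nearer one conjugated by the adjacent swap
-- with `z`: three sign changes, an odd number.
opposite-head : ∀ (x : X) (ys : Vec X m) j → Opposite (lookup ys j ∷ ys V.[ j ]≔ x) (x ∷ ys)
opposite-head x (y ∷ ys) zero    = opposite-swap y x ys
opposite-head x (z ∷ ys) (suc j) = opposite-trans³
  (opposite-swap (lookup ys j) z (ys V.[ j ]≔ x))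
  (opposite-cons z (opposite-head x ys j))
  (opposite-swap z x ys)

transpose-suc : ∀ (i j k : Fin n) → transpose (suc i) (suc j) (suc k) ≡ suc (transpose i j k)
transpose-suc i j k with does (k F.≟ i)
... | true = refl
... | false with does (k F.≟ j)
...   | true  = refl
...   | false = refl

transpose-left : ∀ (i j : Fin n) → transpose i j i ≡ j
transpose-left i j rewrite dec-true (i F.≟ i) refl = refl

transpose-right : ∀ (i j : Fin n) → transpose i j j ≡ i
transpose-right i j with j F.≟ i
... | yes j≡i = j≡i
... | no _ rewrite dec-true (j F.≟ j) refl = refl

transpose-other : ∀ (i j : Fin n) {k} → k ≢ i → k ≢ j → transpose i j k ≡ k
transpose-other i j {k} k≢i k≢j rewrite dec-false (k F.≟ i) k≢i | dec-false (k F.≟ j) k≢j = refl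

tabulate-update : ∀ {g h : Fin n → X} j → (∀ v → v ≢ j → g v ≡ h v) →
                  tabulate g ≡ tabulate h V.[ j ]≔ g j
tabulate-update {g = g} zero e = cong (g zero ∷_) (V.tabulate-cong (λ v → e (suc v) (λ ())))
tabulate-update (suc j) e =
  cong₂ _∷_ (e zero (λ ())) (tabulate-update j (λ v v≢j → e (suc v) (v≢j ∘ F.suc-injective)))

-- Stated for any g to cover both transpose 0 (j + 1) and transpose (j + 1) 0.
opposite-transpose₀ : ∀ (f g : Fin (suc n) → X) j → g zero ≡ f (suc j) → g (suc j) ≡ f zero →
                      (∀ v → v ≢ j → g (suc v) ≡ f (suc v)) → Opposite (tabulate g) (tabulate f)
opposite-transpose₀ f g j e₀ e₁ e =
  subst (λ xs → Opposite xs (tabulate f)) (sym eq) (opposite-head (f zero) (tabulate (f ∘ suc)) j)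
  where
  eq : tabulate g ≡ lookup (tabulate (f ∘ suc)) j ∷ tabulate (f ∘ suc) V.[ j ]≔ f zero
  eq = cong₂ _∷_ (trans e₀ (sym (V.lookup∘tabulate (f ∘ suc) j)))
    (trans (tabulate-update j e) (cong (tabulate (f ∘ suc) V.[ j ]≔_) e₁))

opposite-transpose : ∀ (f : Fin n → X) {i j : Fin n} → i ≢ j →
                     Opposite (tabulate (f ∘ transpose i j)) (tabulate f)
opposite-transpose f {zero} {zero} i≢j = ⊥-elim (i≢j refl)
opposite-transpose f {zero} {suc j} _ = opposite-transpose₀ f (f ∘ transpose zero (suc j)) j refl
  (cong f (transpose-right zero (suc j)))
  (λ v v≢j → cong f (transpose-other zero (suc j) (λ ()) (v≢j ∘ F.suc-injective)))
opposite-transpose f {suc i} {zero} _ = opposite-transpose₀ f (f ∘ transpose (suc i) zero) i refl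
  (cong f (transpose-left (suc i) zero))
  (λ v v≢i → cong f (transpose-other (suc i) zero (v≢i ∘ F.suc-injective) (λ ())))
opposite-transpose f {suc i} {suc j} i≢j = subst (λ xs → Opposite (f zero ∷ xs) (tabulate f))
  (V.tabulate-cong {f = f ∘ suc ∘ transpose i j} (λ k → cong f (sym (transpose-suc i j k))))
  (opposite-cons (f zero) (opposite-transpose (f ∘ suc) (i≢j ∘ cong suc)))

-- A rearrangement of allFin n hits every v exactly once; nothing else is needed of its bijectivity.

occ : Fin n → Vec (Fin n) m → ℕ
occ v []      = 0
occ v (x ∷ w) = (if does (x F.≟ v) then 1 else 0) ℕ.+ occ v w

SameOcc : Vec (Fin n) m → Vec (Fin n) m → Set
SameOcc w xs = ∀ v → occ v w ≡ occ v xs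

+-leftComm : ∀ a b c → a ℕ.+ (b ℕ.+ c) ≡ b ℕ.+ (a ℕ.+ c)
+-leftComm a b c = trans (sym (ℕ.+-assoc a b c)) (trans (cong (ℕ._+ c) (ℕ.+-comm a b)) (ℕ.+-assoc b a c))

insSum-cong-occ : ∀ (x : Fin n) (p : Vec (Fin n) m) {F G : Vec (Fin n) (suc m) → ℚ} →
             (∀ w → SameOcc w (x ∷ p) → F w ≡ G w) → insSum x F p ≡ insSum x G p
insSum-cong-occ x []      e = e _ (λ v → refl)
insSum-cong-occ x (y ∷ p) e = cong₂ _-_ (e _ (λ v → refl))
  (insSum-cong-occ x p (λ w s → e (y ∷ w) (λ v → trans (cong ((if does (y F.≟ v) then 1 else 0) ℕ.+_) (s v))
     (+-leftComm (if does (y F.≟ v) then 1 else 0) (if does (x F.≟ v) then 1 else 0) (occ v p)))))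

altSum-cong-occ : ∀ (xs : Vec (Fin n) m) {F G : Vec (Fin n) m → ℚ} →
             (∀ w → SameOcc w xs → F w ≡ G w) → altSum xs F ≡ altSum xs G
altSum-cong-occ []       e = e [] (λ v → refl)
altSum-cong-occ (x ∷ xs) e = altSum-cong-occ xs (λ p s → insSum-cong-occ x p
  (λ w t → e w (λ v → trans (t v) (cong ((if does (x F.≟ v) then 1 else 0) ℕ.+_) (s v)))))

insSum-0 : ∀ (x : X) (p : Vec X m) → insSum x (λ _ → 0ℚ) p ≡ 0ℚ
insSum-0 x []      = refl
insSum-0 x (y ∷ p) = cong (λ z → 0ℚ - z) (insSum-0 x p)

altSum-0 : ∀ (xs : Vec X m) → altSum xs (λ _ → 0ℚ) ≡ 0ℚ
altSum-0 []       = refl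
altSum-0 (x ∷ xs) = trans (altSum-cong xs (insSum-0 x)) (altSum-0 xs)

altSum-vanish : ∀ (xs : Vec (Fin n) m) {F : Vec (Fin n) m → ℚ} →
             (∀ w → SameOcc w xs → F w ≡ 0ℚ) → altSum xs F ≡ 0ℚ
altSum-vanish xs e = trans (altSum-cong-occ xs e) (altSum-0 xs)

insSum-vanish : ∀ (x : Fin n) (p : Vec (Fin n) m) {F : Vec (Fin n) (suc m) → ℚ} →
             (∀ w → SameOcc w (x ∷ p) → F w ≡ 0ℚ) → insSum x F p ≡ 0ℚ
insSum-vanish x p e = trans (insSum-cong-occ x p e) (insSum-0 x p)

-- Only insertion of `x` at the front survives, with sign +1. At any later position the head comes
-- from `xs`, where `x` does not occur.
altSum-head : ∀ (x : Fin n) (xs : Vec (Fin n) m) {F : Vec (Fin n) (suc m) → ℚ} → occ x xs ≡ 0 →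
             (∀ y w → SameOcc (y ∷ w) (x ∷ xs) → y ≢ x → F (y ∷ w) ≡ 0ℚ) →
             altSum (x ∷ xs) F ≡ altSum xs (F ∘ (x ∷_))
altSum-head {n} {m} x xs {F} e₀ e = altSum-cong-occ xs go
  where
  go : ∀ w → SameOcc w xs → insSum x F w ≡ F (x ∷ w)
  go []      s = refl
  go (y ∷ w) s = trans (cong (λ z → F (x ∷ y ∷ w) - z) (insSum-vanish x w
      (λ w′ t → e y w′ (λ v → trans (cong ((if does (y F.≟ v) then 1 else 0) ℕ.+_) (t v))
         (trans (+-leftComm (if does (y F.≟ v) then 1 else 0) (if does (x F.≟ v) then 1 else 0) (occ v w))
          (cong ((if does (x F.≟ v) then 1 else 0) ℕ.+_) (s v)))) y≢x)))
    (ℚ.+-identityʳ _)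
    where
    y≢x : y ≢ x
    y≢x refl with trans (sym (cong (λ b → (if b then 1 else 0) ℕ.+ occ y w) (dec-true (y F.≟ y) refl))) (trans (s y) e₀)
    ... | ()

-- The coefficients of δ_T

-- The test of `inColGroup` at one entry v, as a function of the column of v, the column of its
-- image, and whether v is fixed.
fixes : Maybe ℕ → Maybe ℕ → Bool → Bool
fixes (just j) (just j′) _ = does (j′ ℕ.≟ j)
fixes (just j) nothing   _ = false
fixes nothing  _         b = b

all : Vec Bool m → Bool
all = V.foldr _ (λ b r → b ∧ r) true

all-lookup : ∀ (bs : Vec Bool m) → all bs ≡ true → ∀ i → lookup bs i ≡ true
all-lookup (true ∷ bs) e zero    = refl
all-lookup (true ∷ bs) e (suc i) = all-lookup bs e i

stabTests : (Fin n → Maybe ℕ) → Vec (Fin n) n → Fin n → Bool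
stabTests col w v = fixes (col v) (col (lookup w v)) (does (lookup w v F.≟ v))

stab : (Fin n → Maybe ℕ) → Vec (Fin n) n → Bool
stab col w = all (tabulate (stabTests col w))

stabTests-true : ∀ (col : Fin n → Maybe ℕ) w → stab col w ≡ true → ∀ v → stabTests col w v ≡ true
stabTests-true col w e v = trans (sym (V.lookup∘tabulate (stabTests col w) v)) (all-lookup (tabulate (stabTests col w)) e v)

does-true : ∀ {P : Set} (P? : Dec P) → does P? ≡ true → P
does-true (yes p) _ = p

stab-col : ∀ (col : Fin n → Maybe ℕ) w → stab col w ≡ true → ∀ v → col (lookup w v) ≡ col v
stab-col col w e v with col v in eq | col (lookup w v) in eq′ | stabTests-true col w e v
... | just j  | just j′ | t = cong just (does-true (j′ ℕ.≟ j) t)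
... | nothing | c       | t = trans (sym eq′) (trans (cong col (does-true (lookup w v F.≟ v) t)) eq)

colTerm : (Fin n → Maybe ℕ) → Mon n → Mon n → Vec (Fin n) n → ℚ
colTerm col x α w = if stab col w then (if does (V.≡-dec ℕ._≟_ (actMon w x) α) then 1ℚ else 0ℚ) else 0ℚ

-- The coefficient function of δ_T, which depends on T only through the column
-- col v and the exponent x v of each v in [n].
colCoeff : (Fin n → Maybe ℕ) → Mon n → Fn n
colCoeff {n} col x α = altSum (allFin n) (colTerm col x α)

colTerm-vanish : ∀ (col : Fin n → Maybe ℕ) x α w →
                 (stab col w ≡ true → actMon w x ≡ α → ⊥) → colTerm col x α w ≡ 0ℚ
colTerm-vanish col x α w h with stab col w
... | false = refl
... | true with V.≡-dec ℕ._≟_ (actMon w x) α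
...   | yes e = ⊥-elim (h refl e)
...   | no _  = refl

fiberSum : Vec (Fin n) m → Mon m → Fin n → ℕ
fiberSum w a v = V.sum (tabulate (λ i → if does (lookup w i F.≟ v) then lookup a i else 0))

-- `actMon` sums over the preimages of `v` instead of using an inverse permutation. Each preimage
-- contributes at most `B - 1`; when `v` occurs once this becomes a strict bound on its exponent.
fiberSum-< : ∀ (w : Vec (Fin n) m) a v B → (∀ i → lookup w i ≡ v → lookup a i < B) →
             occ v w ℕ.+ fiberSum w a v ≤ occ v w ℕ.* B
fiberSum-< []      []      v B h = z≤n
fiberSum-< (y ∷ w) (a ∷ α) v B h with fiberSum-< w α v B (h ∘ suc) | y F.≟ v
... | ih | no _  = ih
... | ih | yes e = ℕ.≤-trans
  (ℕ.≤-reflexive (cong suc (+-leftComm (occ v w) a (fiberSum w α v))))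
  (ℕ.+-mono-≤ (h zero e) ih)

occ-map-suc : ∀ (v : Fin n) (w : Vec (Fin n) m) → occ (suc v) (V.map suc w) ≡ occ v w
occ-map-suc v []      = refl
occ-map-suc v (y ∷ w) = cong ((if does (y F.≟ v) then 1 else 0) ℕ.+_) (occ-map-suc v w)

occ-zero-map-suc : ∀ (w : Vec (Fin n) m) → occ zero (V.map suc w) ≡ 0
occ-zero-map-suc []      = refl
occ-zero-map-suc (y ∷ w) = occ-zero-map-suc w

allFin-suc : ∀ n → allFin (suc n) ≡ zero ∷ V.map suc (allFin n)
allFin-suc n = cong (zero ∷_) (V.tabulate-∘ suc id)

occ-allFin : ∀ (v : Fin n) → occ v (allFin n) ≡ 1
occ-allFin {suc n} zero    = trans (cong (occ zero) (allFin-suc n)) (cong suc (occ-zero-map-suc (allFin n)))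
occ-allFin {suc n} (suc v) = trans (cong (occ (suc v)) (allFin-suc n))
  (trans (occ-map-suc v (allFin n)) (occ-allFin v))

permutation-fiber-< : ∀ (w : Vec (Fin n) n) a v B → SameOcc w (allFin n) →
                      (∀ i → lookup w i ≡ v → lookup a i < B) → lookup (actMon w a) v < B
permutation-fiber-< w a v B s h = subst₂ _≤_
  (trans (cong (ℕ._+ fiberSum w a v) occ≡1) (cong suc (sym (V.lookup∘tabulate (fiberSum w a) v))))
  (trans (cong (ℕ._* B) occ≡1) (ℕ.*-identityˡ B))
  (fiberSum-< w a v B h)
  where
  occ≡1 : occ v w ≡ 1
  occ≡1 = trans (s v) (occ-allFin v)

-- Permutations in the column group give `v` an exponent that stood at an entry with the same `col`
-- value.
colCoeff-support : ∀ (col : Fin n → Maybe ℕ) x α v B → (∀ i → col i ≡ col v → lookup x i < B) →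
                   B ≤ lookup α v → colCoeff col x α ≡ 0ℚ
colCoeff-support {n} col x α v B h B≤α = altSum-vanish (allFin n) (λ w s → colTerm-vanish col x α w (λ st e →
  ℕ.<⇒≱ (subst (λ β → lookup β v < B) e (permutation-fiber-< w x v B s
     (λ { i refl → h i (sym (stab-col col w st i)) }))) B≤α))

module _ (col : Fin (suc n) → Maybe ℕ) (x₀ : ℕ) (x : Mon n)
         (below : ∀ q j → col zero ≡ just j → col (suc q) ≡ just j → lookup x q < x₀) where

  private
    moved-vanish : ∀ α y w → SameOcc (y ∷ w) (allFin (suc n)) → y ≢ zero →
                   colTerm col (x₀ ∷ x) (x₀ ∷ α) (y ∷ w) ≡ 0ℚ
    moved-vanish α y w s y≢0 = colTerm-vanish col (x₀ ∷ x) (x₀ ∷ α) (y ∷ w) go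
      where
      go : stab col (y ∷ w) ≡ true → actMon (y ∷ w) (x₀ ∷ x) ≡ x₀ ∷ α → ⊥
      go st e with col zero in eq | stabTests-true col (y ∷ w) st zero
      ... | nothing | t = y≢0 (does-true (y F.≟ zero) t)
      ... | just j  | _ = ℕ.<-irrefl (cong V.head e)
            (permutation-fiber-< (y ∷ w) (x₀ ∷ x) zero x₀ s
              (λ { zero e′ → ⊥-elim (y≢0 e′)
                 ; (suc q) e′ → below q j eq
                     (trans (sym (stab-col col (y ∷ w) st (suc q))) (trans (cong col e′) eq)) }))

    fixed-stab : ∀ p → stab col (zero ∷ V.map suc p) ≡ stab (col ∘ suc) p
    fixed-stab p = cong₂ _∧_ (first (col zero)) (cong all (V.tabulate-cong (λ v →
      cong (λ z → fixes (col (suc v)) (col z) (does (z F.≟ suc v))) (V.lookup-map v suc p))))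
      where
      first : ∀ c → fixes c c true ≡ true
      first (just j) = dec-true (j ℕ.≟ j) refl
      first nothing  = refl

    fixed-actMon : ∀ p → actMon (zero ∷ V.map suc p) (x₀ ∷ x) ≡ x₀ ∷ actMon p x
    fixed-actMon p = cong₂ _∷_
      (trans (cong (x₀ ℕ.+_) (no-zero p x)) (ℕ.+-identityʳ x₀))
      (V.tabulate-cong (λ v → cong V.sum (V.tabulate-cong (λ i →
        cong (λ z → if does (z F.≟ suc v) then lookup x i else 0) (V.lookup-map i suc p)))))
      where
      no-zero : ∀ {m} (p : Vec (Fin n) m) x → fiberSum (V.map suc p) x zero ≡ 0
      no-zero []      []      = refl
      no-zero (y ∷ p) (a ∷ x) = no-zero p x

    fixed-term : ∀ α p → colTerm col (x₀ ∷ x) (x₀ ∷ α) (zero ∷ V.map suc p) ≡ colTerm (col ∘ suc) x α p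
    fixed-term α p = cong₂ (λ b c → if b then (if c then 1ℚ else 0ℚ) else 0ℚ) (fixed-stab p)
      (does-⇔ (mk⇔ (λ e → V.∷-injectiveʳ (trans (sym (fixed-actMon p)) e))
                   (λ e → trans (fixed-actMon p) (cong (x₀ ∷_) e)))
         (V.≡-dec ℕ._≟_ (actMon (zero ∷ V.map suc p) (x₀ ∷ x)) (x₀ ∷ α)) (V.≡-dec ℕ._≟_ (actMon p x) α))

  -- A permutation moving 0 gives it the exponent of a lower entry of its column, which is less than
  -- `x₀` by `below`; if 0 lies in no column, it cannot move at all. What remains are the
  -- permutations of the other variables, with the same sign.
  colCoeff-head : ∀ α → colCoeff col (x₀ ∷ x) (x₀ ∷ α) ≡ colCoeff (col ∘ suc) x α
  colCoeff-head α = begin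
    altSum (allFin (suc n)) (colTerm col (x₀ ∷ x) (x₀ ∷ α))
      ≡⟨ cong (λ l → altSum l (colTerm col (x₀ ∷ x) (x₀ ∷ α))) (allFin-suc n) ⟩
    altSum (zero ∷ V.map suc (allFin n)) (colTerm col (x₀ ∷ x) (x₀ ∷ α))
      ≡⟨ altSum-head zero (V.map suc (allFin n)) (occ-zero-map-suc (allFin n))
           (λ y w s y≢0 → moved-vanish α y w (λ v → trans (s v) (cong (occ v) (sym (allFin-suc n)))) y≢0) ⟩
    altSum (V.map suc (allFin n)) (colTerm col (x₀ ∷ x) (x₀ ∷ α) ∘ (zero ∷_))
      ≡⟨ altSum-map suc (allFin n) _ ⟩
    altSum (allFin n) (λ p → colTerm col (x₀ ∷ x) (x₀ ∷ α) (zero ∷ V.map suc p))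
      ≡⟨ altSum-cong (allFin n) (fixed-term α) ⟩
    colCoeff (col ∘ suc) x α ∎
    where open ≡-Reasoning

-- Antisymmetry in two entries of a column

data TransposeView (i j : Fin n) : Fin n → Fin n → Set where
  left  : TransposeView i j i j
  right : TransposeView i j j i
  other : ∀ {k} → k ≢ i → k ≢ j → TransposeView i j k k

transposeView : ∀ (i j k : Fin n) → TransposeView i j k (transpose i j k)
transposeView i j k with k F.≟ i
... | yes refl = left
... | no k≢i with k F.≟ j
...   | yes refl = right
...   | no k≢j   = other k≢i k≢j

transpose-involutive : ∀ (i j k : Fin n) → transpose i j (transpose i j k) ≡ k
transpose-involutive i j k with transpose i j k | transposeView i j k
... | _ | left           = transpose-right i j
... | _ | right          = transpose-left i j
... | _ | other k≢i k≢j  = transpose-other i j k≢i k≢j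

vec-ext : ∀ {xs ys : Vec X m} → (∀ i → lookup xs i ≡ lookup ys i) → xs ≡ ys
vec-ext {xs = xs} {ys} e = trans (sym (V.tabulate∘lookup xs)) (trans (V.tabulate-cong e) (V.tabulate∘lookup ys))

module _ (col : Fin n → Maybe ℕ) (x : Mon n) (a b : Fin n) (a≢b : a ≢ b)
         (j : ℕ) (col-a : col a ≡ just j) (col-b : col b ≡ just j) where

  private
    τ : Fin n → Fin n
    τ = transpose a b

    swapMon : Mon n → Mon n
    swapMon α = tabulate (lookup α ∘ τ)

    swapMon-involutive : ∀ α → swapMon (swapMon α) ≡ α
    swapMon-involutive α = vec-ext (λ v → trans (V.lookup∘tabulate _ v) (trans (V.lookup∘tabulate _ (τ v))
      (cong (lookup α) (transpose-involutive a b v))))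

    col-τ : ∀ v → col (τ v) ≡ col v
    col-τ v with τ v | transposeView a b v
    ... | _ | left      = trans col-b (sym col-a)
    ... | _ | right     = trans col-a (sym col-b)
    ... | _ | other _ _ = refl

    τ-⇔ : ∀ u v → does (τ u F.≟ v) ≡ does (u F.≟ τ v)
    τ-⇔ u v = does-⇔ (mk⇔ (λ { refl → sym (transpose-involutive a b u) })
                           (λ { refl → transpose-involutive a b v })) (τ u F.≟ v) (u F.≟ τ v)

    τ-fixed : ∀ v → col v ≡ nothing → τ v ≡ v
    τ-fixed v e with τ v | transposeView a b v
    ... | _ | other _ _ = refl
    ... | _ | left      with () ← trans (sym e) col-a
    ... | _ | right     with () ← trans (sym e) col-b

    stab-τ : ∀ w → stab col (V.map τ w) ≡ stab col w
    stab-τ w = cong all (V.tabulate-cong (λ v →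
      trans (cong (λ z → fixes (col v) (col z) (does (z F.≟ v))) (V.lookup-map v τ w))
      (trans (cong (λ c → fixes (col v) c (does (τ (lookup w v) F.≟ v))) (col-τ (lookup w v)))
      (test v (lookup w v)))))
      where
      test : ∀ v u → fixes (col v) (col u) (does (τ u F.≟ v)) ≡ fixes (col v) (col u) (does (u F.≟ v))
      test v u with col v in eq | col u
      ... | just _  | just _  = refl
      ... | just _  | nothing = refl
      ... | nothing | _       = trans (τ-⇔ u v) (cong (λ z → does (u F.≟ z)) (τ-fixed v eq))

    actMon-τ : ∀ w → actMon (V.map τ w) x ≡ swapMon (actMon w x)
    actMon-τ w = V.tabulate-cong (λ v → trans
      (cong V.sum (V.tabulate-cong (λ i → cong (λ t → if t then lookup x i else 0)
         (trans (cong (λ z → does (z F.≟ v)) (V.lookup-map i τ w)) (τ-⇔ (lookup w i) v)))))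
      (sym (V.lookup∘tabulate (fiberSum w x) (τ v))))

    colTerm-τ : ∀ α w → colTerm col x (swapMon α) w ≡ colTerm col x α (V.map τ w)
    colTerm-τ α w = cong₂ (λ b c → if b then (if c then 1ℚ else 0ℚ) else 0ℚ) (sym (stab-τ w))
      (does-⇔ (mk⇔ (λ e → trans (actMon-τ w) (trans (cong swapMon e) (swapMon-involutive α)))
                   (λ e → trans (sym (swapMon-involutive _)) (cong swapMon (trans (sym (actMon-τ w)) e))))
         (V.≡-dec ℕ._≟_ (actMon w x) (swapMon α)) (V.≡-dec ℕ._≟_ (actMon (V.map τ w) x) α))

    -- Since `a` and `b` share a column, left multiplication by their transposition maps the column
    -- group to itself and reverses the sign.
    colCoeff-τ : ∀ α → colCoeff col x (swapMon α) ≡ - colCoeff col x α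
    colCoeff-τ α = begin
      altSum (allFin n) (colTerm col x (swapMon α))     ≡⟨ altSum-cong (allFin n) (colTerm-τ α) ⟩
      altSum (allFin n) (colTerm col x α ∘ V.map τ)     ≡⟨ altSum-map τ (allFin n) _ ⟨
      altSum (V.map τ (allFin n)) (colTerm col x α)     ≡⟨ cong (λ l → altSum l (colTerm col x α)) (V.tabulate-∘ τ id) ⟨
      altSum (tabulate τ) (colTerm col x α)             ≡⟨ Opposite.opposite (opposite-transpose id a≢b) _ ⟩
      - altSum (allFin n) (colTerm col x α)             ∎
      where open ≡-Reasoning

    swapMon-fixed : ∀ γ → lookup γ a ≡ lookup γ b → swapMon γ ≡ γ
    swapMon-fixed γ e = vec-ext (λ v → trans (V.lookup∘tabulate _ v) (go v))
      where
      go : ∀ v → lookup γ (τ v) ≡ lookup γ v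
      go v with τ v | transposeView a b v
      ... | _ | left      = sym e
      ... | _ | right     = e
      ... | _ | other _ _ = refl

    swapMon-inc : ∀ γ → lookup γ a ≡ lookup γ b → swapMon (inc a γ) ≡ inc b γ
    swapMon-inc γ e = vec-ext (λ v → trans (V.lookup∘tabulate _ v) (go v))
      where
      go : ∀ v → lookup (inc a γ) (τ v) ≡ lookup (inc b γ) v
      go v with τ v | transposeView a b v
      ... | _ | left  = trans (V.lookup∘updateAt′ b a (a≢b ∘ sym) γ) (trans (sym e) (sym (V.lookup∘updateAt′ a b a≢b γ)))
      ... | _ | right = trans (lookup-inc a γ) (trans (cong suc e) (sym (lookup-inc b γ)))
      ... | _ | other v≢a v≢b = trans (V.lookup∘updateAt′ v a v≢a γ) (sym (V.lookup∘updateAt′ v b v≢b γ))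

  colCoeff-equal : ∀ γ → lookup γ a ≡ lookup γ b → colCoeff col x γ ≡ 0ℚ
  colCoeff-equal γ e = q≡-q⇒q≡0 (trans (cong (colCoeff col x) (sym (swapMon-fixed γ e))) (colCoeff-τ γ))
    where
    q≡-q⇒q≡0 : ∀ {q} → q ≡ - q → q ≡ 0ℚ
    q≡-q⇒q≡0 {q} e = *-cancelˡ {1ℚ + 1ℚ} (λ ())
      (trans (solve 1 (λ q → con (1ℚ + 1ℚ) :* q := q :+ q) refl q)
      (trans (cong (q +_) e) (trans (ℚ.+-inverseʳ q) (sym (ℚ.*-zeroʳ (1ℚ + 1ℚ))))))
      where open +-*-Solver

  -- When `γ` agrees at `a` and `b`, the swap exchanges the two incremented monomials. This is what
  -- cancels the terms of e_d(S) that contain exactly one of `a` and `b`.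
  colCoeff-inc : ∀ γ → lookup γ a ≡ lookup γ b → colCoeff col x (inc a γ) + colCoeff col x (inc b γ) ≡ 0ℚ
  colCoeff-inc γ e = trans (cong (λ z → colCoeff col x (inc a γ) + z)
    (trans (cong (colCoeff col x) (sym (swapMon-inc γ e))) (colCoeff-τ (inc a γ)))) (ℚ.+-inverseʳ (colCoeff col x (inc a γ)))

-- Counting

𝟙 : {P : Set} → Dec P → ℕ
𝟙 P? = if does P? then 1 else 0

𝟙-yes : ∀ {P : Set} (P? : Dec P) → P → 𝟙 P? ≡ 1
𝟙-yes P? p = cong (λ b → if b then 1 else 0) (dec-true P? p)

𝟙-no : ∀ {P : Set} (P? : Dec P) → ¬ P → 𝟙 P? ≡ 0
𝟙-no P? ¬p = cong (λ b → if b then 1 else 0) (dec-false P? ¬p)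

𝟙-≤ : ∀ {P : Set} (P? : Dec P) {b} → (P → 1 ≤ b) → 𝟙 P? ≤ b
𝟙-≤ (yes p) h = h p
𝟙-≤ (no _)  h = z≤n

sum-mono : ∀ (f g : Fin n → ℕ) → (∀ i → f i ≤ g i) → sum f ≤ sum g
sum-mono {zero}  f g h = z≤n
sum-mono {suc n} f g h = ℕ.+-mono-≤ (h zero) (sum-mono (f ∘ suc) (g ∘ suc) (h ∘ suc))

term≤sum : ∀ (f : Fin n → ℕ) i → f i ≤ sum f
term≤sum f zero    = ℕ.m≤m+n _ _
term≤sum f (suc i) = ℕ.≤-trans (term≤sum (f ∘ suc) i) (ℕ.m≤n+m _ _)

sum-zero : ∀ (f : Fin n → ℕ) → (∀ i → f i ≡ 0) → sum f ≡ 0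
sum-zero {zero}  f e = refl
sum-zero {suc n} f e = cong₂ ℕ._+_ (e zero) (sum-zero (f ∘ suc) (e ∘ suc))

sum-𝟙-unique : ∀ {P : Fin n → Set} (P? : ∀ i → Dec (P i)) → (∀ i j → P i → P j → i ≡ j) → sum (λ i → 𝟙 (P? i)) ≤ 1
sum-𝟙-unique {zero}  P? u = z≤n
sum-𝟙-unique {suc n} P? u with P? zero
... | no _  = sum-𝟙-unique (P? ∘ suc) (λ i j p q → F.suc-injective (u (suc i) (suc j) p q))
... | yes p = ℕ.≤-reflexive (cong suc (sum-zero _ (λ i → 𝟙-no (P? (suc i)) (λ q → F.0≢1+n (u zero (suc i) p q)))))

sum-const : ∀ n c → sum {n} (λ _ → c) ≡ n ℕ.* c
sum-const zero    c = refl
sum-const (suc n) c = cong (c ℕ.+_) (sum-const n c)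

double-count : ∀ (R : Fin m → Fin n → ℕ) (p : Fin m → ℕ) (q : Fin n → ℕ) →
               (∀ v → p v ≤ sum (R v)) → (∀ t → sum (λ v → R v t) ≤ q t) → sum p ≤ sum q
double-count R p q total inj = ℕ.≤-trans (sum-mono p (λ v → sum (R v)) total)
  (ℕ.≤-trans (ℕ.≤-reflexive (∑-comm R)) (sum-mono (λ t → sum (λ v → R v t)) q inj))

module _ {P : Fin n → Set} (P? : ∀ v → Dec (P v)) (f : Fin n → ℕ)
         (inj : ∀ v v′ → P v → P v′ → f v ≡ f v′ → v ≡ v′) where

  count-interval : ∀ lo hi → (∀ v → P v → lo ≤ f v × f v < hi) → sum (λ v → 𝟙 (P? v)) ≤ hi ∸ lo
  count-interval lo hi range = subst (sum (λ v → 𝟙 (P? v)) ≤_)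
    (trans (sum-const (hi ∸ lo) 1) (ℕ.*-identityʳ (hi ∸ lo)))
    (double-count (λ v t → 𝟙 (R? v t)) _ (λ _ → 1) total
      (λ t → sum-𝟙-unique (λ v → R? v t) (λ v v′ (p , e) (p′ , e′) → inj v v′ p p′ (trans e (sym e′)))))
    where
    R? : ∀ v (t : Fin (hi ∸ lo)) → Dec (P v × f v ≡ lo ℕ.+ toℕ t)
    R? v t = P? v ×-dec (f v ℕ.≟ lo ℕ.+ toℕ t)
    total : ∀ v → 𝟙 (P? v) ≤ sum (λ t → 𝟙 (R? v t))
    total v = 𝟙-≤ (P? v) λ p →
      let lo≤ = proj₁ (range v p)
          t₀  = F.fromℕ< (ℕ.∸-monoˡ-< (proj₂ (range v p)) lo≤)
          e   = sym (trans (cong (lo ℕ.+_) (F.toℕ-fromℕ< _)) (ℕ.m+[n∸m]≡n lo≤))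
      in subst (_≤ sum (λ t → 𝟙 (R? v t))) (𝟙-yes (R? v t₀) (p , e)) (term≤sum (λ t → 𝟙 (R? v t)) t₀)

-- If b and b′ ∈ {b , b + 1} both inject a set of size ≥ h, b′ into [0 , h), then b = b′ on it.
-- Count the elements with b < t and those with t ≤ b′ for t = b v₀ + 1.
rigid : ∀ {P : Fin n → Set} (P? : ∀ v → Dec (P v)) (b b′ : Fin n → ℕ) h →
        h ≤ sum (λ v → 𝟙 (P? v)) →
        (∀ v v′ → P v → P v′ → b v ≡ b v′ → v ≡ v′) →
        (∀ v v′ → P v → P v′ → b′ v ≡ b′ v′ → v ≡ v′) →
        (∀ v → b v ≤ b′ v) → (∀ v → P v → b′ v < h) →
        ∀ v₀ → P v₀ → b v₀ < b′ v₀ → ⊥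
rigid {n} {P} P? b b′ h big injb injb′ b≤b′ b′<h v₀ pv₀ lt = ℕ.<-irrefl refl (begin-strict
  h                                          <⟨ ℕ.n<1+n h ⟩
  1 ℕ.+ h                                    ≤⟨ ℕ.+-mono-≤ (subst (_≤ sum at) (𝟙-yes (v₀ F.≟ v₀) refl) (term≤sum at v₀)) big ⟩
  sum at ℕ.+ sum (λ v → 𝟙 (P? v))            ≡⟨ ∑-distrib-+ at (λ v → 𝟙 (P? v)) ⟨
  sum (λ v → at v ℕ.+ 𝟙 (P? v))              ≤⟨ sum-mono _ (λ v → 𝟙 (lo? v) ℕ.+ 𝟙 (hi? v)) pointwise ⟩
  sum (λ v → 𝟙 (lo? v) ℕ.+ 𝟙 (hi? v))        ≡⟨ ∑-distrib-+ (λ v → 𝟙 (lo? v)) (λ v → 𝟙 (hi? v)) ⟩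
  sum (λ v → 𝟙 (lo? v)) ℕ.+ sum (λ v → 𝟙 (hi? v))
    ≤⟨ ℕ.+-mono-≤
         (count-interval lo? b (λ v v′ p p′ → injb v v′ (proj₁ p) (proj₁ p′)) 0 t (λ v p → z≤n , proj₂ p))
         (count-interval hi? b′ (λ v v′ p p′ → injb′ v v′ (proj₁ p) (proj₁ p′)) t h (λ v p → proj₂ p , b′<h v (proj₁ p))) ⟩
  t ℕ.+ (h ∸ t)                              ≡⟨ ℕ.m+[n∸m]≡n (ℕ.≤-trans lt (ℕ.<⇒≤ (b′<h v₀ pv₀))) ⟩
  h                                          ∎)
  where
  open ℕ.≤-Reasoning
  t = suc (b v₀)
  at : Fin n → ℕ
  at v = 𝟙 (v F.≟ v₀)
  lo? : ∀ v → Dec (P v × b v < t)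
  lo? v = P? v ×-dec (b v ℕ.<? t)
  hi? : ∀ v → Dec (P v × t ≤ b′ v)
  hi? v = P? v ×-dec (t ℕ.≤? b′ v)
  cover : ∀ v → P v → 1 ≤ 𝟙 (lo? v) ℕ.+ 𝟙 (hi? v)
  cover v p with ℕ.<-≤-connex (b v) t
  ... | inj₁ l = subst (λ z → 1 ≤ z ℕ.+ 𝟙 (hi? v)) (sym (𝟙-yes (lo? v) (p , l))) (s≤s z≤n)
  ... | inj₂ g = subst (λ z → 1 ≤ 𝟙 (lo? v) ℕ.+ z) (sym (𝟙-yes (hi? v) (p , ℕ.≤-trans g (b≤b′ v)))) (ℕ.m≤n+m 1 _)
  pointwise : ∀ v → at v ℕ.+ 𝟙 (P? v) ≤ 𝟙 (lo? v) ℕ.+ 𝟙 (hi? v)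
  pointwise v with v F.≟ v₀
  -- The element `v₀` is counted twice, as `b v₀ < t` and `t ≤ b′ v₀`. This surplus of one is the
  -- contradiction.
  ... | yes refl = ℕ.≤-trans (ℕ.+-monoʳ-≤ 1 (ℕ.≤-reflexive (𝟙-yes (P? v) pv₀)))
        (ℕ.≤-reflexive (sym (cong₂ ℕ._+_ (𝟙-yes (lo? v) (pv₀ , ℕ.n<1+n _)) (𝟙-yes (hi? v) (pv₀ , lt)))))
  ... | no _     = 𝟙-≤ (P? v) (cover v)

-- δ_T is harmonic

height : Vec ℕ s → ℕ → ℕ
height lam j = sum (λ r → 𝟙 (j ℕ.<? lookup lam r))

excess : Vec ℕ s → ℕ → ℕ
excess lam c = sum (λ r → lookup lam r ∸ c)

esum : ℕ → Subset n → Fn n → ℚ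
esum d S F = ∑ (esymMons d S) F

-- G stands for K g with g orthogonal to the ideal.  The threshold λ′ₙ + ⋯ + λ′ₙ₋ₘ₊₁ is counted by rows, as excess lam (n ∸ m).
record Harmonic (n : ℕ) (lam : Vec ℕ s) (G : Fn n) : Set where
  field
    power : ∀ i β → s ≤ lookup β i → G β ≡ 0ℚ
    elementary : ∀ S d β → card S < d ℕ.+ excess lam (n ∸ card S) → esum d S (G ∘ (β ⊞_)) ≡ 0ℚ

sameCol? : ∀ (c : Maybe ℕ) j → Dec (c ≡ just j)
sameCol? c j = Maybe.≡-dec ℕ._≟_ c (just j)

-- All that the harmonicity of δ_T uses of T. A column with at least h entries whose exponents are
-- distinct and below h has no room to move, which is the hypothesis of `rigid`.
record Columns (lam : Vec ℕ s) (col : Fin n → Maybe ℕ) (x : Mon n) : Set where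
  field
    full : ∀ j → height lam j ≤ sum (λ v → 𝟙 (sameCol? (col v) j))
    inside : ∀ v j → col v ≡ just j → lookup x v < height lam j
    outside : ∀ v → col v ≡ nothing → lookup x v < s

height≤s : ∀ (lam : Vec ℕ s) j → height lam j ≤ s
height≤s {s} lam j = ℕ.≤-trans (sum-mono _ (λ _ → 1) (λ r → 𝟙-≤ (j ℕ.<? lookup lam r) (λ _ → s≤s z≤n)))
  (ℕ.≤-reflexive (trans (sum-const s 1) (ℕ.*-identityʳ s)))

∑-All : ∀ {xs : List X} {f g : X → ℚ} → All (λ x → f x ≡ g x) xs → ∑ xs f ≡ ∑ xs g
∑-All []       = refl
∑-All (e ∷ es) = cong₂ _+_ e (∑-All es)

∑-All-zero : ∀ {xs : List X} {f : X → ℚ} → All (λ x → f x ≡ 0ℚ) xs → ∑ xs f ≡ 0ℚ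
∑-All-zero {xs = xs} es = trans (∑-All es) (∑-zero xs (λ _ → refl))

-- Elementary symmetric sums of shifts

esum-true : ∀ d (S : Subset n) F → esum (suc d) (true ∷ S) F ≡ esum d S (F ∘ (1 ∷_)) + esum (suc d) S (F ∘ (0 ∷_))
esum-true d S F = trans (∑-++ (map (1 ∷_) (esymMons d S)) _ F)
  (cong₂ _+_ (∑-map (1 ∷_) (esymMons d S) F) (∑-map (0 ∷_) (esymMons (suc d) S) F))

esum-false : ∀ d (S : Subset n) F → esum d (false ∷ S) F ≡ esum d S (F ∘ (0 ∷_))
esum-false zero    S F = refl
esum-false (suc d) S F = ∑-map (0 ∷_) (esymMons (suc d) S) F

-- Degree d - 1, with the value 0 in degree -1, so that `esum-remove` covers d = 0.
esum⁻ : ℕ → Subset n → Fn n → ℚ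
esum⁻ zero    S F = 0ℚ
esum⁻ (suc d) S F = esum d S F

esum-remove : ∀ d (S : Subset n) F a → lookup S a ≡ true →
              esum d S F ≡ esum⁻ d (S V.[ a ]≔ false) (F ∘ inc a) + esum d (S V.[ a ]≔ false) F
esum-remove zero    S           F a       e = sym (ℚ.+-identityˡ _)
esum-remove (suc d) (true ∷ S)  F zero    e = trans (esum-true d S F)
  (sym (cong₂ _+_ (esum-false d S (F ∘ inc zero)) (esum-false (suc d) S F)))
esum-remove (suc d) (false ∷ S) F (suc a) e = begin
  esum (suc d) (false ∷ S) F          ≡⟨ esum-false (suc d) S F ⟩
  esum (suc d) S (F ∘ (0 ∷_))         ≡⟨ esum-remove (suc d) S (F ∘ (0 ∷_)) a e ⟩
  esum d S′ (F ∘ inc (suc a) ∘ (0 ∷_)) + esum (suc d) S′ (F ∘ (0 ∷_))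
    ≡⟨ cong₂ _+_ (esum-false d S′ (F ∘ inc (suc a))) (esum-false (suc d) S′ F) ⟨
  esum d (false ∷ S′) (F ∘ inc (suc a)) + esum (suc d) (false ∷ S′) F ∎
  where
  open ≡-Reasoning
  S′ = S V.[ a ]≔ false
esum-remove (suc d) (true ∷ S)  F (suc a) e = begin
  esum (suc d) (true ∷ S) F
    ≡⟨ esum-true d S F ⟩
  esum d S F₁ + esum (suc d) S F₀
    ≡⟨ cong₂ _+_ (esum-remove d S F₁ a e) (esum-remove (suc d) S F₀ a e) ⟩
  (esum⁻ d S′ (F₁ ∘ inc a) + esum d S′ F₁) + (esum d S′ (F₀ ∘ inc a) + esum (suc d) S′ F₀)
    ≡⟨ +-interchange (esum⁻ d S′ (F₁ ∘ inc a)) _ _ _ ⟩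
  (esum⁻ d S′ (F₁ ∘ inc a) + esum d S′ (F₀ ∘ inc a)) + (esum d S′ F₁ + esum (suc d) S′ F₀)
    ≡⟨ cong₂ _+_ (merge d) (sym (esum-true d S′ F)) ⟩
  esum d (true ∷ S′) (F ∘ inc (suc a)) + esum (suc d) (true ∷ S′) F ∎
  where
  open ≡-Reasoning
  S′ = S V.[ a ]≔ false
  F₀ = F ∘ (0 ∷_)
  F₁ = F ∘ (1 ∷_)
  merge : ∀ d → esum⁻ d S′ (F₁ ∘ inc a) + esum d S′ (F₀ ∘ inc a) ≡ esum d (true ∷ S′) (F ∘ inc (suc a))
  merge zero    = ℚ.+-identityˡ _
  merge (suc d) = sym (esum-true d S′ (F ∘ inc (suc a)))

record Indicates (d : ℕ) (S : Subset n) (u : Mon n) : Set where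
  field
    ≤1 : ∀ v → lookup u v ≤ 1
    zero-outside : ∀ v → lookup S v ≡ false → lookup u v ≡ 0
    size : sum (lookup u) ≡ d
open Indicates

indicates-esymMons : ∀ d (S : Subset n) → All (Indicates d S) (esymMons d S)
indicates-esymMons {n} zero S = record
  { ≤1 = λ v → subst (_≤ 1) (sym (V.lookup-replicate v 0)) z≤n
  ; zero-outside = λ v _ → V.lookup-replicate v 0
  ; size = sum-zero (lookup (replicate n 0)) (λ v → V.lookup-replicate v 0) } ∷ []
indicates-esymMons (suc d) []          = []
indicates-esymMons (suc d) (true ∷ S)  = All.++⁺
  (All.map⁺ (All.map cons₁ (indicates-esymMons d S)))
  (All.map⁺ (All.map cons₀ (indicates-esymMons (suc d) S)))
  where
  cons₁ : ∀ {u} → Indicates d S u → Indicates (suc d) (true ∷ S) (1 ∷ u)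
  cons₁ i = record { ≤1 = λ { zero → ℕ.≤-refl ; (suc v) → ≤1 i v }
                   ; zero-outside = λ { zero () ; (suc v) → zero-outside i v }
                   ; size = cong suc (size i) }
  cons₀ : ∀ {u} → Indicates (suc d) S u → Indicates (suc d) (true ∷ S) (0 ∷ u)
  cons₀ i = record { ≤1 = λ { zero → z≤n ; (suc v) → ≤1 i v }
                   ; zero-outside = λ { zero () ; (suc v) → zero-outside i v }
                   ; size = size i }
indicates-esymMons (suc d) (false ∷ S) = All.map⁺ (All.map cons₀ (indicates-esymMons (suc d) S))
  where
  cons₀ : ∀ {u} → Indicates (suc d) S u → Indicates (suc d) (false ∷ S) (0 ∷ u)
  cons₀ i = record { ≤1 = λ { zero → z≤n ; (suc v) → ≤1 i v }
                   ; zero-outside = λ { zero _ → refl ; (suc v) → zero-outside i v }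
                   ; size = size i }

-- If G is antisymmetric in the variables a and b of S, the terms of e_d(S) cancel in pairs.
esum-antisymmetric : ∀ d (S : Subset n) (F : Fn n) a b → a ≢ b → lookup S a ≡ true → lookup S b ≡ true →
  (∀ u → lookup u a ≡ lookup u b → F u ≡ 0ℚ) →
  (∀ u → lookup u a ≡ lookup u b → F (inc a u) + F (inc b u) ≡ 0ℚ) → esum d S F ≡ 0ℚ
esum-antisymmetric {n} d S F a b a≢b ea eb F0 F± = begin
  esum d S F
    ≡⟨ esum-remove d S F a ea ⟩
  esum⁻ d S₁ (F ∘ inc a) + esum d S₁ F
    ≡⟨ cong₂ _+_ (first d) (esum-remove d S₁ F b eb₁) ⟩
  esum⁻ d S₂ (F ∘ inc a) + (esum⁻ d S₂ (F ∘ inc b) + esum d S₂ F)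
    ≡⟨ ℚ.+-assoc (esum⁻ d S₂ (F ∘ inc a)) _ _ ⟨
  (esum⁻ d S₂ (F ∘ inc a) + esum⁻ d S₂ (F ∘ inc b)) + esum d S₂ F
    ≡⟨ cong₂ _+_ (middle d) (∑-All-zero (All.map (λ i → F0 _ (same i)) (indicates-esymMons d S₂))) ⟩
  0ℚ ∎
  where
  open ≡-Reasoning
  S₁ = S V.[ a ]≔ false
  S₂ = S₁ V.[ b ]≔ false
  eb₁ : lookup S₁ b ≡ true
  eb₁ = trans (V.lookup∘update′ (a≢b ∘ sym) S false) eb
  same : ∀ {d u} → Indicates d S₂ u → lookup u a ≡ lookup u b
  same i = trans (zero-outside i a (trans (V.lookup∘update′ a≢b S₁ false) (V.lookup∘update a S false)))
                 (sym (zero-outside i b (V.lookup∘update b S₁ false)))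
  inc-same : ∀ u → lookup u a ≡ lookup u b → lookup (inc a (inc b u)) a ≡ lookup (inc a (inc b u)) b
  inc-same u e = begin
    lookup (inc a (inc b u)) a ≡⟨ lookup-inc a (inc b u) ⟩
    suc (lookup (inc b u) a)   ≡⟨ cong suc (V.lookup∘updateAt′ a b a≢b u) ⟩
    suc (lookup u a)           ≡⟨ cong suc e ⟩
    suc (lookup u b)           ≡⟨ lookup-inc b u ⟨
    lookup (inc b u) b         ≡⟨ V.lookup∘updateAt′ b a (a≢b ∘ sym) (inc b u) ⟨
    lookup (inc a (inc b u)) b ∎
  -- Subsets containing both `a` and `b` have equal exponents there and vanish by `F0`.
  first : ∀ d → esum⁻ d S₁ (F ∘ inc a) ≡ esum⁻ d S₂ (F ∘ inc a)
  first zero    = refl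
  first (suc d) = trans (esum-remove d S₁ (F ∘ inc a) b eb₁) (trans (cong (_+ esum d S₂ (F ∘ inc a)) (both d)) (ℚ.+-identityˡ _))
    where
    both : ∀ d → esum⁻ d S₂ (F ∘ inc a ∘ inc b) ≡ 0ℚ
    both zero    = refl
    both (suc d) = ∑-All-zero (All.map (λ {u} i → F0 _ (inc-same u (same i))) (indicates-esymMons d S₂))
  -- Subsets containing exactly one of `a` and `b` are paired by exchanging the two.
  middle : ∀ d → esum⁻ d S₂ (F ∘ inc a) + esum⁻ d S₂ (F ∘ inc b) ≡ 0ℚ
  middle zero    = refl
  middle (suc d) = trans (sym (∑-+ (esymMons d S₂) (F ∘ inc a) (F ∘ inc b)))
    (∑-All-zero (All.map (λ i → F± _ (same i)) (indicates-esymMons d S₂)))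

member? : ∀ (S : Subset n) v → Dec (lookup S v ≡ true)
member? S v = lookup S v ≟ᵇ true

nonmember? : ∀ (S : Subset n) v → Dec (lookup S v ≡ false)
nonmember? S v = lookup S v ≟ᵇ false

card-sum : ∀ (S : Subset n) → card S ≡ sum (λ v → 𝟙 (member? S v))
card-sum []          = refl
card-sum (true ∷ S)  = cong suc (card-sum S)
card-sum (false ∷ S) = card-sum S

card-compl : ∀ (S : Subset n) → card S ℕ.+ sum (λ v → 𝟙 (nonmember? S v)) ≡ n
card-compl []          = refl
card-compl (true ∷ S)  = cong suc (card-compl S)
card-compl (false ∷ S) = trans (ℕ.+-suc (card S) _) (cong suc (card-compl S))

count-below : ∀ L m → m ≤ L → m ≤ sum {L} (λ j → 𝟙 (toℕ j ℕ.<? m))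
count-below L       zero    _         = z≤n
count-below (suc L) (suc m) (s≤s m≤L) = s≤s (count-below L m m≤L)

𝟙-× : ∀ {P Q : Set} (P? : Dec P) (Q? : Dec Q) → 𝟙 (P? ×-dec Q?) ≡ 𝟙 P? ℕ.* 𝟙 Q?
𝟙-× (yes _) (yes _) = refl
𝟙-× (yes _) (no _)  = refl
𝟙-× (no _)  _       = refl

𝟙-split : ∀ {P Q : Set} (P? : Dec P) (Q? : Dec Q) → 𝟙 P? ≤ 𝟙 (¬? Q?) ℕ.+ 𝟙 P? ℕ.* 𝟙 Q?
𝟙-split (yes _) (yes _) = s≤s z≤n
𝟙-split (yes _) (no _)  = s≤s z≤n
𝟙-split (no _)  _       = z≤n

columnFn : (Fin n → Maybe ℕ) → Mon n → Fn n
columnFn col x α = fac α * colCoeff col x α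

columnFn-zero : ∀ (col : Fin n → Maybe ℕ) x α → colCoeff col x α ≡ 0ℚ → columnFn col x α ≡ 0ℚ
columnFn-zero col x α e = trans (cong (fac α *_) e) (ℚ.*-zeroʳ (fac α))

lookup-⊞ : ∀ (β u : Mon n) v → lookup (β ⊞ u) v ≡ lookup β v ℕ.+ lookup u v
lookup-⊞ β u v = V.lookup-zipWith ℕ._+_ v β u

-- Columns contained in a subset of the variables

module _ (lam : Vec ℕ s) (col : Fin n → Maybe ℕ) (x : Mon n) (C : Columns lam col x) (S : Subset n) where
  open Columns C

  private
    Good : ℕ → Set
    Good j = ∀ v → col v ≡ just j → lookup S v ≡ true

    good? : ∀ j → Dec (Good j)
    good? j = F.all? (λ v → sameCol? (col v) j →-dec member? S v)

    GoodCol : Maybe ℕ → Set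
    GoodCol (just j) = Good j
    GoodCol nothing  = ⊥

    goodCol? : ∀ c → Dec (GoodCol c)
    goodCol? (just j) = good? j
    goodCol? nothing  = no (λ ())

    good-member : ∀ v → GoodCol (col v) → lookup S v ≡ true
    good-member v g with col v in eq
    ... | just j = g v eq

    L = sum (lookup lam)

    -- Every column that is not good has an entry outside `S`, and different columns have different
    -- entries. So at most n - |S| of the columns meeting row `r` are bad. `L` bounds all row
    -- lengths and makes the range of columns finite.
    row : ∀ r → lookup lam r ∸ (n ∸ card S) ≤ sum {L} (λ j → 𝟙 (toℕ j ℕ.<? lookup lam r) ℕ.* 𝟙 (good? (toℕ j)))
    row r = ℕ.m≤n+o⇒m∸n≤o (lookup lam r) (n ∸ card S) (begin
      lookup lam r                                       ≤⟨ count-below L (lookup lam r) (term≤sum (lookup lam) r) ⟩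
      sum {L} (λ j → 𝟙 (toℕ j ℕ.<? lookup lam r))        ≤⟨ sum-mono _ (λ j → bad j ℕ.+ both j) split ⟩
      sum {L} (λ j → bad j ℕ.+ both j)                   ≡⟨ ∑-distrib-+ bad both ⟩
      sum bad ℕ.+ sum both                               ≤⟨ ℕ.+-monoˡ-≤ (sum both) (double-count R bad _ witness once) ⟩
      sum (λ v → 𝟙 (nonmember? S v)) ℕ.+ sum both        ≡⟨ cong (ℕ._+ sum both) outside-card ⟩
      (n ∸ card S) ℕ.+ sum both                          ∎)
      where
      open ℕ.≤-Reasoning
      bad both : Fin L → ℕ
      bad j = 𝟙 (¬? (good? (toℕ j)))
      both j = 𝟙 (toℕ j ℕ.<? lookup lam r) ℕ.* 𝟙 (good? (toℕ j))
      R? : ∀ (j : Fin L) v → Dec (col v ≡ just (toℕ j) × lookup S v ≡ false)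
      R? j v = sameCol? (col v) (toℕ j) ×-dec nonmember? S v
      R : Fin L → Fin n → ℕ
      R j v = 𝟙 (R? j v)
      split : ∀ j → 𝟙 (toℕ j ℕ.<? lookup lam r) ≤ bad j ℕ.+ both j
      split j = 𝟙-split (toℕ j ℕ.<? lookup lam r) (good? (toℕ j))
      witness : ∀ j → bad j ≤ sum (R j)
      witness j = 𝟙-≤ (¬? (good? (toℕ j))) λ ¬g →
        let v , ¬imp = F.¬∀⟶∃¬ n _ (λ v → sameCol? (col v) (toℕ j) →-dec member? S v) ¬g
        in subst (_≤ sum (R j)) (𝟙-yes (R? j v) (escape v ¬imp)) (term≤sum (R j) v)
        where
        escape : ∀ v → ¬ (col v ≡ just (toℕ j) → lookup S v ≡ true) → col v ≡ just (toℕ j) × lookup S v ≡ false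
        escape v ¬imp with sameCol? (col v) (toℕ j) | lookup S v
        ... | yes e | false = e , refl
        ... | yes e | true  = ⊥-elim (¬imp (λ _ → refl))
        ... | no ¬e | _     = ⊥-elim (¬imp (λ e → ⊥-elim (¬e e)))
      once : ∀ v → sum (λ j → R j v) ≤ 𝟙 (nonmember? S v)
      once v = case (nonmember? S v)
        where
        case : (S? : Dec (lookup S v ≡ false)) → sum (λ j → R j v) ≤ 𝟙 S?
        case (yes _) = sum-𝟙-unique (λ j → R? j v) (λ j j′ p p′ → F.toℕ-injective (Maybe.just-injective (trans (sym (proj₁ p)) (proj₁ p′))))
        case (no ¬e) = ℕ.≤-reflexive (sum-zero (λ j → R j v) (λ j → 𝟙-no (R? j v) (¬e ∘ proj₂)))
      outside-card : sum (λ v → 𝟙 (nonmember? S v)) ≡ n ∸ card S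
      outside-card = trans (sym (ℕ.m+n∸m≡n (card S) _)) (cong (_∸ card S) (card-compl S))

    -- Summing `row` over the rows bounds the excess by the number of boxes in good columns, and by
    -- `full` there are at least that many entries in them.
    excess≤good : excess lam (n ∸ card S) ≤ sum (λ v → 𝟙 (goodCol? (col v)))
    excess≤good = begin
      excess lam (n ∸ card S)
        ≤⟨ sum-mono (λ r → lookup lam r ∸ (n ∸ card S)) (λ r → sum (λ j → cell r j ℕ.* g j)) row ⟩
      sum (λ r → sum (λ j → cell r j ℕ.* g j))
        ≡⟨ ∑-comm (λ r j → cell r j ℕ.* g j) ⟩
      sum (λ j → sum (λ r → cell r j ℕ.* g j))
        ≡⟨ sum-cong-≗ (λ j → *-distribʳ-sum (g j) (λ r → cell r j)) ⟨
      sum {L} (λ j → height lam (toℕ j) ℕ.* g j)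
        ≤⟨ sum-mono (λ j → height lam (toℕ j) ℕ.* g j) (λ j → sum (λ v → incol v j) ℕ.* g j) (λ j → ℕ.*-monoˡ-≤ (g j) (full (toℕ j))) ⟩
      sum (λ j → sum (λ v → incol v j) ℕ.* g j)
        ≡⟨ sum-cong-≗ (λ j → *-distribʳ-sum (g j) (λ v → incol v j)) ⟩
      sum (λ j → sum (λ v → incol v j ℕ.* g j))
        ≡⟨ ∑-comm (λ j v → incol v j ℕ.* g j) ⟩
      sum (λ v → sum (λ j → incol v j ℕ.* g j))
        ≤⟨ sum-mono (λ v → sum (λ j → incol v j ℕ.* g j)) (λ v → 𝟙 (goodCol? (col v))) once ⟩
      sum (λ v → 𝟙 (goodCol? (col v))) ∎
      where
      open ℕ.≤-Reasoning
      cell : Fin s → Fin L → ℕ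
      cell r j = 𝟙 (toℕ j ℕ.<? lookup lam r)
      g : Fin L → ℕ
      g j = 𝟙 (good? (toℕ j))
      incol : Fin n → Fin L → ℕ
      incol v j = 𝟙 (sameCol? (col v) (toℕ j))
      R? : ∀ v (j : Fin L) → Dec (col v ≡ just (toℕ j) × Good (toℕ j))
      R? v j = sameCol? (col v) (toℕ j) ×-dec good? (toℕ j)
      once : ∀ v → sum (λ j → incol v j ℕ.* g j) ≤ 𝟙 (goodCol? (col v))
      once v = ℕ.≤-trans (sum-mono (λ j → incol v j ℕ.* g j) (λ j → 𝟙 (R? v j))
          (λ j → ℕ.≤-reflexive (sym (𝟙-× (sameCol? (col v) (toℕ j)) (good? (toℕ j))))))
        (case (goodCol? (col v)))
        where
        case : (G? : Dec (GoodCol (col v))) → sum (λ j → 𝟙 (R? v j)) ≤ 𝟙 G?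
        case (yes _) = sum-𝟙-unique (R? v) (λ j j′ p p′ → F.toℕ-injective (Maybe.just-injective (trans (sym (proj₁ p)) (proj₁ p′))))
        case (no ¬g) = ℕ.≤-reflexive (sum-zero (λ j → 𝟙 (R? v j)) (λ j → 𝟙-no (R? v j) (λ (e , g) → ¬g (subst GoodCol (sym e) g))))

  -- The set indicated by `u` and the union of the good columns are disjoint subsets of `S`. The
  -- conclusion is the negation of the threshold condition.
  avoid-good : ∀ d u → Indicates d S u → (∀ v → 0 < lookup u v → ¬ GoodCol (col v)) →
               d ℕ.+ excess lam (n ∸ card S) ≤ card S
  avoid-good d u i avoid = begin
    d ℕ.+ excess lam (n ∸ card S)                              ≤⟨ ℕ.+-monoʳ-≤ d excess≤good ⟩
    d ℕ.+ sum (λ v → 𝟙 (goodCol? (col v)))                     ≡⟨ cong (ℕ._+ sum (λ v → 𝟙 (goodCol? (col v)))) (size i) ⟨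
    sum (lookup u) ℕ.+ sum (λ v → 𝟙 (goodCol? (col v)))        ≡⟨ ∑-distrib-+ (lookup u) _ ⟨
    sum (λ v → lookup u v ℕ.+ 𝟙 (goodCol? (col v)))            ≤⟨ sum-mono _ (λ v → 𝟙 (member? S v)) pointwise ⟩
    sum (λ v → 𝟙 (member? S v))                                ≡⟨ card-sum S ⟨
    card S                                                     ∎
    where
    open ℕ.≤-Reasoning
    pointwise : ∀ v → lookup u v ℕ.+ 𝟙 (goodCol? (col v)) ≤ 𝟙 (member? S v)
    pointwise v with lookup u v in eq | goodCol? (col v)
    ... | zero  | no _  = z≤n
    ... | zero  | yes g = ℕ.≤-reflexive (sym (𝟙-yes (member? S v) (good-member v g)))
    ... | suc a | yes g = ⊥-elim (avoid v (subst (0 <_) (sym eq) (s≤s z≤n)) g)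
    ... | suc a | no _  with lookup S v in eq′
    ...   | true  = ℕ.≤-trans (ℕ.≤-reflexive (ℕ.+-identityʳ (suc a))) (subst (_≤ 1) eq (≤1 i v))
    ...   | false with () ← trans (sym eq) (zero-outside i v eq′)

  columns-exceed : ∀ j v → col v ≡ just j → ∀ α → height lam j ≤ lookup α v → columnFn col x α ≡ 0ℚ
  columns-exceed j v e α h = columnFn-zero col x α
    (colCoeff-support col x α v (height lam j) (λ i e′ → inside i j (trans e′ e)) h)

  columns-power : ∀ i β → s ≤ lookup β i → columnFn col x β ≡ 0ℚ
  columns-power i β s≤ with col i in eq
  ... | just j  = columns-exceed j i eq β (ℕ.≤-trans (height≤s lam j) s≤)
  ... | nothing = columnFn-zero col x β (colCoeff-support col x β i s (λ i′ e → outside i′ (trans e eq)) s≤)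

  private
    Clash : Mon n → Fin n → Fin n → Set
    Clash β a b = a ≢ b × GoodCol (col a) × col a ≡ col b × lookup β a ≡ lookup β b

    clash? : ∀ β → Dec (∃ λ a → ∃ λ b → Clash β a b)
    clash? β = F.any? (λ a → F.any? (λ b →
      ¬? (a F.≟ b) ×-dec goodCol? (col a) ×-dec Maybe.≡-dec ℕ._≟_ (col a) (col b) ×-dec (lookup β a ℕ.≟ lookup β b)))

    clash-elementary : ∀ d β → (∃ λ a → ∃ λ b → Clash β a b) → esum d S (columnFn col x ∘ (β ⊞_)) ≡ 0ℚ
    clash-elementary d β (a , b , a≢b , g , ab , βab) with col a in eqa
    ... | just j = esum-antisymmetric d S (columnFn col x ∘ (β ⊞_)) a b a≢b (g a eqa) (g b (sym ab))
          (λ u e → columnFn-zero col x (β ⊞ u) (colCoeff-equal col x a b a≢b j eqa (sym ab) (β ⊞ u) (⊞-same u e)))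
          incs-cancel
      where
      ⊞-same : ∀ u → lookup u a ≡ lookup u b → lookup (β ⊞ u) a ≡ lookup (β ⊞ u) b
      ⊞-same u e = trans (lookup-⊞ β u a) (trans (cong₂ ℕ._+_ βab e) (sym (lookup-⊞ β u b)))
      incs-cancel : ∀ u → lookup u a ≡ lookup u b →
                    columnFn col x (β ⊞ inc a u) + columnFn col x (β ⊞ inc b u) ≡ 0ℚ
      incs-cancel u e = begin
        columnFn col x (β ⊞ inc a u) + columnFn col x (β ⊞ inc b u)
          ≡⟨ cong₂ (λ y z → columnFn col x y + columnFn col x z) (⊞-inc a β u) (⊞-inc b β u) ⟨
        fac (inc a γ) * colCoeff col x (inc a γ) + fac (inc b γ) * colCoeff col x (inc b γ)
          ≡⟨ cong (λ z → fac (inc a γ) * colCoeff col x (inc a γ) + z * colCoeff col x (inc b γ)) fac-same ⟨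
        fac (inc a γ) * colCoeff col x (inc a γ) + fac (inc a γ) * colCoeff col x (inc b γ)
          ≡⟨ ℚ.*-distribˡ-+ (fac (inc a γ)) _ _ ⟨
        fac (inc a γ) * (colCoeff col x (inc a γ) + colCoeff col x (inc b γ))
          ≡⟨ cong (fac (inc a γ) *_) (colCoeff-inc col x a b a≢b j eqa (sym ab) γ (⊞-same u e)) ⟩
        fac (inc a γ) * 0ℚ
          ≡⟨ ℚ.*-zeroʳ (fac (inc a γ)) ⟩
        0ℚ ∎
        where
        open ≡-Reasoning
        γ = β ⊞ u
        -- Equal exponents at `a` and `b` give equal factorial weights, so the cancellation in
        -- `colCoeff` carries over to `columnFn`.
        fac-same : fac (inc a γ) ≡ fac (inc b γ)
        fac-same = trans (fac-inc a γ) (trans (cong (λ z → ℕ→ℚ (suc z) * fac γ) (⊞-same u e)) (sym (fac-inc b γ)))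

    -- If the value is nonzero, the exponents of `β ⊞ u` on a good column are distinct and below its
    -- height, and those of `β` are distinct for want of a clash. By `rigid` they coincide, so `u`
    -- misses every good column and `avoid-good` contradicts the threshold.
    no-clash-vanish : ∀ d β → card S < d ℕ.+ excess lam (n ∸ card S) → ¬ (∃ λ a → ∃ λ b → Clash β a b) →
                      ∀ {u} → Indicates d S u → columnFn col x (β ⊞ u) ≡ 0ℚ
    no-clash-vanish d β thr ¬clash {u} i with columnFn col x (β ⊞ u) ℚ.≟ 0ℚ
    ... | yes e = e
    ... | no nz = ⊥-elim (ℕ.<⇒≱ thr (avoid-good d u i avoid))
      where
      avoid : ∀ v → 0 < lookup u v → ¬ GoodCol (col v)
      avoid v 0<u g with col v in eq
      ... | just j = rigid (λ w → sameCol? (col w) j) (lookup β) (lookup (β ⊞ u)) (height lam j) (full j)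
            injβ injβ′ (λ w → subst (lookup β w ≤_) (sym (lookup-⊞ β u w)) (ℕ.m≤m+n _ _)) bound v eq
            (subst (lookup β v <_) (sym (lookup-⊞ β u v)) (ℕ.m<m+n (lookup β v) 0<u))
        where
        injβ : ∀ w w′ → col w ≡ just j → col w′ ≡ just j → lookup β w ≡ lookup β w′ → w ≡ w′
        injβ w w′ e e′ same with w F.≟ w′
        ... | yes w≡w′ = w≡w′
        ... | no w≢w′  = ⊥-elim (¬clash (w , w′ , w≢w′ , subst GoodCol (sym e) g , trans e (sym e′) , same))
        injβ′ : ∀ w w′ → col w ≡ just j → col w′ ≡ just j → lookup (β ⊞ u) w ≡ lookup (β ⊞ u) w′ → w ≡ w′
        injβ′ w w′ e e′ same with w F.≟ w′
        ... | yes w≡w′ = w≡w′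
        ... | no w≢w′  = ⊥-elim (nz (columnFn-zero col x (β ⊞ u) (colCoeff-equal col x w w′ w≢w′ j e e′ (β ⊞ u) same)))
        bound : ∀ w → col w ≡ just j → lookup (β ⊞ u) w < height lam j
        bound w e with ℕ.<-≤-connex (lookup (β ⊞ u) w) (height lam j)
        ... | inj₁ l = l
        ... | inj₂ h = ⊥-elim (nz (columns-exceed j w e (β ⊞ u) h))

  columns-elementary : ∀ d β → card S < d ℕ.+ excess lam (n ∸ card S) → esum d S (columnFn col x ∘ (β ⊞_)) ≡ 0ℚ
  columns-elementary d β thr with clash? β
  ... | yes c = clash-elementary d β c
  ... | no ¬c = ∑-All-zero (All.map (no-clash-vanish d β thr ¬c) (indicates-esymMons d S))

columnFn-harmonic : ∀ {lam : Vec ℕ s} {col : Fin n → Maybe ℕ} {x} → Columns lam col x → Harmonic n lam (columnFn col x)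
columnFn-harmonic {n = n} {lam = lam} {col} {x} C = record
  { power = columns-power lam col x C (replicate n false)
  ; elementary = columns-elementary lam col x C }

-- Fillings and the removal of a box

below : Vec ℕ s → Fin s → ℕ → ℕ
below lam i j = sum (λ i′ → 𝟙 ((toℕ i ℕ.<? toℕ i′) ×-dec (j ℕ.<? lookup lam i′)))

-- Entries are natural numbers, since no function into Fin 0 can represent the empty filling for n = 0.
record Fills {s : ℕ} (n : ℕ) (lam : Vec ℕ s) (T : Fin s → ℕ → ℕ) (col : Fin n → Maybe ℕ) (x : Mon n) : Set where
  field
    range : ∀ i j → j < lookup lam i → T i j < n
    injective : ∀ i j i′ j′ → j < lookup lam i → j′ < lookup lam i′ → T i j ≡ T i′ j′ → i ≡ i′ × j ≡ j′
    increasing : ∀ i i′ j → toℕ i < toℕ i′ → j < lookup lam i′ → T i j < T i′ j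
    on : ∀ i j v → j < lookup lam i → T i j ≡ toℕ v → col v ≡ just j × lookup x v ≡ below lam i j
    off : ∀ v → (∀ i j → j < lookup lam i → T i j ≢ toℕ v) → col v ≡ nothing × lookup x v ≡ s ∸ 1

Occupies : Vec ℕ s → (Fin s → ℕ → ℕ) → ℕ → Set
Occupies lam T v = ∃ λ i → ∃ λ j → j < lookup lam i × T i j ≡ v

occupies? : ∀ (lam : Vec ℕ s) T v → Dec (Occupies lam T v)
occupies? lam T v = F.any? (λ i → ℕ.anyUpTo? (λ j → T i j ℕ.≟ v) (lookup lam i))

below<height : ∀ (lam : Vec ℕ s) i j → j < lookup lam i → below lam i j < height lam j
below<height lam i j j<λ = begin
  1 ℕ.+ below lam i j                ≤⟨ ℕ.+-monoˡ-≤ (below lam i j) (subst (_≤ sum at) (𝟙-yes (i F.≟ i) refl) (term≤sum at i)) ⟩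
  sum at ℕ.+ below lam i j           ≡⟨ ∑-distrib-+ at later ⟨
  sum (λ i′ → at i′ ℕ.+ later i′)    ≤⟨ sum-mono (λ i′ → at i′ ℕ.+ later i′) (λ i′ → 𝟙 (j ℕ.<? lookup lam i′)) pointwise ⟩
  height lam j                       ∎
  where
  open ℕ.≤-Reasoning
  at later : Fin _ → ℕ
  at i′ = 𝟙 (i′ F.≟ i)
  later i′ = 𝟙 ((toℕ i ℕ.<? toℕ i′) ×-dec (j ℕ.<? lookup lam i′))
  one : ∀ i′ → j < lookup lam i′ → 1 ≤ 𝟙 (j ℕ.<? lookup lam i′)
  one i′ l = ℕ.≤-reflexive (sym (𝟙-yes (j ℕ.<? lookup lam i′) l))
  pointwise : ∀ i′ → at i′ ℕ.+ later i′ ≤ 𝟙 (j ℕ.<? lookup lam i′)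
  pointwise i′ with i′ F.≟ i
  ... | no _     = 𝟙-≤ ((toℕ i ℕ.<? toℕ i′) ×-dec (j ℕ.<? lookup lam i′)) (one i′ ∘ proj₂)
  ... | yes refl = subst (λ z → suc z ≤ 𝟙 (j ℕ.<? lookup lam i))
        (sym (𝟙-no ((toℕ i ℕ.<? toℕ i) ×-dec (j ℕ.<? lookup lam i)) (ℕ.<-irrefl refl ∘ proj₁))) (one i j<λ)

module _ {lam : Vec ℕ s} {T : Fin s → ℕ → ℕ} {col : Fin n → Maybe ℕ} {x : Mon n} (0<s : 0 < s) (fills : Fills n lam T col x) where
  open Fills fills

  fills⇒columns : Columns lam col x
  fills⇒columns = record { full = full ; inside = inside ; outside = outside }
    where
    full : ∀ j → height lam j ≤ sum (λ v → 𝟙 (sameCol? (col v) j))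
    full j = double-count (λ r v → 𝟙 (R? r v)) (λ r → 𝟙 (j ℕ.<? lookup lam r)) (λ v → 𝟙 (sameCol? (col v) j)) total once
      where
      R? : ∀ r v → Dec (j < lookup lam r × T r j ≡ toℕ v)
      R? r v = (j ℕ.<? lookup lam r) ×-dec (T r j ℕ.≟ toℕ v)
      total : ∀ r → 𝟙 (j ℕ.<? lookup lam r) ≤ sum (λ v → 𝟙 (R? r v))
      total r = 𝟙-≤ (j ℕ.<? lookup lam r) λ l →
        let v = F.fromℕ< (range r j l)
        in subst (_≤ sum (λ v → 𝟙 (R? r v))) (𝟙-yes (R? r v) (l , sym (F.toℕ-fromℕ< (range r j l))))
             (term≤sum (λ v → 𝟙 (R? r v)) v)
      once : ∀ v → sum (λ r → 𝟙 (R? r v)) ≤ 𝟙 (sameCol? (col v) j)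
      once v = case (sameCol? (col v) j)
        where
        case : (C? : Dec (col v ≡ just j)) → sum (λ r → 𝟙 (R? r v)) ≤ 𝟙 C?
        case (yes _) = sum-𝟙-unique (λ r → R? r v)
          (λ r r′ (l , e) (l′ , e′) → proj₁ (injective r j r′ j l l′ (trans e (sym e′))))
        case (no ¬c) = ℕ.≤-reflexive (sum-zero (λ r → 𝟙 (R? r v)) (λ r → 𝟙-no (R? r v) (λ (l , e) → ¬c (proj₁ (on r j v l e)))))
    inside : ∀ v j → col v ≡ just j → lookup x v < height lam j
    inside v j c with occupies? lam T (toℕ v)
    ... | no ¬o with () ← trans (sym c) (proj₁ (off v (λ i j l e → ¬o (i , j , l , e))))
    ... | yes (i , j′ , l , e) with on i j′ v l e
    ...   | c′ , x≡ with refl ← trans (sym c) c′ = subst (_< height lam j) (sym x≡) (below<height lam i j l)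
    outside : ∀ v → col v ≡ nothing → lookup x v < s
    outside v c with occupies? lam T (toℕ v)
    ... | no ¬o = subst (_< s) (sym (proj₂ (off v (λ i j l e → ¬o (i , j , l , e)))))
            (ℕ.∸-monoʳ-< {s} {1} {0} (s≤s z≤n) 0<s)
    ... | yes (i , j , l , e) with () ← trans (sym c) (proj₁ (on i j v l e))

infixr 5 _◂_
_◂_ : Maybe ℕ → (Fin n → Maybe ℕ) → Fin (suc n) → Maybe ℕ
(c ◂ col) zero    = c
(c ◂ col) (suc v) = col v

fills-nil : ∀ (lam : Vec ℕ s) → (∀ i → lookup lam i ≡ 0) → Fills 0 lam (λ _ _ → 0) (λ ()) []
fills-nil lam empty = record
  { range = λ i j l → ⊥-elim (none i l)
  ; injective = λ i _ _ _ l → ⊥-elim (none i l)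
  ; increasing = λ _ i′ _ _ l → ⊥-elim (none i′ l)
  ; on = λ _ _ ()
  ; off = λ () }
  where
  none : ∀ i {j} → j < lookup lam i → ⊥
  none i l with () ← subst (_ <_) (empty i) l

fills-skip : ∀ {lam : Vec ℕ s} {T} {col : Fin n → Maybe ℕ} {x} → Fills n lam T col x →
             Fills (suc n) lam (λ i j → suc (T i j)) (nothing ◂ col) (s ∸ 1 ∷ x)
fills-skip f = record
  { range = λ i j l → s≤s (range i j l)
  ; injective = λ i j i′ j′ l l′ e → injective i j i′ j′ l l′ (ℕ.suc-injective e)
  ; increasing = λ i i′ j l l′ → s≤s (increasing i i′ j l l′)
  ; on = λ { i j zero l () ; i j (suc v) l e → on i j v l (ℕ.suc-injective e) }
  ; off = λ { zero h → refl , refl ; (suc v) h → off v (λ i j l e → h i j l (cong suc e)) } }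
  where open Fills f

-- lam′ arises from lam by removing the last box of column c.
record Removes (lam lam′ : Vec ℕ (suc s)) (c : ℕ) : Set where
  field
    same⁺ : ∀ i j → j ≢ c → j < lookup lam i → j < lookup lam′ i
    same⁻ : ∀ i j → j ≢ c → j < lookup lam′ i → j < lookup lam i
    top : c < lookup lam zero
    down⁺ : ∀ i → c < lookup lam (suc i) → c < lookup lam′ (F.inject₁ i)
    down⁻ : ∀ i → c < lookup lam′ (F.inject₁ i) → c < lookup lam (suc i)
    last : ¬ c < lookup lam′ (F.fromℕ s)

𝟙-⇔ : ∀ {P Q : Set} (P? : Dec P) (Q? : Dec Q) → (P → Q) → (Q → P) → 𝟙 P? ≡ 𝟙 Q?
𝟙-⇔ P? Q? f g = cong (λ b → if b then 1 else 0) (does-⇔ (mk⇔ f g) P? Q?)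

sum-inject₁ : ∀ (f : Fin (suc n) → ℕ) → f (F.fromℕ n) ≡ 0 → sum f ≡ sum (f ∘ F.inject₁)
sum-inject₁ f e = trans (sum-init-last f) (trans (cong (sum (f ∘ F.inject₁) ℕ.+_) e) (ℕ.+-identityʳ _))

module _ {lam lam′ : Vec ℕ (suc s)} {c : ℕ} (rem : Removes lam lam′ c) where
  open Removes rem

  height-removed : sum (λ k → 𝟙 (c ℕ.<? lookup lam (suc k))) ≡ height lam′ c
  height-removed = trans (sum-cong-≗ (λ k → 𝟙-⇔ (c ℕ.<? lookup lam (suc k)) (c ℕ.<? lookup lam′ (F.inject₁ k)) (down⁺ k) (down⁻ k)))
    (sym (sum-inject₁ (λ k → 𝟙 (c ℕ.<? lookup lam′ k)) (𝟙-no (c ℕ.<? lookup lam′ (F.fromℕ s)) last)))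

  height-removes : height lam c ≡ suc (height lam′ c)
  height-removes = cong₂ ℕ._+_ (𝟙-yes (c ℕ.<? lookup lam zero) top) height-removed

  below-top : below lam zero c ≡ height lam′ c
  below-top = trans (cong₂ ℕ._+_ (𝟙-no ((0 ℕ.<? 0) ×-dec (c ℕ.<? lookup lam zero)) (λ ()))
    (sum-cong-≗ (λ k → 𝟙-⇔ ((0 ℕ.<? suc (toℕ k)) ×-dec (c ℕ.<? lookup lam (suc k))) (c ℕ.<? lookup lam (suc k)) proj₂ (s≤s z≤n ,_))))
    height-removed

  below-same : ∀ i j → j ≢ c → below lam i j ≡ below lam′ i j
  below-same i j j≢c = sum-cong-≗ (λ k → 𝟙-⇔ ((toℕ i ℕ.<? toℕ k) ×-dec (j ℕ.<? lookup lam k)) ((toℕ i ℕ.<? toℕ k) ×-dec (j ℕ.<? lookup lam′ k))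
    (λ (l , b) → l , same⁺ k j j≢c b) (λ (l , b) → l , same⁻ k j j≢c b))

  below-down : ∀ i → below lam (suc i) c ≡ below lam′ (F.inject₁ i) c
  below-down i = trans (cong₂ ℕ._+_ (𝟙-no ((suc (toℕ i) ℕ.<? 0) ×-dec (c ℕ.<? lookup lam zero)) (λ ()))
      (sum-cong-≗ (λ k → 𝟙-⇔ ((suc (toℕ i) ℕ.<? suc (toℕ k)) ×-dec (c ℕ.<? lookup lam (suc k))) (R? (F.inject₁ k))
        (λ (l , b) → subst₂ _<_ (sym (F.toℕ-inject₁ i)) (sym (F.toℕ-inject₁ k)) (ℕ.s<s⁻¹ l) , down⁺ k b)
        (λ (l , b) → s≤s (subst₂ _<_ (F.toℕ-inject₁ i) (F.toℕ-inject₁ k) l) , down⁻ k b))))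
    (sym (sum-inject₁ (λ k → 𝟙 (R? k)) (𝟙-no (R? (F.fromℕ s)) (last ∘ proj₂))))
    where
    R? : ∀ k → Dec (toℕ (F.inject₁ i) < toℕ k × c < lookup lam′ k)
    R? k = (toℕ (F.inject₁ i) ℕ.<? toℕ k) ×-dec (c ℕ.<? lookup lam′ k)

  -- Column `c` slides down one row below the new entry 0, and all old entries are renumbered by
  -- `suc`. Fillings obey no condition along rows, so the other columns can stay in place.
  pushTop : (Fin (suc s) → ℕ → ℕ) → Fin (suc s) → ℕ → ℕ
  pushTop T i j with j ℕ.≟ c
  pushTop T i       j | no _  = suc (T i j)
  pushTop T zero    j | yes _ = 0
  pushTop T (suc i) j | yes _ = suc (T (F.inject₁ i) j)

  -- Exponents count the boxes below, so a box added on top changes none of the old ones, and the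
  -- new entry has the whole old column below it.
  fills-push : ∀ {T} {col : Fin n → Maybe ℕ} {x} → Fills n lam′ T col x →
               Fills (suc n) lam (pushTop T) (just c ◂ col) (height lam′ c ∷ x)
  fills-push {n} {T} {col} {x} f = record
    { range = range′ ; injective = injective′ ; increasing = increasing′ ; on = on′ ; off = off′ }
    where
    open Fills f
    range′ : ∀ i j → j < lookup lam i → pushTop T i j < suc n
    range′ i j l with j ℕ.≟ c
    range′ i       j l | no j≢c   = s≤s (range i j (same⁺ i j j≢c l))
    range′ zero    j l | yes _    = s≤s z≤n
    range′ (suc i) j l | yes refl = s≤s (range (F.inject₁ i) j (down⁺ i l))
    injective′ : ∀ i j i′ j′ → j < lookup lam i → j′ < lookup lam i′ → pushTop T i j ≡ pushTop T i′ j′ → i ≡ i′ × j ≡ j′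
    injective′ i j i′ j′ l l′ e with j ℕ.≟ c | j′ ℕ.≟ c
    injective′ i j i′ j′ l l′ e | no j≢c | no j′≢c =
      injective i j i′ j′ (same⁺ i j j≢c l) (same⁺ i′ j′ j′≢c l′) (ℕ.suc-injective e)
    injective′ i j (suc i′) j′ l l′ e | no j≢c | yes refl =
      ⊥-elim (j≢c (proj₂ (injective i j (F.inject₁ i′) j′ (same⁺ i j j≢c l) (down⁺ i′ l′) (ℕ.suc-injective e))))
    injective′ (suc i) j i′ j′ l l′ e | yes refl | no j′≢c =
      ⊥-elim (j′≢c (sym (proj₂ (injective (F.inject₁ i) j i′ j′ (down⁺ i l) (same⁺ i′ j′ j′≢c l′) (ℕ.suc-injective e)))))
    injective′ zero    j zero     j′ l l′ e | yes refl | yes refl = refl , refl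
    injective′ (suc i) j (suc i′) j′ l l′ e | yes refl | yes refl =
      cong suc (F.inject₁-injective (proj₁ (injective (F.inject₁ i) j (F.inject₁ i′) j′ (down⁺ i l) (down⁺ i′ l′) (ℕ.suc-injective e)))) , refl
    increasing′ : ∀ i i′ j → toℕ i < toℕ i′ → j < lookup lam i′ → pushTop T i j < pushTop T i′ j
    increasing′ i i′ j l b with j ℕ.≟ c
    increasing′ i       i′       j l b       | no j≢c   = s≤s (increasing i i′ j l (same⁺ i′ j j≢c b))
    increasing′ zero    (suc i′) j l b       | yes refl = s≤s z≤n
    increasing′ (suc i) (suc i′) j (s≤s l) b | yes refl =
      s≤s (increasing (F.inject₁ i) (F.inject₁ i′) j (subst₂ _<_ (sym (F.toℕ-inject₁ i)) (sym (F.toℕ-inject₁ i′)) l) (down⁺ i′ b))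
    on′ : ∀ i j v → j < lookup lam i → pushTop T i j ≡ toℕ v →
          (just c ◂ col) v ≡ just j × lookup (height lam′ c ∷ x) v ≡ below lam i j
    on′ i j v l e with j ℕ.≟ c
    on′ i j (suc v) l e | no j≢c with on i j v (same⁺ i j j≢c l) (ℕ.suc-injective e)
    ... | ec , ex = ec , trans ex (sym (below-same i j j≢c))
    on′ zero j zero l e | yes refl = refl , sym below-top
    on′ (suc i) j (suc v) l e | yes refl with on (F.inject₁ i) j v (down⁺ i l) (ℕ.suc-injective e)
    ... | ec , ex = ec , trans ex (sym (below-down i))
    pushTop-top : pushTop T zero c ≡ 0
    pushTop-top with c ℕ.≟ c
    ... | yes _  = refl
    ... | no c≢c = ⊥-elim (c≢c refl)
    pushTop-down : ∀ i → pushTop T (suc i) c ≡ suc (T (F.inject₁ i) c)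
    pushTop-down i with c ℕ.≟ c
    ... | yes _  = refl
    ... | no c≢c = ⊥-elim (c≢c refl)
    pushTop-same : ∀ i j → j ≢ c → pushTop T i j ≡ suc (T i j)
    pushTop-same i j j≢c with j ℕ.≟ c
    ... | yes j≡c = ⊥-elim (j≢c j≡c)
    ... | no _    = refl
    off′ : ∀ v → (∀ i j → j < lookup lam i → pushTop T i j ≢ toℕ v) →
           (just c ◂ col) v ≡ nothing × lookup (height lam′ c ∷ x) v ≡ s
    off′ zero    h = ⊥-elim (h zero c top pushTop-top)
    off′ (suc v) h = off v free
      where
      free : ∀ i j → j < lookup lam′ i → T i j ≢ toℕ v
      free i j l e with j ℕ.≟ c
      ... | no j≢c = h i j (same⁻ i j j≢c l) (trans (pushTop-same i j j≢c) (cong suc e))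
      ... | yes refl with view i
      ...   | ‵fromℕ     = last l
      ...   | ‵inject₁ i = h (suc i) j (down⁻ i l) (trans (pushTop-down i) (cong suc e))

-- Induction on the number of variables

-- The counterpart of `InDerivSpan` for functions on monomials. Taking `Fills` as generators lets
-- the induction reach n = 0, where the empty filling is needed.
data Span {s : ℕ} (n : ℕ) (lam : Vec ℕ s) : Fn n → Set where
  base  : ∀ {T col x} → Fills n lam T col x → Span n lam (columnFn col x)
  zer   : Span n lam (λ _ → 0ℚ)
  add   : ∀ {F G} → Span n lam F → Span n lam G → Span n lam (λ α → F α + G α)
  scal  : ∀ q {F} → Span n lam F → Span n lam (λ α → q * F α)
  shift : ∀ i {F} → Span n lam F → Span n lam (F ∘ inc i)
  resp  : ∀ {F G} → Span n lam F → (∀ α → F α ≡ G α) → Span n lam G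

lookup-≤-inc : ∀ (i j : Fin n) β → lookup β j ≤ lookup (inc i β) j
lookup-≤-inc i j β with j F.≟ i
... | yes refl = ℕ.≤-trans (ℕ.n≤1+n _) (ℕ.≤-reflexive (sym (lookup-inc j β)))
... | no j≢i   = ℕ.≤-reflexive (sym (V.lookup∘updateAt′ j i j≢i β))

module _ {lam : Vec ℕ s} where
  open Harmonic

  harmonic-zer : Harmonic n lam (λ _ → 0ℚ)
  harmonic-zer = record { power = λ _ _ _ → refl ; elementary = λ S d _ _ → ∑-zero (esymMons d S) (λ _ → refl) }

  harmonic-add : ∀ {F G : Fn n} → Harmonic n lam F → Harmonic n lam G → Harmonic n lam (λ α → F α + G α)
  harmonic-add {F = F} {G} f g = record
    { power = λ i β h → cong₂ _+_ (power f i β h) (power g i β h)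
    ; elementary = λ S d β h → trans (∑-+ (esymMons d S) (F ∘ (β ⊞_)) (G ∘ (β ⊞_)))
        (cong₂ _+_ (elementary f S d β h) (elementary g S d β h)) }

  harmonic-scal : ∀ q {F : Fn n} → Harmonic n lam F → Harmonic n lam (λ α → q * F α)
  harmonic-scal q {F} f = record
    { power = λ i β h → trans (cong (q *_) (power f i β h)) (ℚ.*-zeroʳ q)
    ; elementary = λ S d β h → trans (∑-*ˡ q (esymMons d S) (F ∘ (β ⊞_)))
        (trans (cong (q *_) (elementary f S d β h)) (ℚ.*-zeroʳ q)) }

  harmonic-shift : ∀ i {F : Fn n} → Harmonic n lam F → Harmonic n lam (F ∘ inc i)
  harmonic-shift i {F} f = record
    { power = λ j β h → power f j (inc i β) (ℕ.≤-trans h (lookup-≤-inc i j β))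
    ; elementary = λ S d β h → trans (∑-cong (esymMons d S) (λ u → cong F (inc-⊞ i β u)))
        (elementary f S d (inc i β) h) }

  harmonic-resp : ∀ {F G : Fn n} → Harmonic n lam F → (∀ α → F α ≡ G α) → Harmonic n lam G
  harmonic-resp f e = record
    { power = λ i β h → trans (sym (e β)) (power f i β h)
    ; elementary = λ S d β h → trans (∑-cong (esymMons d S) (λ u → sym (e (β ⊞ u)))) (elementary f S d β h) }

  span⇒harmonic : 0 < s → ∀ {F : Fn n} → Span n lam F → Harmonic n lam F
  span⇒harmonic 0<s (base f)    = columnFn-harmonic (fills⇒columns 0<s f)
  span⇒harmonic 0<s zer         = harmonic-zer
  span⇒harmonic 0<s (add f g)   = harmonic-add (span⇒harmonic 0<s f) (span⇒harmonic 0<s g)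
  span⇒harmonic 0<s (scal q f)  = harmonic-scal q (span⇒harmonic 0<s f)
  span⇒harmonic 0<s (shift i f) = harmonic-shift i (span⇒harmonic 0<s f)
  span⇒harmonic 0<s (resp f e)  = harmonic-resp (span⇒harmonic 0<s f) e

-- A member of the span of degree ≤ i in x₀ whose coefficient of x₀ⁱ (up to i!) is G.
Lifts : ∀ {s n} → Vec ℕ s → ℕ → Fn n → Set
Lifts {n = n} lam i G = ∃ λ F → Span (suc n) lam F × (∀ α → F (i ∷ α) ≡ G α) × (∀ a α → i < a → F (a ∷ α) ≡ 0ℚ)

span-shift^ : ∀ {lam : Vec ℕ s} i m {F : Fn n} → Span n lam F → Span n lam (F ∘ inc^ i m)
span-shift^ i zero    f = f
span-shift^ i (suc m) f = shift i (span-shift^ i m f)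

-- Apply the derivative by x₀ `X ∸ i` times and divide by `q`. Because derivatives are shifts here,
-- no further constants arise.
lifts-degree : ∀ {lam : Vec ℕ s} {i X} {F : Fn (suc n)} {G : Fn n} {q} → q ≢ 0ℚ → i ≤ X → Span (suc n) lam F →
               (∀ α → F (X ∷ α) ≡ q * G α) → (∀ a α → X < a → F (a ∷ α) ≡ 0ℚ) → Lifts lam i G
lifts-degree {i = i} {X} {F} {G} {q} q≢0 i≤X f top above =
  _ , scal (1/ q) (span-shift^ zero (X ∸ i) f) , top′ , above′
  where
  instance _ = ≢-nonZero q≢0
  top′ : ∀ α → 1/ q * F (inc^ zero (X ∸ i) (i ∷ α)) ≡ G α
  top′ α = begin
    1/ q * F (inc^ zero (X ∸ i) (i ∷ α))
      ≡⟨ cong (λ β → 1/ q * F β) (trans (inc^-zero (X ∸ i) i α) (cong (_∷ α) (ℕ.m+[n∸m]≡n i≤X))) ⟩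
    1/ q * F (X ∷ α)      ≡⟨ cong (1/ q *_) (top α) ⟩
    1/ q * (q * G α)      ≡⟨ ℚ.*-assoc (1/ q) q (G α) ⟨
    (1/ q * q) * G α      ≡⟨ cong (_* G α) (ℚ.*-inverseˡ q) ⟩
    1ℚ * G α              ≡⟨ ℚ.*-identityˡ (G α) ⟩
    G α                   ∎
    where open ≡-Reasoning
  above′ : ∀ a α → i < a → 1/ q * F (inc^ zero (X ∸ i) (a ∷ α)) ≡ 0ℚ
  above′ a α i<a = trans (cong (1/ q *_) (trans (cong F (inc^-zero (X ∸ i) a α))
    (above (a ℕ.+ (X ∸ i)) α (subst (_< a ℕ.+ (X ∸ i)) (ℕ.m+[n∸m]≡n i≤X) (ℕ.+-monoˡ-< (X ∸ i) i<a)))))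
    (ℚ.*-zeroʳ (1/ q))

-- Taking the coefficient of x₀ⁱ is linear and commutes with derivatives by the other variables, so
-- lifting the generators suffices.
lifts-span : ∀ {lam lam′ : Vec ℕ s} {i} →
  (∀ {T col x} → Fills n lam′ T col x → Lifts lam i (columnFn col x)) →
  ∀ {G} → Span n lam′ G → Lifts lam i G
lifts-span b (base f) = b f
lifts-span b zer      = _ , zer , (λ _ → refl) , (λ _ _ _ → refl)
lifts-span b (add f g) with lifts-span b f | lifts-span b g
... | F , sF , tF , aF | G , sG , tG , aG =
  _ , add sF sG , (λ α → cong₂ _+_ (tF α) (tG α)) , (λ a α h → cong₂ _+_ (aF a α h) (aG a α h))
lifts-span b (scal q f) with lifts-span b f
... | F , sF , tF , aF =
  _ , scal q sF , (λ α → cong (q *_) (tF α)) , (λ a α h → trans (cong (q *_) (aF a α h)) (ℚ.*-zeroʳ q))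
lifts-span b (shift j f) with lifts-span b f
... | F , sF , tF , aF = _ , shift (suc j) sF , (λ α → tF (inc j α)) , (λ a α h → aF a (inc j α) h)
lifts-span b (resp f e) with lifts-span b f
... | F , sF , tF , aF = F , sF , (λ α → trans (tF α) (e α)) , aF

columnFn-head : ∀ (c : Maybe ℕ) (col : Fin n → Maybe ℕ) x₀ x →
  (∀ q j → c ≡ just j → col q ≡ just j → lookup x q < x₀) →
  ∀ α → columnFn (c ◂ col) (x₀ ∷ x) (x₀ ∷ α) ≡ fact x₀ * columnFn col x α
columnFn-head c col x₀ x h α = trans (cong (fact x₀ * fac α *_) (colCoeff-head (c ◂ col) x₀ x h α))
  (ℚ.*-assoc (fact x₀) (fac α) _)

-- Outside the filling, x₀ has the largest exponent that the power relations permit, here `s` for a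
-- shape with `suc s` parts; every admissible `i` lies below it.
lifts-skip : ∀ {lam : Vec ℕ (suc s)} {i} → i ≤ s → ∀ {G : Fn n} → Span n lam G → Lifts lam i G
lifts-skip {s} {lam = lam} i≤s = lifts-span λ {T} {col} {x} f →
  lifts-degree (fact≢0 s) i≤s (base (fills-skip f)) (columnFn-head nothing col s x (λ _ _ ()))
    (λ a α s<a → Harmonic.power (columnFn-harmonic (fills⇒columns (s≤s z≤n) (fills-skip f))) zero (a ∷ α) s<a)

-- On top of column `c`, x₀ has exponent `height lam′ c`. This is also the top degree of δ_T in x₀,
-- since exponents in a column stay below its height.
lifts-push : ∀ {lam lam′ : Vec ℕ (suc s)} {c i} → Removes lam lam′ c → i ≤ height lam′ c →
             ∀ {G : Fn n} → Span n lam′ G → Lifts lam i G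
lifts-push {lam = lam} {lam′} {c} rem i≤h = lifts-span λ {T} {col} {x} f →
  lifts-degree (fact≢0 (height lam′ c)) i≤h (base (fills-push rem f))
    (columnFn-head (just c) col (height lam′ c) x
      (λ { q j refl e → Columns.inside (fills⇒columns (s≤s z≤n) f) q j e }))
    (λ a α h<a → columns-exceed lam (just c ◂ col) (height lam′ c ∷ x)
      (fills⇒columns (s≤s z≤n) (fills-push rem f)) (replicate _ false) c zero refl (a ∷ α)
      (subst (_≤ a) (sym (height-removes rem)) h<a))

-- Shapes with one box fewer

Antitone : Vec ℕ s → Set
Antitone {s} lam = ∀ (i j : Fin s) → toℕ i ≤ toℕ j → lookup lam j ≤ lookup lam i

lastIndex : ∀ {P : Fin n → Set} (P? : ∀ i → Dec (P i)) i → P i →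
            ∃ λ r → toℕ i ≤ toℕ r × P r × (∀ k → toℕ r < toℕ k → ¬ P k)
lastIndex {suc n} P? i pi with F.any? (P? ∘ suc)
lastIndex {suc n} P? i pi | yes (k , pk) with lastIndex (P? ∘ suc) k pk
lastIndex {suc n} P? zero    pi | yes _ | r , _ , pr , max = suc r , z≤n , pr , λ { (suc k) (s≤s l) → max k l }
lastIndex {suc n} P? (suc i) pi | yes _ | _ with lastIndex (P? ∘ suc) i pi
... | r , i≤r , pr , max = suc r , s≤s i≤r , pr , λ { (suc k) (s≤s l) → max k l }
lastIndex {suc n} P? zero    pi | no ¬p = zero , z≤n , pi , λ { (suc k) _ pk → ¬p (k , pk) }
lastIndex {suc n} P? (suc i) pi | no ¬p = ⊥-elim (¬p (i , pi))

prefix-count : ∀ {P : Fin n → Set} (P? : ∀ k → Dec (P k)) m → m ≤ n → (∀ k → toℕ k < m → P k) → m ≤ sum (λ k → 𝟙 (P? k))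
prefix-count         P? zero    _         h = z≤n
prefix-count {suc n} P? (suc m) (s≤s m≤n) h = ℕ.+-mono-≤
  (ℕ.≤-reflexive (sym (𝟙-yes (P? zero) (h zero (s≤s z≤n)))))
  (prefix-count (P? ∘ suc) m m≤n (λ k l → h (suc k) (s≤s l)))

sum-mono-< : ∀ (f g : Fin n → ℕ) r → (∀ k → f k ≤ g k) → f r < g r → sum f < sum g
sum-mono-< f g zero    le lt = ℕ.+-mono-<-≤ lt (sum-mono (f ∘ suc) (g ∘ suc) (le ∘ suc))
sum-mono-< f g (suc r) le lt = ℕ.+-mono-≤-< (le zero) (sum-mono-< (f ∘ suc) (g ∘ suc) r (le ∘ suc) lt)

∸-step : ∀ m c → m ∸ c ≤ (m ∸ suc c) ℕ.+ 1
∸-step zero    zero    = z≤n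
∸-step zero    (suc c) = z≤n
∸-step (suc m) zero    = ℕ.≤-reflexive (ℕ.+-comm 1 m)
∸-step (suc m) (suc c) = ∸-step m c

-- lam′ stands for the shape that carries the coefficient of x₀ⁱ: lam without the last box of the column
-- that ends row i, or lam itself if row i is empty.
record Shrinks (lam lam′ : Vec ℕ (suc s)) (i : Fin (suc s)) : Set where
  field
    antitone : Antitone lam′
    excess-≤ : ∀ c → excess lam′ c ≤ excess lam c
    excess-< : ∀ c → c < lookup lam i → excess lam′ c < excess lam c
    lifts : ∀ {n} {G : Fn n} → Span n lam′ G → Lifts lam (toℕ i) G

module _ (lam : Vec ℕ (suc s)) (anti : Antitone lam) (i : Fin (suc s)) where

  shrinks-empty : lookup lam i ≡ 0 → Shrinks lam lam i
  shrinks-empty e = record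
    { antitone = anti
    ; excess-≤ = λ c → ℕ.≤-refl
    ; excess-< = λ c l → ⊥-elim (ℕ.n≮0 (subst (c <_) e l))
    ; lifts = lifts-skip (ℕ.≤-pred (F.toℕ<n i)) }

  -- The box is taken from `r`, the last row reaching column `c`, so that the rows remain weakly
  -- decreasing. As i ≤ r, row `r` also has length exactly `suc c`.
  shrinks-box : ∀ c → lookup lam i ≡ suc c → ∃ λ lam′ → Shrinks lam lam′ i
  shrinks-box c e with lastIndex (λ k → c ℕ.<? lookup lam k) i (ℕ.≤-reflexive (sym e))
  ... | r , i≤r , c<r , max = lam′ , record
    { antitone = antitone
    ; excess-≤ = λ b → sum-mono (λ k → lookup lam′ k ∸ b) (λ k → lookup lam k ∸ b) (λ k → ℕ.∸-monoˡ-≤ b (lam′≤lam k))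
    -- From `b < suc c` follows b ≤ c, so truncated subtraction does not swallow the box lost in row
    -- `r`.
    ; excess-< = λ b b< → sum-mono-< (λ k → lookup lam′ k ∸ b) (λ k → lookup lam k ∸ b) r (λ k → ℕ.∸-monoˡ-≤ b (lam′≤lam k))
        (subst₂ (λ y z → y ∸ b < z ∸ b) (sym at-r) (sym lam-r)
           (ℕ.≤-reflexive (sym (ℕ.+-∸-assoc 1 {c} {b} (ℕ.≤-pred (subst (b <_) e b<))))))
    -- The rows before `r` still reach column `c`, and there are at least `i` of them.
    ; lifts = lifts-push removes (prefix-count (λ k → c ℕ.<? lookup lam′ k) (toℕ i) (ℕ.<⇒≤ (F.toℕ<n i))
        (λ k l → before k (ℕ.<-≤-trans l i≤r))) }
    where
    lam′ = lam V.[ r ]≔ c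
    lam-r : lookup lam r ≡ suc c
    lam-r = ℕ.≤-antisym (subst (lookup lam r ≤_) e (anti i r i≤r)) c<r
    at-r : lookup lam′ r ≡ c
    at-r = V.lookup∘update r lam c
    off-r : ∀ k → k ≢ r → lookup lam′ k ≡ lookup lam k
    off-r k k≢r = V.lookup∘update′ k≢r lam c
    lam′≤lam : ∀ k → lookup lam′ k ≤ lookup lam k
    lam′≤lam k with k F.≟ r
    ... | yes refl = ℕ.≤-trans (ℕ.≤-reflexive at-r) (ℕ.<⇒≤ c<r)
    ... | no k≢r   = ℕ.≤-reflexive (off-r k k≢r)
    antitone : Antitone lam′
    antitone k l k≤l with k F.≟ r
    ... | no k≢r = subst (lookup lam′ l ≤_) (sym (off-r k k≢r)) (ℕ.≤-trans (lam′≤lam l) (anti k l k≤l))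
    ... | yes refl with l F.≟ r
    ...   | yes refl = ℕ.≤-refl
    ...   | no l≢r   = subst₂ _≤_ (sym (off-r l l≢r)) (sym at-r)
              (ℕ.≮⇒≥ (max l (ℕ.≤∧≢⇒< k≤l (l≢r ∘ sym ∘ F.toℕ-injective))))
    until : ∀ k → toℕ k ≤ toℕ r → c < lookup lam k
    until k k≤r = ℕ.≤-trans c<r (anti k r k≤r)
    before : ∀ k → toℕ k < toℕ r → c < lookup lam′ k
    before k k<r = subst (c <_) (sym (off-r k (λ { refl → ℕ.<-irrefl refl k<r }))) (until k (ℕ.<⇒≤ k<r))
    before⁻ : ∀ k → c < lookup lam′ k → toℕ k < toℕ r
    before⁻ k l with toℕ k ℕ.<? toℕ r | k F.≟ r
    ... | yes k<r | _        = k<r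
    ... | no k≮r  | yes refl = ⊥-elim (ℕ.<-irrefl (sym at-r) l)
    ... | no k≮r  | no k≢r   = ⊥-elim (max k (ℕ.≤∧≢⇒< (ℕ.≮⇒≥ k≮r) (k≢r ∘ sym ∘ F.toℕ-injective)) (subst (c <_) (off-r k k≢r) l))
    removes : Removes lam lam′ c
    removes = record
      { same⁺ = same⁺
      ; same⁻ = λ k j _ l → ℕ.<-≤-trans l (lam′≤lam k)
      ; top = until zero z≤n
      ; down⁺ = λ k l → before (F.inject₁ k) (subst (_< toℕ r) (sym (F.toℕ-inject₁ k))
          (ℕ.≮⇒≥ (λ r<k → max (suc k) r<k l)))
      ; down⁻ = λ k l → until (suc k) (subst (_< toℕ r) (F.toℕ-inject₁ k) (before⁻ (F.inject₁ k) l))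
      ; last = λ l → ℕ.<⇒≱ (before⁻ (F.fromℕ s) l) (subst (toℕ r ≤_) (sym (F.toℕ-fromℕ s)) (ℕ.≤-pred (F.toℕ<n r))) }
      where
      same⁺ : ∀ k j → j ≢ c → j < lookup lam k → j < lookup lam′ k
      same⁺ k j j≢c l with k F.≟ r
      ... | no k≢r   = subst (j <_) (sym (off-r k k≢r)) l
      ... | yes refl = subst (j <_) (sym at-r) (ℕ.≤∧≢⇒< (ℕ.≤-pred (subst (j <_) lam-r l)) j≢c)

  shrink : ∃ λ lam′ → Shrinks lam lam′ i
  shrink with lookup lam i in e
  ... | zero  = lam , shrinks-empty e
  ... | suc c = shrinks-box c e

  -- Rows from `i` on have length at most `c` and contribute nothing; each of the `toℕ i` rows
  -- before loses at most one box.
  excess-suc : ∀ c → lookup lam i ≤ c → excess lam c ≤ excess lam (suc c) ℕ.+ toℕ i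
  excess-suc c λ≤c = begin
    excess lam c
      ≤⟨ sum-mono (λ k → lookup lam k ∸ c) (λ k → (lookup lam k ∸ suc c) ℕ.+ 𝟙 (toℕ k ℕ.<? toℕ i)) pointwise ⟩
    sum (λ k → (lookup lam k ∸ suc c) ℕ.+ 𝟙 (toℕ k ℕ.<? toℕ i))
      ≡⟨ ∑-distrib-+ (λ k → lookup lam k ∸ suc c) (λ k → 𝟙 (toℕ k ℕ.<? toℕ i)) ⟩
    excess lam (suc c) ℕ.+ sum {suc s} (λ k → 𝟙 (toℕ k ℕ.<? toℕ i))
      ≤⟨ ℕ.+-monoʳ-≤ (excess lam (suc c))
           (count-interval (λ (k : Fin (suc s)) → toℕ k ℕ.<? toℕ i) toℕ (λ _ _ _ _ → F.toℕ-injective) 0 (toℕ i) (λ k l → z≤n , l)) ⟩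
    excess lam (suc c) ℕ.+ toℕ i ∎
    where
    open ℕ.≤-Reasoning
    pointwise : ∀ k → lookup lam k ∸ c ≤ (lookup lam k ∸ suc c) ℕ.+ 𝟙 (toℕ k ℕ.<? toℕ i)
    pointwise k with ℕ.<-≤-connex (toℕ k) (toℕ i)
    ... | inj₂ i≤k = ℕ.≤-trans (ℕ.≤-reflexive (ℕ.m≤n⇒m∸n≡0 (ℕ.≤-trans (anti i k i≤k) λ≤c))) z≤n
    ... | inj₁ k<i = subst (lookup lam k ∸ c ≤_) (cong (λ z → (lookup lam k ∸ suc c) ℕ.+ z) (sym (𝟙-yes (toℕ k ℕ.<? toℕ i) k<i)))
          (∸-step (lookup lam k) c)

card≤n : ∀ (S : Subset n) → card S ≤ n
card≤n S = subst (card S ≤_) (card-compl S) (ℕ.m≤m+n _ _)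

-- The relations satisfied by the leading coefficient

module _ {lam lam′ : Vec ℕ (suc s)} (anti : Antitone lam) {i : Fin (suc s)} (sh : Shrinks lam lam′ i)
         {G : Fn (suc n)} (harm : Harmonic (suc n) lam G)
         (above : ∀ a α → toℕ i < a → G (a ∷ α) ≡ 0ℚ) where
  open Harmonic harm
  open Shrinks sh

  private
    module _ (S : Subset n) (β : Mon n) where
      c = n ∸ card S

      slice : ℕ → ℕ → ℚ
      slice a d = esum d S (λ u → G (a ∷ (β ⊞ u)))

      -- This is e_{d+1}(S ∪ {x₀}) = x₀ e_d(S) + e_{d+1}(S). Adding x₀ to both the subset and the
      -- variables leaves the size `c` of the complement unchanged.
      slice-sum : ∀ a d → card S < d ℕ.+ excess lam c → slice (suc a) d + slice a (suc d) ≡ 0ℚ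
      slice-sum a d h = begin
        slice (suc a) d + slice a (suc d)
          ≡⟨ cong₂ (λ y z → esum d S (λ u → G (y ∷ (β ⊞ u))) + esum (suc d) S (λ u → G (z ∷ (β ⊞ u))))
               (ℕ.+-comm 1 a) (sym (ℕ.+-identityʳ a)) ⟩
        slice (a ℕ.+ 1) d + slice (a ℕ.+ 0) (suc d)
          ≡⟨ esum-true d S (G ∘ ((a ∷ β) ⊞_)) ⟨
        esum (suc d) (true ∷ S) (G ∘ ((a ∷ β) ⊞_))
          ≡⟨ elementary (true ∷ S) (suc d) (a ∷ β) (s≤s h) ⟩
        0ℚ ∎
        where open ≡-Reasoning

      -- Here `S` is taken without x₀, so its complement among `suc n` variables has `suc c`
      -- elements and the threshold is weaker.
      slice-low : ∀ a d → card S < d ℕ.+ excess lam (suc c) → slice a d ≡ 0ℚ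
      slice-low a d h = trans (cong (λ z → slice z d) (sym (ℕ.+-identityʳ a)))
        (trans (sym (esum-false d S (G ∘ ((a ∷ β) ⊞_))))
          (elementary (false ∷ S) d (a ∷ β) (subst (λ z → card S < d ℕ.+ excess lam z) (sym (ℕ.+-∸-assoc 1 (card≤n S))) h)))

      -- By `slice-sum`, a power of x₀ is traded for a degree of the elementary symmetric
      -- polynomial. At x₀-degree 0 the degree has grown by `a`, enough for `slice-low`.
      slice-descend : ∀ a d → card S < d ℕ.+ excess lam c → card S < d ℕ.+ (a ℕ.+ excess lam (suc c)) → slice a d ≡ 0ℚ
      slice-descend zero    d h h′ = slice-low 0 d h′
      slice-descend (suc a) d h h′ = begin
        slice (suc a) d                      ≡⟨ ℚ.+-identityʳ _ ⟨
        slice (suc a) d + 0ℚ                 ≡⟨ cong (slice (suc a) d +_) (slice-descend a (suc d) (ℕ.m≤n⇒m≤1+n h) (subst (card S <_) (ℕ.+-suc d _) h′)) ⟨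
        slice (suc a) d + slice a (suc d)    ≡⟨ slice-sum a d h ⟩
        0ℚ                                   ∎
        where open ≡-Reasoning

      -- The other summand of `slice-sum` has x₀-degree i + 1 and vanishes by `above`. The index
      -- shift costs one degree, which the removed box pays for through `excess-<`. For d = 0 the
      -- relation for S ∪ {x₀} in degree 0 applies directly.
      slice-top : ∀ d → c < lookup lam i → card S < d ℕ.+ excess lam′ c → slice (toℕ i) d ≡ 0ℚ
      slice-top zero c<λ h = trans (cong (λ z → slice z 0) (sym (ℕ.+-identityʳ (toℕ i))))
        (elementary (true ∷ S) 0 (toℕ i ∷ β) (ℕ.<-≤-trans (s≤s h) (excess-< c c<λ)))
      slice-top (suc d) c<λ h = begin
        slice (toℕ i) (suc d)                          ≡⟨ ℚ.+-identityˡ _ ⟨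
        0ℚ + slice (toℕ i) (suc d)                     ≡⟨ cong (_+ slice (toℕ i) (suc d)) (∑-zero (esymMons d S) (λ u → above (suc (toℕ i)) (β ⊞ u) (ℕ.n<1+n _))) ⟨
        slice (suc (toℕ i)) d + slice (toℕ i) (suc d)
          ≡⟨ slice-sum (toℕ i) d (ℕ.<-≤-trans h (ℕ.≤-trans (ℕ.≤-reflexive (sym (ℕ.+-suc d _))) (ℕ.+-monoʳ-≤ d (excess-< c c<λ)))) ⟩
        0ℚ ∎
        where open ≡-Reasoning

      slice-zero : ∀ d → card S < d ℕ.+ excess lam′ c → slice (toℕ i) d ≡ 0ℚ
      slice-zero d h with ℕ.<-≤-connex c (lookup lam i)
      ... | inj₁ c<λ = slice-top d c<λ h
      ... | inj₂ λ≤c = slice-descend (toℕ i) d h′ (ℕ.<-≤-trans h′ (ℕ.+-monoʳ-≤ d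
            (ℕ.≤-trans (excess-suc lam anti i c λ≤c) (ℕ.≤-reflexive (ℕ.+-comm (excess lam (suc c)) (toℕ i))))))
        where h′ = ℕ.<-≤-trans h (ℕ.+-monoʳ-≤ d (excess-≤ c))

  harmonic-leading : Harmonic n lam′ (G ∘ (toℕ i ∷_))
  harmonic-leading = record
    { power = λ j β h → power (suc j) (toℕ i ∷ β) h
    ; elementary = λ S d β h → slice-zero S β d h }

-- Cancel the leading coefficient in x₀, which lies in the span of a smaller shape, and repeat.
harmonic⇒span : ∀ n (lam : Vec ℕ (suc s)) → Antitone lam → ∀ {G : Fn n} → Harmonic n lam G → Span n lam G
harmonic⇒span {s} zero lam anti {G} harm with excess lam 0 in e
-- A nonempty shape without variables: e_0 of the empty set is a generator, so 1 lies in the ideal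
-- and `G` is zero.
... | suc _ = resp zer (λ { [] → sym (trans (sym (ℚ.+-identityʳ (G [])))
      (Harmonic.elementary harm [] 0 [] (subst (0 <_) (sym e) (s≤s z≤n)))) })
-- For the empty shape the generator is the constant 1, given by the empty filling.
... | zero  = resp (scal (G []) (base (fills-nil lam empty))) (λ { [] → ℚ.*-identityʳ (G []) })
  where
  empty : ∀ i → lookup lam i ≡ 0
  empty i = ℕ.n≤0⇒n≡0 (subst (lookup lam i ≤_) e (term≤sum (lookup lam) i))
harmonic⇒span {s} (suc n) lam anti harm = bounded (suc s) ℕ.≤-refl harm
  (λ a α h → Harmonic.power harm zero (a ∷ α) h)
  where
  bounded : ∀ b → b ≤ suc s → ∀ {G} → Harmonic (suc n) lam G →
            (∀ a α → b ≤ a → G (a ∷ α) ≡ 0ℚ) → Span (suc n) lam G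
  bounded zero    _   _    above = resp zer (λ { (a ∷ α) → sym (above a α z≤n) })
  bounded (suc b) b<s {G} harm above = resp (add spanF rest) (λ α → x+[y-x]≡y (F α) (G α))
    where
    i = F.fromℕ< b<s
    i≡b : toℕ i ≡ b
    i≡b = F.toℕ-fromℕ< b<s
    smaller = shrink lam anti i
    lam′ = proj₁ smaller
    sh = proj₂ smaller
    above′ : ∀ a α → toℕ i < a → G (a ∷ α) ≡ 0ℚ
    above′ a α h = above a α (subst (_< a) i≡b h)
    lifted = Shrinks.lifts sh (harmonic⇒span n lam′ (Shrinks.antitone sh) (harmonic-leading anti sh harm above′))
    F = proj₁ lifted
    spanF = proj₁ (proj₂ lifted)
    F-top = proj₁ (proj₂ (proj₂ lifted))
    F-above = proj₂ (proj₂ (proj₂ lifted))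
    x+[y-x]≡y : ∀ x y → x + (y + - 1ℚ * x) ≡ y
    x+[y-x]≡y = solve 2 (λ x y → x :+ (y :+ con (- 1ℚ) :* x) := y) refl
      where open +-*-Solver
    cancel : ∀ {x y} → x ≡ y → x + - 1ℚ * y ≡ 0ℚ
    cancel {x} refl = solve 1 (λ x → x :+ con (- 1ℚ) :* x := con 0ℚ) refl x
      where open +-*-Solver
    rest : Span (suc n) lam (λ α → G α + - 1ℚ * F α)
    -- The remainder is harmonic because `F`, a member of the span, is.
    rest = bounded b (ℕ.<⇒≤ b<s) (harmonic-add harm (harmonic-scal (- 1ℚ) (span⇒harmonic (s≤s z≤n) spanF))) below-b
      where
      below-b : ∀ a α → b ≤ a → G (a ∷ α) + - 1ℚ * F (a ∷ α) ≡ 0ℚ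
      below-b a α b≤a with ℕ.m≤n⇒m<n∨m≡n b≤a
      ... | inj₁ b<a  = cancel (trans (above a α b<a) (sym (F-above a α (subst (_< a) (sym i≡b) b<a))))
      ... | inj₂ refl = cancel (subst (λ a → G (a ∷ α) ≡ F (a ∷ α)) i≡b (sym (F-top α)))

-- The sign of a permutation

pm : ℕ → ℚ
pm zero    = 1ℚ
pm (suc k) = - pm k

pm-+ : ∀ a b → pm (a ℕ.+ b) ≡ pm a * pm b
pm-+ zero    b = sym (ℚ.*-identityˡ (pm b))
pm-+ (suc a) b = trans (cong -_ (pm-+ a b)) (ℚ.neg-distribˡ-* (pm a) (pm b))

smaller : Fin N → Vec (Fin N) m → ℕ
smaller x w = sum (λ b → 𝟙 (toℕ (lookup w b) ℕ.<? toℕ x))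

-- The sign as a product over entries, each counting the smaller ones after it. Unlike `inversions`,
-- this follows the recursion of vectors.
sgn : Vec (Fin N) m → ℚ
sgn []      = 1ℚ
sgn (x ∷ w) = pm (smaller x w) * sgn w

inserts-All : ∀ {P : X → Set} {x} {p : Vec X m} → P x → VAll P p → All (VAll P) (inserts x p)
inserts-All px []        = (px ∷ []) ∷ []
inserts-All px (py ∷ ps) = (px ∷ py ∷ ps) ∷ All.map⁺ (All.map (py ∷_) (inserts-All px ps))

perms-All : ∀ {P : X → Set} {xs : Vec X m} → VAll P xs → All (VAll P) (perms xs)
perms-All []        = [] ∷ []
perms-All (px ∷ ps) = All.concat⁺ (All.map⁺ (All.map (inserts-All px) (perms-All ps)))

inserts-smaller : ∀ (x : Fin N) (p : Vec (Fin N) m) y →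
                  All (λ w → smaller y w ≡ 𝟙 (toℕ x ℕ.<? toℕ y) ℕ.+ smaller y p) (inserts x p)
inserts-smaller x []      y = refl ∷ []
inserts-smaller x (z ∷ p) y = refl ∷ All.map⁺ (All.map
  (λ e → trans (cong (𝟙 (toℕ z ℕ.<? toℕ y) ℕ.+_) e)
    (+-leftComm (𝟙 (toℕ z ℕ.<? toℕ y)) (𝟙 (toℕ x ℕ.<? toℕ y)) (smaller y p))) (inserts-smaller x p y))

-- Inserting a new least entry at position p creates p inversions.
∑-inserts : ∀ (x : Fin N) (p : Vec (Fin N) m) → VAll (λ y → toℕ x < toℕ y) p → ∀ F →
            ∑ (inserts x p) (λ w → sgn w * F w) ≡ sgn p * insSum x F p
∑-inserts x []      _        F = ℚ.+-identityʳ _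
∑-inserts x (y ∷ p) (x<y ∷ ps) F = begin
  sgn (x ∷ y ∷ p) * F (x ∷ y ∷ p) + ∑ (map (y ∷_) (inserts x p)) (λ w → sgn w * F w)
    ≡⟨ cong₂ _+_ (cong (_* F (x ∷ y ∷ p)) (trans (cong (λ k → pm k * sgn (y ∷ p)) smaller≡0) (ℚ.*-identityˡ (sgn (y ∷ p))))) rest ⟩
  (ε * sgn p) * F (x ∷ y ∷ p) + (- ε) * (sgn p * insSum x (F ∘ (y ∷_)) p)
    ≡⟨ solve 4 (λ e s a b → (e :* s) :* a :+ (:- e) :* (s :* b) := (e :* s) :* (a :- b)) refl
         ε (sgn p) (F (x ∷ y ∷ p)) (insSum x (F ∘ (y ∷_)) p) ⟩
  sgn (y ∷ p) * (F (x ∷ y ∷ p) - insSum x (F ∘ (y ∷_)) p) ∎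
  where
  open ≡-Reasoning
  open +-*-Solver
  ε = pm (smaller y p)
  none : ∀ {m} {q : Vec (Fin _) m} → VAll (λ y → toℕ x < toℕ y) q → smaller x q ≡ 0
  none []        = refl
  none (_∷_ {x = z} x<z qs) = cong₂ ℕ._+_ (𝟙-no (toℕ z ℕ.<? toℕ x) (ℕ.<-asym x<z)) (none qs)
  smaller≡0 : smaller x (y ∷ p) ≡ 0
  smaller≡0 = none (x<y ∷ ps)
  rest : ∑ (map (y ∷_) (inserts x p)) (λ w → sgn w * F w) ≡ (- ε) * (sgn p * insSum x (F ∘ (y ∷_)) p)
  rest = begin
    ∑ (map (y ∷_) (inserts x p)) (λ w → sgn w * F w)
      ≡⟨ ∑-map (y ∷_) (inserts x p) _ ⟩
    ∑ (inserts x p) (λ w → (pm (smaller y w) * sgn w) * F (y ∷ w))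
      ≡⟨ ∑-All (All.map (λ {w} e → trans (cong (λ k → (pm k * sgn w) * F (y ∷ w))
             (trans e (cong (ℕ._+ smaller y p) (𝟙-yes (toℕ x ℕ.<? toℕ y) x<y))))
             (ℚ.*-assoc (- ε) (sgn w) (F (y ∷ w)))) (inserts-smaller x p y)) ⟩
    ∑ (inserts x p) (λ w → (- ε) * (sgn w * F (y ∷ w)))
      ≡⟨ ∑-*ˡ (- ε) (inserts x p) _ ⟩
    (- ε) * ∑ (inserts x p) (λ w → sgn w * F (y ∷ w))
      ≡⟨ cong ((- ε) *_) (∑-inserts x p ps (F ∘ (y ∷_))) ⟩
    (- ε) * (sgn p * insSum x (F ∘ (y ∷_)) p) ∎

data Increasing : Vec (Fin N) m → Set where
  []  : Increasing {N} []
  _∷_ : ∀ {x : Fin N} {xs : Vec (Fin N) m} → VAll (λ y → toℕ x < toℕ y) xs → Increasing xs → Increasing (x ∷ xs)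

-- For increasing `xs`, `perms` inserts an entry below all those already placed, so its position,
-- which `altSum` turns into a sign, is the number of inversions it adds.
∑-perms : ∀ {xs : Vec (Fin N) m} → Increasing xs → ∀ F → ∑ (perms xs) (λ w → sgn w * F w) ≡ altSum xs F
∑-perms []                          F = trans (ℚ.+-identityʳ _) (ℚ.*-identityˡ _)
∑-perms (_∷_ {x = x} {xs} x< incr) F = begin
  ∑ (concatMap (inserts x) (perms xs)) (λ w → sgn w * F w)
    ≡⟨ ∑-concatMap (inserts x) (perms xs) _ ⟩
  ∑ (perms xs) (λ p → ∑ (inserts x p) (λ w → sgn w * F w))
    ≡⟨ ∑-All (All.map (λ {p} x<p → ∑-inserts x p x<p F) (perms-All x<)) ⟩
  ∑ (perms xs) (λ p → sgn p * insSum x F p)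
    ≡⟨ ∑-perms incr (insSum x F) ⟩
  altSum xs (insSum x F) ∎
  where open ≡-Reasoning

increasing-map-suc : ∀ {xs : Vec (Fin N) m} → Increasing xs → Increasing (V.map suc xs)
increasing-map-suc []        = []
increasing-map-suc (x< ∷ incr) = go x< ∷ increasing-map-suc incr
  where
  go : ∀ {x : Fin N} {xs : Vec (Fin N) m} → VAll (λ y → toℕ x < toℕ y) xs → VAll (λ y → suc (toℕ x) < toℕ y) (V.map suc xs)
  go []         = []
  go (l ∷ ls) = s≤s l ∷ go ls

increasing-allFin : ∀ n → Increasing (allFin n)
increasing-allFin zero    = []
increasing-allFin (suc n) = subst Increasing (sym (allFin-suc n)) (positive (allFin n) ∷ increasing-map-suc (increasing-allFin n))
  where
  positive : ∀ {m} (xs : Vec (Fin n) m) → VAll (λ y → 0 < toℕ y) (V.map suc xs)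
  positive []       = []
  positive (x ∷ xs) = s≤s z≤n ∷ positive xs

length-filter-tabulate : ∀ {P : X → Set} (P? : ∀ x → Dec (P x)) (h : Y → X) (f : Fin n → Y) →
  L.length (L.filter P? (map h (V.toList (tabulate f)))) ≡ sum (λ i → 𝟙 (P? (h (f i))))
length-filter-tabulate {n = zero}  P? h f = refl
length-filter-tabulate {n = suc n} P? h f with P? (h (f zero))
... | yes _ = cong suc (length-filter-tabulate P? h (f ∘ suc))
... | no _  = length-filter-tabulate P? h (f ∘ suc)

length-filter-product : ∀ {P : X × Y → Set} (P? : ∀ z → Dec (P z)) (f : Fin m → X) (g : Fin n → Y) →
  L.length (L.filter P? (L.cartesianProduct (V.toList (tabulate f)) (V.toList (tabulate g))))
    ≡ sum (λ i → sum (λ j → 𝟙 (P? (f i , g j))))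
length-filter-product {m = zero}  P? f g = refl
length-filter-product {m = suc m} P? f g = begin
  L.length (L.filter P? (row ++ rows))                       ≡⟨ cong L.length (L.filter-++ P? row rows) ⟩
  L.length (L.filter P? row ++ L.filter P? rows)             ≡⟨ L.length-++ (L.filter P? row) ⟩
  L.length (L.filter P? row) ℕ.+ L.length (L.filter P? rows)
    ≡⟨ cong₂ ℕ._+_ (length-filter-tabulate P? (f zero ,_) g) (length-filter-product P? (f ∘ suc) g) ⟩
  sum (λ i → sum (λ j → 𝟙 (P? (f i , g j))))                 ∎
  where
  open ≡-Reasoning
  row = map (f zero ,_) (V.toList (tabulate g))
  rows = L.cartesianProduct (V.toList (tabulate (f ∘ suc))) (V.toList (tabulate g))

pm-inversions : ∀ (w : Vec (Fin N) m) →
  pm (sum (λ a → sum (λ b → 𝟙 ((toℕ a ℕ.<? toℕ b) ×-dec (toℕ (lookup w b) ℕ.<? toℕ (lookup w a)))))) ≡ sgn w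
pm-inversions []                  = refl
pm-inversions {N} {suc m} (x ∷ w) = begin
  pm (sum (λ b → pair zero b) ℕ.+ sum (λ a → sum (λ b → pair (suc a) b)))
    ≡⟨ pm-+ (sum (λ b → pair zero b)) _ ⟩
  pm (sum (λ b → pair zero b)) * pm (sum (λ a → sum (λ b → pair (suc a) b)))
    ≡⟨ cong (pm (smaller x w) *_) (pm-inversions w) ⟩
  pm (smaller x w) * sgn w ∎
  where
  open ≡-Reasoning
  pair : Fin (suc m) → Fin (suc m) → ℕ
  pair a b = 𝟙 ((toℕ a ℕ.<? toℕ b) ×-dec (toℕ (lookup (x ∷ w) b) ℕ.<? toℕ (lookup (x ∷ w) a)))

-- The parity test of `sign` is a local function, so it enters through its three defining equations.
parity : ∀ (even : ℕ → Bool) → even 0 ≡ true → even 1 ≡ false → (∀ m → even (suc (suc m)) ≡ even m) →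
         ∀ m → (if even m then 1ℚ else - 1ℚ) ≡ pm m
parity even e₀ e₁ e₂ zero          rewrite e₀ = refl
parity even e₀ e₁ e₂ (suc zero)    rewrite e₁ = refl
parity even e₀ e₁ e₂ (suc (suc m)) rewrite e₂ m = trans (parity even e₀ e₁ e₂ m) (sym (neg-involutive (pm m)))

sign≡pm : ∀ (w : Vec (Fin n) n) → sign w ≡ pm (inversions w)
sign≡pm w = go (inversions w) refl
  where
  -- Unification in go solves this by the local parity test of sign.
  even : ℕ → Bool
  even = _
  go : ∀ k → inversions w ≡ k → sign w ≡ pm k
  go k e with inversions w
  go k refl | .k = parity even refl refl (λ _ → refl) k

inversions≡sum : ∀ (w : Vec (Fin n) n) → inversions w ≡
  sum (λ a → sum (λ b → 𝟙 ((toℕ a ℕ.<? toℕ b) ×-dec (toℕ (lookup w b) ℕ.<? toℕ (lookup w a)))))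
inversions≡sum w = length-filter-product (λ { (a , b) → (toℕ a ℕ.<? toℕ b) ×-dec (toℕ (lookup w b) ℕ.<? toℕ (lookup w a)) }) id id

sign≡sgn : ∀ (w : Vec (Fin n) n) → sign w ≡ sgn w
sign≡sgn w = trans (sign≡pm w) (trans (cong pm (inversions≡sum w)) (pm-inversions w))

module _ {lam : Vec ℕ s} (T : Filling s n) where

  -- Names the local test function of inColGroup.
  inColGroup-tests : ∀ w → ∃ λ (tests : Fin n → Bool) → inColGroup lam T w ≡ all (tabulate tests)
  inColGroup-tests w = _ , refl

  inColGroup≡stab : ∀ w → inColGroup lam T w ≡ stab (colOf lam T) w
  inColGroup≡stab w = trans (proj₂ (inColGroup-tests w)) (cong all (V.tabulate-cong same))
    where
    same : ∀ v → proj₁ (inColGroup-tests w) v ≡ stabTests (colOf lam T) w v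
    same v with colOf lam T v
    ... | nothing = refl
    ... | just j with colOf lam T (lookup w v)
    ...   | just _  = refl
    ...   | nothing = refl

  coeff-δ : ∀ α → coeff (δ lam T) α ≡ colCoeff (colOf lam T) (monT lam T) α
  coeff-δ α = begin
    coeff (δ lam T) α
      ≡⟨ go (allPerms n) ⟩
    ∑ (allPerms n) (λ w → sgn w * colTerm (colOf lam T) (monT lam T) α w)
      ≡⟨ ∑-perms (increasing-allFin n) _ ⟩
    colCoeff (colOf lam T) (monT lam T) α ∎
    where
    open ≡-Reasoning
    term : Vec (Fin n) n → Poly n
    term w = if inColGroup lam T w then (sign w , actMon w (monT lam T)) ∷ [] else []
    single : ∀ w → coeff (term w) α ≡ sgn w * colTerm (colOf lam T) (monT lam T) α w
    single w rewrite inColGroup≡stab w with stab (colOf lam T) w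
    ... | false = sym (ℚ.*-zeroʳ (sgn w))
    ... | true with does (V.≡-dec ℕ._≟_ (actMon w (monT lam T)) α)
    ...   | true  = trans (ℚ.+-identityʳ (sign w)) (trans (sign≡sgn w) (sym (ℚ.*-identityʳ (sgn w))))
    ...   | false = sym (ℚ.*-zeroʳ (sgn w))
    go : ∀ l → coeff (concatMap term l) α ≡ ∑ l (λ w → sgn w * colTerm (colOf lam T) (monT lam T) α w)
    go []      = refl
    go (w ∷ l) = trans (coeff-⊕ (term w) (concatMap term l) α) (cong₂ _+_ (single w) (go l))

-- Passage to polynomials

cell∈cells : ∀ (lam : Vec ℕ s) i j → j < lookup lam i → (i , j) ∈ cells lam
cell∈cells lam i j l = Mem.∈-concatMap⁺ _ (lose (VMem.∈-toList⁺ (VMem.∈-allFin⁺ i)) (Mem.∈-map⁺ (i ,_) (Mem.∈-upTo⁺ l)))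

cells⇒cell : ∀ (lam : Vec ℕ s) {i j} → (i , j) ∈ cells lam → j < lookup lam i
cells⇒cell {s} lam m with find (Mem.∈-concatMap⁻ (λ i → map (i ,_) (upTo (lookup lam i))) {xs = V.toList (allFin s)} m)
... | i , _ , m′ with Mem.∈-map⁻ (i ,_) m′
...   | j , j∈ , refl = Mem.∈-upTo⁻ j∈

module _ {B : Set} (T : Filling s n) (v : Fin n) (f : Fin s → ℕ → B) (z : B)
         (step : Fin s × ℕ → B → B) (step≡ : ∀ i j r → step (i , j) r ≡ (if does (T i j F.≟ v) then f i j else r)) where

  -- Common to `colOf` and `expT`, in which the first matching cell decides; `only` makes the match
  -- unique. The abstract `step` stands for their anonymous functions, found by unification.
  foldr-hit : ∀ l i j → (i , j) ∈ l → T i j ≡ v → (∀ i′ j′ → (i′ , j′) ∈ l → T i′ j′ ≡ v → i′ ≡ i × j′ ≡ j) →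
              foldr step z l ≡ f i j
  foldr-hit ((i′ , j′) ∷ l) i j m e only = trans (step≡ i′ j′ _) (go m)
    where
    go : (i , j) ∈ (i′ , j′) ∷ l → (if does (T i′ j′ F.≟ v) then f i′ j′ else foldr step z l) ≡ f i j
    go m with T i′ j′ F.≟ v
    ... | yes e′ with only i′ j′ (here refl) e′
    ...   | refl , refl = refl
    go (here refl) | no ¬e = ⊥-elim (¬e e)
    go (there m)   | no _  = foldr-hit l i j m e (λ i″ j″ m″ → only i″ j″ (there m″))

  foldr-miss : ∀ l → (∀ i j → (i , j) ∈ l → T i j ≢ v) → foldr step z l ≡ z
  foldr-miss []            none = refl
  foldr-miss ((i , j) ∷ l) none = trans (step≡ i j _) (trans
    (cong (λ b → if b then f i j else foldr step z l) (dec-false (T i j F.≟ v) (none i j (here refl))))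
    (foldr-miss l (λ i′ j′ m → none i′ j′ (there m))))

boxesBelow≡below : ∀ (lam : Vec ℕ s) i j → boxesBelow lam i j ≡ below lam i j
boxesBelow≡below {s} lam i j = trans (cong (λ l → L.length (L.filter P? l)) (sym (L.map-id (V.toList (allFin s)))))
  (length-filter-tabulate P? id id)
  where
  P? : ∀ i′ → Dec (toℕ i < toℕ i′ × j < lookup lam i′)
  P? i′ = (toℕ i ℕ.<? toℕ i′) ×-dec (j ℕ.<? lookup lam i′)

module _ {lam : Vec ℕ s} {T : Filling s n} (inj : IsInj lam T) where

  isInj⇒fills : Fills n lam (λ i j → toℕ (T i j)) (colOf lam T) (monT lam T)
  isInj⇒fills = record
    { range = λ i j _ → F.toℕ<n (T i j)
    ; injective = λ i j i′ j′ l l′ e → cell-injective i j i′ j′ l l′ (F.toℕ-injective e)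
    ; increasing = λ i i′ j → proj₂ inj i i′ j
    ; on = λ i j v l e → on i j v l (F.toℕ-injective e)
    ; off = λ v none → off v (λ i j m e → none i j (cells⇒cell lam m) (cong toℕ e)) }
    where
    cell-injective : ∀ i j i′ j′ → j < lookup lam i → j′ < lookup lam i′ → T i j ≡ T i′ j′ → i ≡ i′ × j ≡ j′
    cell-injective i j i′ j′ l l′ e = cong proj₁ c≡c′ , cong (proj₁ ∘ proj₂) c≡c′
      where c≡c′ = proj₁ inj (i , j , l) (i′ , j′ , l′) e
    on : ∀ i j v → j < lookup lam i → T i j ≡ v → colOf lam T v ≡ just j × lookup (monT lam T) v ≡ below lam i j
    on i j v l e =
      foldr-hit T v (λ _ j → just j) nothing _ (λ _ _ _ → refl) (cells lam) i j (cell∈cells lam i j l) e only ,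
      trans (V.lookup∘tabulate (expT lam T) v)
        (trans (foldr-hit T v (boxesBelow lam) (s ∸ 1) _ (λ _ _ _ → refl) (cells lam) i j (cell∈cells lam i j l) e only)
               (boxesBelow≡below lam i j))
      where
      only : ∀ i′ j′ → (i′ , j′) ∈ cells lam → T i′ j′ ≡ v → i′ ≡ i × j′ ≡ j
      only i′ j′ m e′ = cell-injective i′ j′ i j (cells⇒cell lam m) l (trans e′ (sym e))
    off : ∀ v → (∀ i j → (i , j) ∈ cells lam → T i j ≢ v) → colOf lam T v ≡ nothing × lookup (monT lam T) v ≡ s ∸ 1
    off v none =
      foldr-miss T v (λ _ j → just j) nothing _ (λ _ _ _ → refl) (cells lam) none ,
      trans (V.lookup∘tabulate (expT lam T) v) (foldr-miss T v (boxesBelow lam) (s ∸ 1) _ (λ _ _ _ → refl) (cells lam) none)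

-- Every v is either an entry or not, so `on` and `off` determine `col` and `x`. This identifies
-- given data with those computed by `colOf` and `monT`.
fills-unique : ∀ {lam : Vec ℕ s} {T T′} {col col′ : Fin n → Maybe ℕ} {x x′} →
  (∀ i j → j < lookup lam i → T′ i j ≡ T i j) → Fills n lam T col x → Fills n lam T′ col′ x′ →
  (∀ v → col′ v ≡ col v) × x′ ≡ x
fills-unique {lam = lam} {T} {T′} {col} {col′} {x} {x′} same f f′ = proj₁ ∘ both , vec-ext (proj₂ ∘ both)
  where
  both : ∀ v → col′ v ≡ col v × lookup x′ v ≡ lookup x v
  both v with occupies? lam T (toℕ v)
  ... | yes (i , j , l , e) =
    let c , y = Fills.on f i j v l e
        c′ , y′ = Fills.on f′ i j v l (trans (same i j l) e)
    in trans c′ (sym c) , trans y′ (sym y)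
  ... | no ¬o =
    let c , y = Fills.off f v (λ i j l e → ¬o (i , j , l , e))
        c′ , y′ = Fills.off f′ v (λ i j l e → ¬o (i , j , l , trans (sym (same i j l)) e))
    in trans c′ (sym c) , trans y′ (sym y)

colCoeff-cong : ∀ {col col′ : Fin n → Maybe ℕ} x α → (∀ v → col v ≡ col′ v) → colCoeff col x α ≡ colCoeff col′ x α
colCoeff-cong {n} x α e = altSum-cong (allFin n) (λ w →
  cong (λ b → if b then (if does (V.≡-dec ℕ._≟_ (actMon w x) α) then 1ℚ else 0ℚ) else 0ℚ)
    (cong all (V.tabulate-cong (λ v → cong₂ (λ c d → fixes c d (does (lookup w v F.≟ v))) (e v) (e (lookup w v))))))

K-δ : ∀ (lam : Vec ℕ s) (T : Filling s n) α → K (δ lam T) α ≡ columnFn (colOf lam T) (monT lam T) α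
K-δ lam T α = cong (fac α *_) (coeff-δ T α)

fills⇒δ : ∀ {lam : Vec ℕ s} {T} {col : Fin (suc n) → Maybe ℕ} {x} → Antitone lam → Fills (suc n) lam T col x →
          ∃ λ T′ → IsInj lam T′ × (∀ α → K (δ lam T′) α ≡ columnFn col x α)
fills⇒δ {n = n} {lam} {T} {col} {x} anti f = T′ , isInj , λ α → trans (K-δ lam T′ α) (cong (fac α *_)
    (trans (colCoeff-cong (monT lam T′) α (proj₁ unique)) (cong (λ y → colCoeff col y α) (proj₂ unique))))
  where
  open Fills f
  T′ : Filling _ (suc n)
  -- Away from the cells `T` is arbitrary; the reduction forces a value in `Fin (suc n)` and, by
  -- `range`, changes no entry of a cell.
  T′ i j = T i j mod suc n
  toℕ-T′ : ∀ i j → j < lookup lam i → toℕ (T′ i j) ≡ T i j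
  toℕ-T′ i j l = trans (F.toℕ-fromℕ< _) (m<n⇒m%n≡m (range i j l))
  cell-≡ : ∀ {i j i′ j′} {l : j < lookup lam i} {l′ : j′ < lookup lam i′} → i ≡ i′ × j ≡ j′ →
           _≡_ {A = Cell lam} (i , j , l) (i′ , j′ , l′)
  cell-≡ {i} {j} (refl , refl) = cong (λ p → i , j , p) (ℕ.<-irrelevant _ _)
  isInj : IsInj lam T′
  isInj = (λ { (i , j , l) (i′ , j′ , l′) e → cell-≡ (injective i j i′ j′ l l′
              (trans (sym (toℕ-T′ i j l)) (trans (cong toℕ e) (toℕ-T′ i′ j′ l′)))) })
        , λ i i′ j i<i′ l → subst₂ _<_ (sym (toℕ-T′ i j (ℕ.<-≤-trans l (anti i i′ (ℕ.<⇒≤ i<i′))))) (sym (toℕ-T′ i′ j l)) (increasing i i′ j i<i′ l)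
  unique = fills-unique toℕ-T′ f (isInj⇒fills isInj)

-- The threshold by columns and by rows

conj≡sum : ∀ (lam : Vec ℕ s) j → conj lam j ≡ sum (λ r → 𝟙 (j ℕ.≤? lookup lam r))
conj≡sum []      j = refl
conj≡sum (y ∷ lam) j with j ℕ.≤ᵇ y
... | true  = cong suc (conj≡sum lam j)
... | false = conj≡sum lam j

sum-applyUpTo : ∀ (f g : ℕ → ℕ) m → sumᴸ (map f (applyUpTo g m)) ≡ sum {m} (λ t → f (g (toℕ t)))
sum-applyUpTo f g zero    = refl
sum-applyUpTo f g (suc m) = cong (f (g 0) ℕ.+_) (sum-applyUpTo f (g ∘ suc) m)

-- A row of length `y` meets this many of the `m` columns n, n - 1, ..., n - m + 1. The minimum
-- discards boxes beyond column n.
count-top : ∀ y n m → m ≤ n → sum {m} (λ t → 𝟙 (n ∸ toℕ t ℕ.≤? y)) ≡ (y ℕ.⊓ n) ∸ (n ∸ m)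
count-top y n       zero    _         = sym (ℕ.m≤n⇒m∸n≡0 (ℕ.m⊓n≤n y n))
count-top y (suc n) (suc m) (s≤s m≤n) with ℕ.<-≤-connex n y
... | inj₁ n<y = trans (cong₂ ℕ._+_ (𝟙-yes (suc n ℕ.≤? y) n<y) (count-top y n m m≤n))
      (trans (cong (λ z → suc (z ∸ (n ∸ m))) (ℕ.m≥n⇒m⊓n≡n (ℕ.<⇒≤ n<y)))
      (trans (sym (ℕ.+-∸-assoc 1 (ℕ.m∸n≤m n m))) (cong (_∸ (n ∸ m)) (sym (ℕ.m≥n⇒m⊓n≡n n<y)))))
... | inj₂ y≤n = trans (cong₂ ℕ._+_ (𝟙-no (suc n ℕ.≤? y) (ℕ.≤⇒≯ y≤n)) (count-top y n m m≤n))
      (cong (_∸ (n ∸ m)) (trans (ℕ.m≤n⇒m⊓n≡m y≤n) (sym (ℕ.m≤n⇒m⊓n≡m (ℕ.m≤n⇒m≤1+n y≤n)))))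

-- The same boxes are counted by columns and by rows; with all rows of length at most `n`, none lies
-- beyond column n.
tailConj≡excess : ∀ n (lam : Vec ℕ s) m → (∀ i → lookup lam i ≤ n) → m ≤ n → tailConj n lam m ≡ excess lam (n ∸ m)
tailConj≡excess n lam m λ≤n m≤n = begin
  tailConj n lam m
    ≡⟨ sum-applyUpTo (λ t → conj lam (n ∸ t)) id m ⟩
  sum {m} (λ t → conj lam (n ∸ toℕ t))
    ≡⟨ sum-cong-≗ {m} (λ t → conj≡sum lam (n ∸ toℕ t)) ⟩
  sum {m} (λ t → sum (λ r → 𝟙 (n ∸ toℕ t ℕ.≤? lookup lam r)))
    ≡⟨ ∑-comm {m} (λ t r → 𝟙 (n ∸ toℕ t ℕ.≤? lookup lam r)) ⟩
  sum (λ r → sum {m} (λ t → 𝟙 (n ∸ toℕ t ℕ.≤? lookup lam r)))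
    ≡⟨ sum-cong-≗ (λ r → trans (count-top (lookup lam r) n m m≤n) (cong (_∸ (n ∸ m)) (ℕ.m≤n⇒m⊓n≡m (λ≤n r)))) ⟩
  excess lam (n ∸ m) ∎
  where open ≡-Reasoning

-- The ideal as relations between pairings

pairAt-map : ∀ (c : ℚ) α (f : Poly n) G β →
  ∑ (map (λ { (d , γ) → (c * d , α ⊞ γ) }) f) (λ z → proj₁ z * G (β ⊞ proj₂ z)) ≡ c * pairAt f G (β ⊞ α)
pairAt-map c α f G β = trans (∑-map _ f _) (trans (∑-cong f (λ { (d , γ) →
    trans (cong (λ z → (c * d) * G z) (sym (⊞-assoc β α γ))) (ℚ.*-assoc c d (G (β ⊞ α ⊞ γ))) }))
  (∑-*ˡ c f _))

pairAt-⊗ : ∀ (h f : Poly n) G β → pairAt (h ⊗ f) G β ≡ ∑ h (λ z → proj₁ z * pairAt f G (β ⊞ proj₂ z))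
pairAt-⊗ h f G β = trans (∑-concatMap _ h _) (∑-cong h (λ { (c , α) → pairAt-map c α f G β }))

pairAt-mono : ∀ α (f : Poly n) G β → pairAt (mono α ⊗ f) G β ≡ pairAt f G (β ⊞ α)
pairAt-mono α f G β = trans (pairAt-⊗ (mono α) f G β) (trans (ℚ.+-identityʳ _) (ℚ.*-identityˡ _))

pairAt-var^ : ∀ (i : Fin n) m G β → pairAt (var i ^P m) G β ≡ G (inc^ i m β)
pairAt-var^ i zero    G β = trans (ℚ.+-identityʳ _) (trans (ℚ.*-identityˡ _) (cong G (⊞-identityʳ β)))
pairAt-var^ i (suc m) G β = trans (pairAt-mono (unitVec i) (var i ^P m) G β)
  (trans (cong (pairAt (var i ^P m) G) (trans (⊞-comm β (unitVec i)) (sym (inc≡⊞ i β)))) (pairAt-var^ i m G (inc i β)))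

pairAt-esym : ∀ d (S : Subset n) G β → pairAt (esym d S) G β ≡ esum d S (G ∘ (β ⊞_))
pairAt-esym d S G β = trans (∑-map (λ u → 1ℚ , u) (esymMons d S) (λ z → proj₁ z * G (β ⊞ proj₂ z))) (∑-cong (esymMons d S) (λ u → ℚ.*-identityˡ (G (β ⊞ u))))

inc^-onto : ∀ (i : Fin n) m β → m ≤ lookup β i → ∃ λ γ → inc^ i m γ ≡ β
inc^-onto zero    m (b ∷ β) h = b ∸ m ∷ β , trans (inc^-zero m (b ∸ m) β) (cong (_∷ β) (ℕ.m∸n+n≡m h))
inc^-onto (suc i) m (b ∷ β) h with inc^-onto i m β h
... | γ , e = b ∷ γ , trans (inc^-suc i m b γ) (cong (b ∷_) e)

lookup-inc^ : ∀ (i : Fin n) m β → m ≤ lookup (inc^ i m β) i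
lookup-inc^ zero    m (b ∷ β) = subst (λ γ → m ≤ lookup γ zero) (sym (inc^-zero m b β)) (ℕ.m≤n+m m b)
lookup-inc^ (suc i) m (b ∷ β) = subst (λ γ → m ≤ lookup γ (suc i)) (sym (inc^-suc i m b β)) (lookup-inc^ i m β)

module _ {lam : Vec ℕ s} (λ≤n : ∀ i → lookup lam i ≤ n) (g : Poly n) where

  private
    threshold : ∀ (S : Subset n) → tailConj n lam (card S) ≡ excess lam (n ∸ card S)
    threshold S = tailConj≡excess n lam (card S) λ≤n (card≤n S)

  -- The ideal contains every monomial multiple of a generator, and multiplying by x^β moves the
  -- base point of the pairing to `β`.
  inHarmonic⇒harmonic : InHarmonic n lam g → Harmonic n lam (K g)
  inHarmonic⇒harmonic harm = record
    { power = λ i β h → let γ , e = inc^-onto i s β h in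
        trans (cong (K g) (sym e)) (trans (sym (pairAt-var^ i s (K g) γ)) (orthogonal γ (powGen i)))
    ; elementary = λ S d β h → trans (sym (pairAt-esym d S (K g) β))
        (orthogonal β (esymGen S d (subst (λ z → card S < d ℕ.+ z) (sym (threshold S)) h))) }
    where
    orthogonal : ∀ β {f} → IsGen n lam f → pairAt f (K g) β ≡ 0ℚ
    orthogonal β {f} i = begin
      pairAt f (K g) β                                ≡⟨ cong (pairAt f (K g)) (⊞-identityˡ β) ⟨
      pairAt f (K g) (replicate n 0 ⊞ β)              ≡⟨ pairAt-mono β f (K g) (replicate n 0) ⟨
      pairAt (mono β ⊗ f) (K g) (replicate n 0)       ≡⟨ ⟨⟩≡pairAt (mono β ⊗ f) g ⟨
      ⟨ mono β ⊗ f , g ⟩                              ≡⟨ harm (mono β ⊗ f) (mul (mono β) (gen i)) ⟩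
      0ℚ                                              ∎
      where open ≡-Reasoning

  harmonic⇒inHarmonic : Harmonic n lam (K g) → InHarmonic n lam g
  harmonic⇒inHarmonic harm f i = trans (⟨⟩≡pairAt f g) (orthogonal i (replicate n 0))
    where
    generator : ∀ {f} → IsGen n lam f → ∀ β → pairAt f (K g) β ≡ 0ℚ
    generator (powGen i)        β = trans (pairAt-var^ i s (K g) β) (Harmonic.power harm i (inc^ i s β) (lookup-inc^ i s β))
    generator (esymGen S d h)   β = trans (pairAt-esym d S (K g) β)
      (Harmonic.elementary harm S d β (subst (λ z → card S < d ℕ.+ z) (threshold S) h))
    -- All base points are needed at once, since `mul` moves them.
    orthogonal : ∀ {f} → InIdeal n lam f → ∀ β → pairAt f (K g) β ≡ 0ℚ
    orthogonal (gen i)           β = generator i β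
    orthogonal zer               β = refl
    orthogonal (add {f} {f′} i j) β = trans (∑-++ f f′ _) (cong₂ _+_ (orthogonal i β) (orthogonal j β))
    orthogonal (mul h {f} i)     β = trans (pairAt-⊗ h f (K g) β)
      (∑-zero h (λ z → trans (cong (proj₁ z *_) (orthogonal i (β ⊞ proj₂ z))) (ℚ.*-zeroʳ (proj₁ z))))
    orthogonal (resp {f} {f′} i e) β = trans (sym (pairAt-resp f f′ g β e)) (orthogonal i β)

-- From functions on monomials back to polynomials

span-⊞ : ∀ {lam : Vec ℕ s} α {G : Fn n} → Span n lam G → Span n lam (λ β → G (β ⊞ α))
span-⊞ {n = n} {lam} α {G} σ = resp (go (V.toList (allFin n))) (λ β → cong G (incs-allFin α β))
  where
  go : ∀ l → Span n lam (G ∘ incs α l)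
  go []      = σ
  go (i ∷ l) = span-shift^ i (lookup α i) (go l)

-- Acting by `h` is a linear combination of iterated shifts, so the ⊙-module also stays inside
-- `Span`.
span-pairAt : ∀ {lam : Vec ℕ s} (h : Poly n) {G : Fn n} → Span n lam G → Span n lam (pairAt h G)
span-pairAt []            σ = zer
span-pairAt ((c , α) ∷ h) σ = add (scal c (span-⊞ α σ)) (span-pairAt h σ)

base-span : ∀ {lam : Vec ℕ s} (T : Filling s n) → IsInj lam T → Span n lam (K (δ lam T))
base-span {lam = lam} T inj = resp (base (isInj⇒fills inj)) (λ α → sym (K-δ lam T α))

K-[] : ∀ α → K {n} [] α ≡ 0ℚ
K-[] α = ℚ.*-zeroʳ (fac α)

derivSpan⇒span : ∀ {lam : Vec ℕ s} {g : Poly n} → InDerivSpan n lam g → Span n lam (K g)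
derivSpan⇒span (base T inj)    = base-span T inj
derivSpan⇒span zer             = resp zer (λ α → sym (K-[] α))
derivSpan⇒span (add {f} {g} p q) = resp (add (derivSpan⇒span p) (derivSpan⇒span q)) (λ α → sym (K-⊕ f g α))
derivSpan⇒span (scal c {f} p)  = resp (scal c (derivSpan⇒span p)) (λ α → sym (K-· c f α))
derivSpan⇒span (der i {f} p)   = resp (shift i (derivSpan⇒span p)) (λ α → sym (K-∂ i f α))
derivSpan⇒span (resp {f} {g} p e) = resp (derivSpan⇒span p) (K-cong f g e)

odotModule⇒span : ∀ {lam : Vec ℕ s} {g : Poly n} → InOdotModule n lam g → Span n lam (K g)
odotModule⇒span (base T inj)    = base-span T inj
odotModule⇒span zer             = resp zer (λ α → sym (K-[] α))
odotModule⇒span (add {f} {g} p q) = resp (add (odotModule⇒span p) (odotModule⇒span q)) (λ α → sym (K-⊕ f g α))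
odotModule⇒span (act h {f} p)   = resp (span-pairAt h (odotModule⇒span p)) (λ α → sym (K-⊙ h f α))
odotModule⇒span (resp {f} {g} p e) = resp (odotModule⇒span p) (K-cong f g e)

span⇒derivSpan : ∀ {lam : Vec ℕ s} {G : Fn (suc n)} → Antitone lam → Span (suc n) lam G →
                 ∃ λ g → InDerivSpan (suc n) lam g × (∀ α → K g α ≡ G α)
span⇒derivSpan {lam = lam} anti (base f) with fills⇒δ anti f
... | T , inj , e = δ lam T , base T inj , e
span⇒derivSpan anti zer = [] , zer , K-[]
span⇒derivSpan anti (add p q) with span⇒derivSpan anti p | span⇒derivSpan anti q
... | f , mf , ef | g , mg , eg = f ⊕ g , add mf mg , λ α → trans (K-⊕ f g α) (cong₂ _+_ (ef α) (eg α))
span⇒derivSpan anti (scal c p) with span⇒derivSpan anti p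
... | f , mf , ef = c · f , scal c mf , λ α → trans (K-· c f α) (cong (c *_) (ef α))
span⇒derivSpan anti (shift i p) with span⇒derivSpan anti p
... | f , mf , ef = ∂ i f , der i mf , λ α → trans (K-∂ i f α) (ef (inc i α))
span⇒derivSpan anti (resp p e) with span⇒derivSpan anti p
... | f , mf , ef = f , mf , λ α → trans (ef α) (e α)

K-scalar : ∀ c (f : Poly n) α → K (((c , replicate n 0) ∷ []) ⊙ f) α ≡ c * K f α
K-scalar c f α = trans (K-⊙ ((c , replicate _ 0) ∷ []) f α)
  (trans (ℚ.+-identityʳ (c * K f (α ⊞ replicate _ 0))) (cong (λ β → c * K f β) (⊞-identityʳ α)))

K-var : ∀ i (f : Poly n) α → K (var i ⊙ f) α ≡ K f (inc i α)
K-var i f α = trans (K-⊙ (var i) f α) (trans (ℚ.+-identityʳ (1ℚ * K f (α ⊞ unitVec i))) (trans (ℚ.*-identityˡ (K f (α ⊞ unitVec i)))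
  (cong (K f) (trans (⊞-comm α (unitVec i)) (sym (inc≡⊞ i α))))))

derivSpan⇒odotModule : ∀ {lam : Vec ℕ s} {g : Poly n} → InDerivSpan n lam g → InOdotModule n lam g
derivSpan⇒odotModule (base T inj)   = base T inj
derivSpan⇒odotModule zer            = zer
derivSpan⇒odotModule (add p q)      = add (derivSpan⇒odotModule p) (derivSpan⇒odotModule q)
derivSpan⇒odotModule {n = n} (scal c {f} p) = resp (act ((c , replicate n 0) ∷ []) (derivSpan⇒odotModule p))
  (K-injective (((c , replicate n 0) ∷ []) ⊙ f) (c · f) (λ α → trans (K-scalar c f α) (sym (K-· c f α))))
derivSpan⇒odotModule (der i {f} p)  = resp (act (var i) (derivSpan⇒odotModule p))
  (K-injective (var i ⊙ f) (∂ i f) (λ α → trans (K-var i f α) (sym (K-∂ i f α))))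
derivSpan⇒odotModule (resp p e)     = resp (derivSpan⇒odotModule p) e

lookup≤sum : ∀ (lam : Vec ℕ s) i → lookup lam i ≤ V.sum lam
lookup≤sum (y ∷ lam) zero    = ℕ.m≤m+n y _
lookup≤sum (y ∷ lam) (suc i) = ℕ.≤-trans (lookup≤sum lam i) (ℕ.m≤n+m _ y)

theorem4p7 : (k n s : ℕ) → 1 ≤ k → k ≤ n → (lam : Vec ℕ s) → IsPartition k lam →
    (∀ (g : Poly n) → InHarmonic n lam g ⇔ InDerivSpan n lam g)
    × (∀ (g : Poly n) → InHarmonic n lam g ⇔ InOdotModule n lam g)
theorem4p7 zero    _       _       () _   _   _
theorem4p7 (suc k) zero    _       _  ()  _   _
theorem4p7 (suc k) (suc n) zero    _  _   []  (_ , ())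
theorem4p7 (suc k) (suc n) (suc s) _  k≤n lam (anti , sum≡k) =
  (λ g → mk⇔ (toDeriv g) (fromSpan g ∘ derivSpan⇒span)) ,
  (λ g → mk⇔ (derivSpan⇒odotModule ∘ toDeriv g) (fromSpan g ∘ odotModule⇒span))
  where
  λ≤n : ∀ i → lookup lam i ≤ suc n
  λ≤n i = ℕ.≤-trans (lookup≤sum lam i) (ℕ.≤-trans (ℕ.≤-reflexive sum≡k) k≤n)
  fromSpan : ∀ g → Span (suc n) lam (K g) → InHarmonic (suc n) lam g
  fromSpan g σ = harmonic⇒inHarmonic λ≤n g (span⇒harmonic (s≤s z≤n) σ)
  toDeriv : ∀ g → InHarmonic (suc n) lam g → InDerivSpan (suc n) lam g
  toDeriv g harm =
    let f , f∈ , e = span⇒derivSpan anti (harmonic⇒span (suc n) lam anti (inHarmonic⇒harmonic λ≤n g harm))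
    in resp f∈ (K-injective f g e)
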